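{- For every $\varepsilon'>0$ there exist $\delta=\delta(\varepsilon')>0$ and $\ell_0$ such that the following holds for every integer $\ell\ge\ell_0$, with $n=2\ell+1$. If $\mathcal{G}\subseteq 2^{[n]}$ is a $(1-\delta)$-$2$-generator for $[n]$ with $|\mathcal{G}|\le 2^{\lfloor n/2\rfloor}+2^{\lceil n/2\rceil}=3\cdot 2^{\ell}$, then there exists $S\subseteq[n]$ with $|S|=\ell$ such that the family $\mathcal{F}_0=\{A: A\subseteq S\}\cup\{B: B\subseteq [n]\setminus S\}$ satisfies $|\mathcal{G}\,\Delta\,\mathcal{F}_0|\le \varepsilon' 2^{\ell}$.
   Context: A family $\mathcal{H}\subseteq 2^{[n]}$ is a $(1-\varepsilon)$-$k$-generator for $[n]$ if all but at most $\varepsilon 2^n$ subsets of $[n]$ can be expressed as a union of at most $k$ pairwise disjoint sets of $\mathcal{H}$. $\Delta$ denotes symmetric difference. -}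

module Defs where

open import Data.Bool using (Bool; true; false; _∧_; _∨_; not; if_then_else_)
open import Data.Nat using (ℕ; zero; suc; _+_; _*_; _^_)
open import Data.Vec using (Vec; []; _∷_; zipWith; replicate)
open import Data.List using (List; []; _∷_; map; _++_; length; filter)
open import Data.Bool.ListAction using (any)
open import Data.Bool using (T?)
open import Data.Fin.Subset using (Subset; _∪_; _∩_; ∁; ⊥; ⊤; inside; outside)

-- A family H ⊆ 2^[n] is represented by its (Boolean) characteristic
-- function on subsets of [n] = Fin n.  Since 2^[n] is finite this covers
-- every family.
Family : ℕ → Set
Family n = Subset n → Bool

allSubsets : (n : ℕ) → List (Subset n)
allSubsets zero = [] ∷ []
allSubsets (suc n) = map (outside ∷_) (allSubsets n) ++ map (inside ∷_) (allSubsets n)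

eqᵇ : ∀ {n} → Subset n → Subset n → Bool
eqᵇ [] [] = true
eqᵇ (x ∷ xs) (y ∷ ys) = (if x then y else not y) ∧ eqᵇ xs ys

disjointᵇ : ∀ {n} → Subset n → Subset n → Bool
disjointᵇ A B = eqᵇ (A ∩ B) ⊥

subsetᵇ : ∀ {n} → Subset n → Subset n → Bool
subsetᵇ A B = eqᵇ (A ∩ B) A

countᵇ : ∀ {n} → (Subset n → Bool) → ℕ
countᵇ {n} P = length (filter (λ A → T? (P A)) (allSubsets n))

card : ∀ {n} → Family n → ℕ
card F = countᵇ F

_Δ_ : ∀ {n} → Family n → Family n → Family n
(F Δ G) A = (F A ∧ not (G A)) ∨ (G A ∧ not (F A))

-- A is the union of at most 2 pairwise disjoint members of H:
-- 0 sets (A = ∅), 1 set (A ∈ H), or 2 disjoint sets B, C ∈ H with B ∪ C = A.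
-- (Two sets are taken distinct automatically: disjoint equal sets are ∅,
-- whose case is covered by the 0/1-set cases.)
union≤2ᵇ : ∀ {n} → Family n → Subset n → Bool
union≤2ᵇ {n} H A =
  eqᵇ A ⊥ ∨ H A ∨
  any (λ B → any (λ C → H B ∧ H C ∧ disjointᵇ B C ∧ eqᵇ (B ∪ C) A) (allSubsets n)) (allSubsets n)

nonGenerated2 : ∀ {n} → Family n → ℕ
nonGenerated2 H = countᵇ (λ A → not (union≤2ᵇ H A))

F₀ : ∀ {n} → Subset n → Family n
F₀ S A = subsetᵇ A S ∨ subsetᵇ A (∁ S)

{-# OPTIONS --safe #-}

-- Write N = 2^ℓ, and join two members of G by an edge when they are disjoint.
--
-- The union of a random bounded tuple in a family of size about 2^(n/2) almost never
-- has fewer than (1/2 - γ) n elements. A positive density of triangles or pentagons in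
-- the graph would blow up to cyclically disjoint unions of that size, which do not fit
-- in [n]; so there are few triangles and pentagons. As G generates almost all sets, the
-- graph has about 4N² ordered edges on 3N vertices, so the average of d(u) + d(v) over
-- the edges uv is at least about (8/3) N. The neighbourhoods of such an edge uv are
-- nearly independent, and, by the lack of pentagons, each remaining set attaches to at
-- most one of them; those that attach to none form a small family F. This gives disjoint
-- X, Y ⊆ G such that all but about |F| N/2 sets are unions of disjoint pairs in X × Y.
--
-- Counting the covered sets that contain i shows that each i belongs to at least
-- 8/25 of X or of Y; let S collect the elements of the first kind. A member of X not
-- inside S is then disjoint from at most 17/25 of Y, and vice versa, so most of X lies
-- inside S and most of Y outside, which forces |S| = ℓ up to exchanging X and Y. The sets
-- whose trace τ on the complement of S is missing from Y are expensive: they need pairs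
-- with a member on the wrong side, and distinct sets with the same τ need distinct ones.
-- Balancing this against |G| ≤ 3N shows that few sets are missing or on the wrong side.

module Submission where

open import Defs
open import Data.Bool using (Bool; true; false; _∧_; _∨_; not; T; T?)
import Data.Bool as Bool
open import Data.Bool.ListAction using (any)
open import Data.Bool.Properties using (∧-comm; ∧-identityʳ)
open import Data.Empty using () renaming (⊥ to Void)
open import Data.Fin using (Fin; zero; suc)
open import Data.Fin.Subset using (Subset; _∪_; _∩_; ∁; ⊥; ∣_∣)
open import Data.Fin.Subset.Properties using (anySubset?; ∪-idem; ∪-comm; ∩-comm)
import Data.Integer as ℤ
import Data.Integer.Properties as ℤ
open import Data.List using (List; []; _∷_; map; _++_; length; filter; cartesianProduct)
open import Data.List.Properties using (length-++; length-map)
open import Data.Nat hiding (_/_)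
import Data.Nat as ℕ
open import Data.Nat.Coprimality using (Coprime; 1-coprimeTo)
open import Data.Nat.DivMod using (m≡m%n+[m/n]*n; m%n<n; /-monoˡ-≤; m*n/n≡m)
open import Data.Nat.Properties
open import Data.Nat.Tactic.RingSolver using (solve-∀)
open import Data.Product using (Σ; ∃; _×_; _,_; proj₁; proj₂)
open import Data.Rational.Properties using (toℚᵘ-homo-*; toℚᵘ-fromℚᵘ; toℚᵘ-mono-≤; toℚᵘ-cancel-≤)
open import Data.Rational.Unnormalised using (mkℚᵘ; *≤*) renaming (_*_ to _*ᵘ_; _≃_ to _≃ᵘ_)
import Data.Rational.Unnormalised.Properties as ℚᵘ
open import Data.Sum using (_⊎_; inj₁; inj₂; [_,_]′)
open import Data.Unit using (tt) renaming (⊤ to Unit)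
open import Data.Vec using (Vec; []; _∷_; lookup; tabulate)
import Data.Vec as Vec
open import Data.Vec.Properties using (≡-dec; lookup-zipWith; lookup-map; lookup∘tabulate)
open import Relation.Binary.PropositionalEquality
open import Relation.Nullary using (¬_; Dec; yes; no; does; contradiction)
open import Relation.Nullary.Decidable using (_×-dec_)

-- Sums and counting

-- Sizes alone cannot force the structure: two sides of 3N/2 sets each have 9/4 N² pairs, more than
-- the 2N² sets to be covered. Single elements force it. If i lay in at most a fraction θ < 1/3 of X
-- and of Y, at most 2θ(1-θ)(9/4)N² < N² disjoint pairs would have a union containing i, yet N² sets
-- contain i; 8/25 is such a θ, with room for the errors. The family F is tolerable because its
-- members are poor value: each takes one unit of the budget 3N and accounts for at most about N/2
-- sets, whereas in the extremal family a member of a side accounts for N or 2N. This needs at most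
-- N/2 sets adjacent to neither end of uv, which fixes the demand d(u) + d(v) ≥ (13/5)N, slightly
-- below the average (8/3)N: with a codegree of at most N/10, inclusion-exclusion leaves 3N + N/10 -
-- (13/5)N = N/2. Estimates stay in the natural numbers: "x is at most N²/K" is written
-- `K * x ≤ N * N`.

𝟙 : Bool → ℕ
𝟙 true  = 1
𝟙 false = 0

𝟙≤1 : ∀ b → 𝟙 b ≤ 1
𝟙≤1 true  = ≤-refl
𝟙≤1 false = z≤n

𝟙-∧ : ∀ a b → 𝟙 (a ∧ b) ≡ 𝟙 a * 𝟙 b
𝟙-∧ true  b = sym (+-identityʳ _)
𝟙-∧ false b = refl

𝟙*≤ : ∀ b {m k} → (b ≡ true → m ≤ k) → 𝟙 b * m ≤ k
𝟙*≤ true  h = ≤-trans (≤-reflexive (+-identityʳ _)) (h refl)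
𝟙*≤ false h = z≤n

𝟙≤ : ∀ b {k} → (b ≡ true → 1 ≤ k) → 𝟙 b ≤ k
𝟙≤ true  h = h refl
𝟙≤ false h = z≤n

∑ : ∀ {a} {A : Set a} → List A → (A → ℕ) → ℕ
∑ []       f = 0
∑ (x ∷ xs) f = f x + ∑ xs f

module _ {a} {A : Set a} where

  ∑-cong : ∀ (xs : List A) {f g} → (∀ x → f x ≡ g x) → ∑ xs f ≡ ∑ xs g
  ∑-cong []       h = refl
  ∑-cong (x ∷ xs) h = cong₂ _+_ (h x) (∑-cong xs h)

  ∑-mono : ∀ (xs : List A) {f g} → (∀ x → f x ≤ g x) → ∑ xs f ≤ ∑ xs g
  ∑-mono []       h = z≤n
  ∑-mono (x ∷ xs) h = +-mono-≤ (h x) (∑-mono xs h)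

  ∑-zero : ∀ (xs : List A) → ∑ xs (λ _ → 0) ≡ 0
  ∑-zero []       = refl
  ∑-zero (x ∷ xs) = ∑-zero xs

  ∑-+ : ∀ (xs : List A) f g → ∑ xs (λ x → f x + g x) ≡ ∑ xs f + ∑ xs g
  ∑-+ []       f g = refl
  ∑-+ (x ∷ xs) f g = trans (cong (f x + g x +_) (∑-+ xs f g)) (lemma (f x) (g x) _ _)
    where lemma : ∀ a b c d → a + b + (c + d) ≡ a + c + (b + d)
          lemma = solve-∀

  ∑-*ˡ : ∀ c (xs : List A) f → ∑ xs (λ x → c * f x) ≡ c * ∑ xs f
  ∑-*ˡ c []       f = sym (*-zeroʳ c)
  ∑-*ˡ c (x ∷ xs) f = trans (cong (c * f x +_) (∑-*ˡ c xs f)) (sym (*-distribˡ-+ c (f x) _))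

  ∑-*ʳ : ∀ c (xs : List A) f → ∑ xs (λ x → f x * c) ≡ ∑ xs f * c
  ∑-*ʳ c xs f = trans (∑-cong xs (λ x → *-comm (f x) c)) (trans (∑-*ˡ c xs f) (*-comm c _))

  ∑-const : ∀ c (xs : List A) → ∑ xs (λ _ → c) ≡ length xs * c
  ∑-const c []       = refl
  ∑-const c (x ∷ xs) = cong (c +_) (∑-const c xs)

  ∑-≤const : ∀ c (xs : List A) f → (∀ x → f x ≤ c) → ∑ xs f ≤ length xs * c
  ∑-≤const c xs f h = ≤-trans (∑-mono xs h) (≤-reflexive (∑-const c xs))

  ∑-++ : ∀ (xs ys : List A) f → ∑ (xs ++ ys) f ≡ ∑ xs f + ∑ ys f
  ∑-++ []       ys f = refl
  ∑-++ (x ∷ xs) ys f = trans (cong (f x +_) (∑-++ xs ys f)) (sym (+-assoc (f x) _ _))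

  ∑-filter : ∀ (p : A → Bool) (xs : List A) f →
             ∑ (filter (λ x → T? (p x)) xs) f ≡ ∑ xs (λ x → 𝟙 (p x) * f x)
  ∑-filter p []       f = refl
  ∑-filter p (x ∷ xs) f with p x
  ... | true  = cong₂ _+_ (sym (+-identityʳ _)) (∑-filter p xs f)
  ... | false = ∑-filter p xs f

  length-∑ : ∀ (xs : List A) → length xs ≡ ∑ xs (λ _ → 1)
  length-∑ xs = sym (trans (∑-const 1 xs) (*-identityʳ _))

∑-map : ∀ {a b} {A : Set a} {B : Set b} (g : A → B) (xs : List A) f →
        ∑ (map g xs) f ≡ ∑ xs (λ x → f (g x))
∑-map g []       f = refl
∑-map g (x ∷ xs) f = cong (f (g x) +_) (∑-map g xs f)

module _ {a b} {A : Set a} {B : Set b} where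

  ∑-swap : ∀ (xs : List A) (ys : List B) (f : A → B → ℕ) →
           ∑ xs (λ x → ∑ ys (f x)) ≡ ∑ ys (λ y → ∑ xs (λ x → f x y))
  ∑-swap []       ys f = sym (∑-zero ys)
  ∑-swap (x ∷ xs) ys f = trans (cong (∑ ys (f x) +_) (∑-swap xs ys f)) (sym (∑-+ ys (f x) _))

  ∑-× : ∀ (xs : List A) (ys : List B) f →
        ∑ (cartesianProduct xs ys) f ≡ ∑ xs (λ x → ∑ ys (λ y → f (x , y)))
  ∑-× []       ys f = refl
  ∑-× (x ∷ xs) ys f = trans (∑-++ (map (x ,_) ys) _ f) (cong₂ _+_ (∑-map (x ,_) ys f) (∑-× xs ys f))

  ∑-product : ∀ (xs : List A) (ys : List B) f g →
              ∑ xs (λ x → ∑ ys (λ y → f x * g y)) ≡ ∑ xs f * ∑ ys g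
  ∑-product xs ys f g = trans (∑-cong xs (λ x → ∑-*ˡ (f x) ys g)) (∑-*ʳ _ xs f)

2ab≤a²+b² : ∀ a b → 2 * (a * b) ≤ a * a + b * b
2ab≤a²+b² a b with ≤-total a b
... | inj₁ a≤b with k , refl ← m≤n⇒∃[o]m+o≡n a≤b =
  ≤-trans (m≤m+n _ (k * k)) (≤-reflexive (lemma a k))
  where lemma : ∀ a k → 2 * (a * (a + k)) + k * k ≡ a * a + (a + k) * (a + k)
        lemma = solve-∀
... | inj₂ b≤a with k , refl ← m≤n⇒∃[o]m+o≡n b≤a =
  ≤-trans (m≤m+n _ (k * k)) (≤-reflexive (lemma b k))
  where lemma : ∀ a k → 2 * ((a + k) * a) + k * k ≡ (a + k) * (a + k) + a * a
        lemma = solve-∀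

∑-cauchy : ∀ {a} {A : Set a} (xs : List A) f →
           ∑ xs f * ∑ xs f ≤ length xs * ∑ xs (λ x → f x * f x)
∑-cauchy xs f = *-cancelˡ-≤ 2 (begin
  2 * (∑ xs f * ∑ xs f)                                  ≡⟨ cong (2 *_) (sym (∑-product xs xs f f)) ⟩
  2 * ∑ xs (λ x → ∑ xs (λ y → f x * f y))                ≡⟨ sym (∑-*ˡ 2 xs _) ⟩
  ∑ xs (λ x → 2 * ∑ xs (λ y → f x * f y))                ≡⟨ ∑-cong xs (λ x → sym (∑-*ˡ 2 xs _)) ⟩
  ∑ xs (λ x → ∑ xs (λ y → 2 * (f x * f y)))              ≤⟨ ∑-mono xs (λ x → ∑-mono xs (λ y → 2ab≤a²+b² (f x) (f y))) ⟩
  ∑ xs (λ x → ∑ xs (λ y → f x * f x + f y * f y))        ≡⟨ ∑-cong xs (λ x → trans (∑-+ xs _ _) (cong (_+ Q) (∑-const _ xs))) ⟩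
  ∑ xs (λ x → length xs * (f x * f x) + Q)               ≡⟨ ∑-+ xs _ _ ⟩
  ∑ xs (λ x → length xs * (f x * f x)) + ∑ xs (λ _ → Q)  ≡⟨ cong₂ _+_ (∑-*ˡ (length xs) xs _) (∑-const Q xs) ⟩
  length xs * Q + length xs * Q                          ≡⟨ lemma (length xs * Q) ⟩
  2 * (length xs * Q)                                    ∎)
  where
  open ≤-Reasoning
  Q = ∑ xs (λ x → f x * f x)
  lemma : ∀ a → a + a ≡ 2 * a
  lemma = solve-∀

-- Sums over all subsets

all : ∀ n → List (Subset n)
all = allSubsets

∑-all-suc : ∀ {n} (f : Subset (suc n) → ℕ) →
            ∑ (all (suc n)) f ≡ ∑ (all n) (λ A → f (false ∷ A)) + ∑ (all n) (λ A → f (true ∷ A))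
∑-all-suc {n} f = trans (∑-++ (map (false ∷_) (all n)) _ f)
                        (cong₂ _+_ (∑-map _ (all n) f) (∑-map _ (all n) f))

length-all : ∀ n → length (all n) ≡ 2 ^ n
length-all zero    = refl
length-all (suc n) = trans (length-++ (map (false ∷_) (all n)))
  (cong₂ _+_ (trans (length-map _ (all n)) (length-all n))
             (trans (trans (length-map _ (all n)) (length-all n)) (sym (+-identityʳ _))))

≤∑ : ∀ {n} (f : Subset n → ℕ) A → f A ≤ ∑ (all n) f
≤∑ f []          = m≤m+n _ _
≤∑ f (false ∷ A) = ≤-trans (≤∑ (λ A → f (false ∷ A)) A) (≤-trans (m≤m+n _ _) (≤-reflexive (sym (∑-all-suc f))))
≤∑ f (true ∷ A)  = ≤-trans (≤∑ (λ A → f (true ∷ A)) A) (≤-trans (m≤n+m _ _) (≤-reflexive (sym (∑-all-suc f))))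

≤∑-distinct : ∀ {n} (f : Subset n → ℕ) A B → ¬ A ≡ B → f A + f B ≤ ∑ (all n) f
≤∑-distinct f [] [] A≢B = contradiction refl A≢B
≤∑-distinct f (false ∷ A) (false ∷ B) ne =
  ≤-trans (≤∑-distinct (λ A → f (false ∷ A)) A B (λ e → ne (cong (false ∷_) e)))
          (≤-trans (m≤m+n _ _) (≤-reflexive (sym (∑-all-suc f))))
≤∑-distinct f (true ∷ A) (true ∷ B) ne =
  ≤-trans (≤∑-distinct (λ A → f (true ∷ A)) A B (λ e → ne (cong (true ∷_) e)))
          (≤-trans (m≤n+m _ _) (≤-reflexive (sym (∑-all-suc f))))
≤∑-distinct f (false ∷ A) (true ∷ B) ne =
  ≤-trans (+-mono-≤ (≤∑ (λ A → f (false ∷ A)) A) (≤∑ (λ A → f (true ∷ A)) B)) (≤-reflexive (sym (∑-all-suc f)))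
≤∑-distinct f (true ∷ A) (false ∷ B) ne =
  ≤-trans (≤-reflexive (+-comm (f (true ∷ A)) _))
  (≤-trans (+-mono-≤ (≤∑ (λ A → f (false ∷ A)) B) (≤∑ (λ A → f (true ∷ A)) A)) (≤-reflexive (sym (∑-all-suc f))))

# : ∀ {n} → (Subset n → Bool) → ℕ
# {n} P = ∑ (all n) (λ A → 𝟙 (P A))

countᵇ≡# : ∀ {n} (P : Subset n → Bool) → countᵇ P ≡ # P
countᵇ≡# {n} P = trans (length-∑ (filter (λ A → T? (P A)) (all n)))
  (trans (∑-filter P (all n) (λ _ → 1)) (∑-cong (all n) (λ A → *-identityʳ _)))

#-true : ∀ n → # {n} (λ _ → true) ≡ 2 ^ n
#-true n = trans (∑-const 1 (all n)) (trans (*-identityʳ _) (length-all n))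

#-mono : ∀ {n} {P Q : Subset n → Bool} → (∀ A → P A ≡ true → Q A ≡ true) → # P ≤ # Q
#-mono {n} h = ∑-mono (all n) (λ A → 𝟙≤ _ (λ p → ≤-reflexive (cong 𝟙 (sym (h A p)))))

eqᵇ-refl : ∀ {n} (A : Subset n) → eqᵇ A A ≡ true
eqᵇ-refl []          = refl
eqᵇ-refl (true ∷ A)  = eqᵇ-refl A
eqᵇ-refl (false ∷ A) = eqᵇ-refl A

eqᵇ⇒≡ : ∀ {n} (A B : Subset n) → eqᵇ A B ≡ true → A ≡ B
eqᵇ⇒≡ []          []          e = refl
eqᵇ⇒≡ (true ∷ A)  (true ∷ B)  e = cong (true ∷_) (eqᵇ⇒≡ A B e)
eqᵇ⇒≡ (false ∷ A) (false ∷ B) e = cong (false ∷_) (eqᵇ⇒≡ A B e)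

#-singleton : ∀ {n} (A : Subset n) → # (eqᵇ A) ≡ 1
#-singleton []                  = refl
#-singleton {suc n} (true ∷ A)  = trans (∑-all-suc (λ B → 𝟙 (eqᵇ (true ∷ A) B)))
  (cong₂ _+_ (∑-zero (all n)) (#-singleton A))
#-singleton {suc n} (false ∷ A) = trans (∑-all-suc (λ B → 𝟙 (eqᵇ (false ∷ A) B)))
  (cong₂ _+_ (#-singleton A) (∑-zero (all n)))

-- A weighted union bound: every set of `P` is hit with total weight at least 1, and each index `j`
-- spends its weight on the single set `g j`.
#-image : ∀ {n i} {I : Set i} (P : Subset n → Bool) (is : List I) (w : I → ℕ) (g : I → Subset n) →
          (∀ A → P A ≡ true → 1 ≤ ∑ is (λ j → w j * 𝟙 (eqᵇ (g j) A))) → # P ≤ ∑ is w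
#-image {n} P is w g h = begin
  # P                                                  ≤⟨ ∑-mono (all n) (λ A → 𝟙≤ (P A) (h A)) ⟩
  ∑ (all n) (λ A → ∑ is (λ j → w j * 𝟙 (eqᵇ (g j) A))) ≡⟨ ∑-swap (all n) is _ ⟩
  ∑ is (λ j → ∑ (all n) (λ A → w j * 𝟙 (eqᵇ (g j) A))) ≡⟨ ∑-cong is (λ j → trans (∑-*ˡ (w j) (all n) _)
                                                            (trans (cong (w j *_) (#-singleton (g j))) (*-identityʳ _))) ⟩
  ∑ is w                                               ∎
  where open ≤-Reasoning

-- Set algebra

opaque

  -- Opaque, so that the sets `A` and `B` can be inferred from `D A B ≡ true`.
  D : ∀ {n} → Subset n → Subset n → Bool
  D = disjointᵇ

  D-def : ∀ {n} (A B : Subset n) → D A B ≡ disjointᵇ A B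
  D-def A B = refl

opaque
  unfolding D

  D-sym : ∀ {n} (A B : Subset n) → D A B ≡ D B A
  D-sym []          []          = refl
  D-sym (true ∷ A)  (true ∷ B)  = refl
  D-sym (true ∷ A)  (false ∷ B) = D-sym A B
  D-sym (false ∷ A) (true ∷ B)  = D-sym A B
  D-sym (false ∷ A) (false ∷ B) = D-sym A B

  D-⊥ : ∀ {n} (B : Subset n) → D ⊥ B ≡ true
  D-⊥ []      = refl
  D-⊥ (x ∷ B) = D-⊥ B

∧-false : ∀ b → b ∧ false ≡ false
∧-false true  = refl
∧-false false = refl

opaque
  unfolding D

  D-∪ : ∀ {n} (A B C : Subset n) → D (A ∪ B) C ≡ D A C ∧ D B C
  D-∪ []          []          []          = refl
  D-∪ (true ∷ A)  (b ∷ B)     (true ∷ C)  = refl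
  D-∪ (true ∷ A)  (true ∷ B)  (false ∷ C) = D-∪ A B C
  D-∪ (true ∷ A)  (false ∷ B) (false ∷ C) = D-∪ A B C
  D-∪ (false ∷ A) (true ∷ B)  (true ∷ C)  = sym (∧-false _)
  D-∪ (false ∷ A) (false ∷ B) (true ∷ C)  = D-∪ A B C
  D-∪ (false ∷ A) (true ∷ B)  (false ∷ C) = D-∪ A B C
  D-∪ (false ∷ A) (false ∷ B) (false ∷ C) = D-∪ A B C

opaque

  _⊆ᵇ_ : ∀ {n} → Subset n → Subset n → Bool
  _⊆ᵇ_ = subsetᵇ

  ⊆ᵇ-def : ∀ {n} (A B : Subset n) → A ⊆ᵇ B ≡ subsetᵇ A B
  ⊆ᵇ-def A B = refl

opaque
  unfolding _⊆ᵇ_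

  ∪-⊆ᵇ : ∀ {n} (A B C : Subset n) → (A ∪ B) ⊆ᵇ C ≡ (A ⊆ᵇ C) ∧ (B ⊆ᵇ C)
  ∪-⊆ᵇ []          []          []          = refl
  ∪-⊆ᵇ (true ∷ A)  (true ∷ B)  (true ∷ C)  = ∪-⊆ᵇ A B C
  ∪-⊆ᵇ (true ∷ A)  (false ∷ B) (true ∷ C)  = ∪-⊆ᵇ A B C
  ∪-⊆ᵇ (true ∷ A)  (b ∷ B)     (false ∷ C) = refl
  ∪-⊆ᵇ (false ∷ A) (true ∷ B)  (true ∷ C)  = ∪-⊆ᵇ A B C
  ∪-⊆ᵇ (false ∷ A) (false ∷ B) (true ∷ C)  = ∪-⊆ᵇ A B C
  ∪-⊆ᵇ (false ∷ A) (true ∷ B)  (false ∷ C) = sym (∧-false _)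
  ∪-⊆ᵇ (false ∷ A) (false ∷ B) (false ∷ C) = ∪-⊆ᵇ A B C

  ⊥-⊆ᵇ : ∀ {n} (C : Subset n) → ⊥ ⊆ᵇ C ≡ true
  ⊥-⊆ᵇ []      = refl
  ⊥-⊆ᵇ (x ∷ C) = ⊥-⊆ᵇ C

  ⊆ᵇ-refl : ∀ {n} (A : Subset n) → A ⊆ᵇ A ≡ true
  ⊆ᵇ-refl []          = refl
  ⊆ᵇ-refl (true ∷ A)  = ⊆ᵇ-refl A
  ⊆ᵇ-refl (false ∷ A) = ⊆ᵇ-refl A

  #-powerset : ∀ {n} (S : Subset n) → # (_⊆ᵇ S) ≡ 2 ^ ∣ S ∣
  #-powerset []                  = refl
  #-powerset {suc n} (true ∷ S)  = trans (∑-all-suc (λ A → 𝟙 (A ⊆ᵇ (true ∷ S))))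
    (cong₂ _+_ (#-powerset S) (trans (#-powerset S) (sym (+-identityʳ _))))
  #-powerset {suc n} (false ∷ S) = trans (∑-all-suc (λ A → 𝟙 (A ⊆ᵇ (false ∷ S))))
    (trans (cong₂ _+_ (#-powerset S) (∑-zero (all n))) (+-identityʳ _))

-- Blow-ups

^-double : ∀ x k → x ^ (2 ^ suc k) ≡ x ^ (2 ^ k) * x ^ (2 ^ k)
^-double x k = trans (cong (λ e → x ^ (2 ^ k + e)) (+-identityʳ (2 ^ k))) (^-distribˡ-+-* x (2 ^ k) (2 ^ k))

^-distrib-* : ∀ t a b → (a * b) ^ t ≡ a ^ t * b ^ t
^-distrib-* zero    a b = refl
^-distrib-* (suc t) a b = trans (cong (a * b *_) (^-distrib-* t a b)) (lemma a b (a ^ t) (b ^ t))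
  where lemma : ∀ a b x y → a * b * (x * y) ≡ a * x * (b * y)
        lemma = solve-∀

-- The power mean inequality; for exponents `2 ^ k` it follows by applying Cauchy-Schwarz `k` times.
power-mean : ∀ {a} {I : Set a} k (is : List I) (f : I → ℕ) N M q → length is ≤ M → 0 < M →
             N * M ≤ q * ∑ is f → N ^ (2 ^ k) * M ≤ q ^ (2 ^ k) * ∑ is (λ i → f i ^ (2 ^ k))
power-mean zero is f N M q len M>0 h =
  subst₂ _≤_ (cong (_* M) (sym (*-identityʳ N)))
    (cong₂ _*_ (sym (*-identityʳ q)) (∑-cong is (λ i → sym (*-identityʳ (f i))))) h
power-mean (suc k) is f N M q len M>0 h = *-cancelˡ-≤ M {{>-nonZero M>0}} (begin
  M * (N ^ (2 ^ suc k) * M)     ≡⟨ cong (λ x → M * (x * M)) (^-double N k) ⟩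
  M * (a * a * M)               ≡⟨ lemma₁ M a ⟩
  (a * M) * (a * M)             ≤⟨ *-mono-≤ ih ih ⟩
  (b * S) * (b * S)             ≡⟨ lemma₂ b S ⟩
  b * b * (S * S)               ≤⟨ *-monoʳ-≤ (b * b) (≤-trans (∑-cauchy is g) (*-monoˡ-≤ Q len)) ⟩
  b * b * (M * Q)               ≡⟨ lemma₃ (b * b) M Q ⟩
  M * (b * b * Q)               ≡⟨ cong₂ (λ x y → M * (x * y)) (sym (^-double q k))
                                     (∑-cong is (λ i → sym (^-double (f i) k))) ⟩
  M * (q ^ (2 ^ suc k) * ∑ is (λ i → f i ^ (2 ^ suc k))) ∎)
  where
  open ≤-Reasoning
  a = N ^ (2 ^ k)
  b = q ^ (2 ^ k)
  g = λ i → f i ^ (2 ^ k)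
  S = ∑ is g
  Q = ∑ is (λ i → g i * g i)
  ih = power-mean k is f N M q len M>0 h
  lemma₁ : ∀ M a → M * (a * a * M) ≡ (a * M) * (a * M)
  lemma₁ = solve-∀
  lemma₂ : ∀ b S → (b * S) * (b * S) ≡ b * b * (S * S)
  lemma₂ = solve-∀
  lemma₃ : ∀ b M Q → b * (M * Q) ≡ M * (b * Q)
  lemma₃ = solve-∀

^-*𝟙 : ∀ d b t → 0 < t → (d * 𝟙 b) ^ t ≡ d ^ t * 𝟙 b
^-*𝟙 d true  t       _ = trans (cong (_^ t) (*-identityʳ d)) (sym (*-identityʳ _))
^-*𝟙 d false (suc t) _ = trans (cong (_* (d * 0) ^ t) (*-zeroʳ d)) (sym (*-zeroʳ (d ^ suc t)))

opaque

  -- The loss of density in one blow-up: density 1/q becomes 1/`grow k q`. The base `3 * q` compares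
  -- the `(3 * N) ^ t` tuples with their mean `(N / q) ^ t`, and the factor 4 leaves room for the
  -- tuples with a small union.
  grow : ℕ → ℕ → ℕ
  grow k q = 4 * (3 * q) ^ (2 ^ k)

  grow-def : ∀ k q → grow k q ≡ 4 * (3 * q) ^ (2 ^ k)
  grow-def k q = refl

module Blowup {n} (gs : List (Subset n)) where

  -- The unnormalised expectation of `h` at the union of `t` independent random members of `gs`.
  tup : ℕ → (Subset n → ℕ) → ℕ
  tup zero    h = h ⊥
  tup (suc t) h = ∑ gs (λ v → tup t (λ U → h (v ∪ U)))

  tup-mono : ∀ t {h k} → (∀ U → h U ≤ k U) → tup t h ≤ tup t k
  tup-mono zero    le = le ⊥
  tup-mono (suc t) le = ∑-mono gs (λ v → tup-mono t (λ U → le (v ∪ U)))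

  tup-cong : ∀ t {h k} → (∀ U → h U ≡ k U) → tup t h ≡ tup t k
  tup-cong zero    e = e ⊥
  tup-cong (suc t) e = ∑-cong gs (λ v → tup-cong t (λ U → e (v ∪ U)))

  tup-const : ∀ t c → tup t (λ _ → c) ≡ length gs ^ t * c
  tup-const zero    c = sym (+-identityʳ c)
  tup-const (suc t) c = trans (∑-cong gs (λ v → tup-const t c))
    (trans (∑-const _ gs) (sym (*-assoc (length gs) _ c)))

  tup-+ : ∀ t h k → tup t (λ U → h U + k U) ≡ tup t h + tup t k
  tup-+ zero    h k = refl
  tup-+ (suc t) h k = trans (∑-cong gs (λ v → tup-+ t (λ U → h (v ∪ U)) (λ U → k (v ∪ U)))) (∑-+ gs _ _)

  tup-*ˡ : ∀ t c h → tup t (λ U → c * h U) ≡ c * tup t h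
  tup-*ˡ zero    c h = refl
  tup-*ˡ (suc t) c h = trans (∑-cong gs (λ v → tup-*ˡ t c (λ U → h (v ∪ U)))) (∑-*ˡ c gs _)

  module _ {a} {I : Set a} (is : List I) (φ : Subset n → I → Bool)
           (φ-∪ : ∀ A B i → φ (A ∪ B) i ≡ φ A i ∧ φ B i) (φ-⊥ : ∀ i → φ ⊥ i ≡ true) where

    deg : I → ℕ
    deg i = ∑ gs (λ v → 𝟙 (φ v i))

    -- A union is compatible with `i` exactly when every entry of the tuple is, so `deg i ^ t`
    -- tuples are compatible with `i`.
    tup-product : ∀ t (c : I → ℕ) →
                  tup t (λ U → ∑ is (λ i → 𝟙 (φ U i) * c i)) ≡ ∑ is (λ i → deg i ^ t * c i)
    tup-product zero    c = ∑-cong is (λ i → cong (λ b → 𝟙 b * c i) (φ-⊥ i))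
    tup-product (suc t) c = begin
      ∑ gs (λ v → tup t (λ U → ∑ is (λ i → 𝟙 (φ (v ∪ U) i) * c i)))
        ≡⟨ ∑-cong gs (λ v → tup-cong t (λ U → ∑-cong is (λ i →
             trans (cong (λ b → 𝟙 b * c i) (φ-∪ v U i))
             (trans (cong (_* c i) (𝟙-∧ (φ v i) (φ U i))) (lemma₁ (𝟙 (φ v i)) _ (c i)))))) ⟩
      ∑ gs (λ v → tup t (λ U → ∑ is (λ i → 𝟙 (φ U i) * (𝟙 (φ v i) * c i))))
        ≡⟨ ∑-cong gs (λ v → tup-product t (λ i → 𝟙 (φ v i) * c i)) ⟩
      ∑ gs (λ v → ∑ is (λ i → deg i ^ t * (𝟙 (φ v i) * c i)))
        ≡⟨ ∑-swap gs is _ ⟩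
      ∑ is (λ i → ∑ gs (λ v → deg i ^ t * (𝟙 (φ v i) * c i)))
        ≡⟨ ∑-cong is (λ i → trans (∑-*ˡ (deg i ^ t) gs _)
             (trans (cong (deg i ^ t *_) (∑-*ʳ (c i) gs _)) (lemma₂ (deg i ^ t) (deg i) (c i)))) ⟩
      ∑ is (λ i → deg i ^ suc t * c i) ∎
      where
      open ≡-Reasoning
      lemma₁ : ∀ a b c → a * b * c ≡ b * (a * c)
      lemma₁ = solve-∀
      lemma₂ : ∀ a b c → a * (b * c) ≡ b * a * c
      lemma₂ = solve-∀

  module _ (sparse : ∀ S → ∑ gs (λ v → 𝟙 (v ⊆ᵇ S)) ≤ 2 ^ ∣ S ∣) where

    -- A union bound over the at most `2 ^ n` small sets `S` that contain the union: by `sparse`, at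
    -- most `(2 ^ s) ^ t` tuples have all their entries inside such an `S`.
    few-small-unions : ∀ t s → tup t (λ U → 𝟙 (∣ U ∣ ≤ᵇ s)) ≤ 2 ^ n * (2 ^ s) ^ t
    few-small-unions t s = begin
      tup t (λ U → 𝟙 (∣ U ∣ ≤ᵇ s))
        ≤⟨ tup-mono t (λ U → ≤-trans (≤-reflexive (sym (trans (cong (λ b → 𝟙 b * 𝟙 (∣ U ∣ ≤ᵇ s)) (⊆ᵇ-refl U)) (+-identityʳ _))))
                                     (≤∑ (λ S → 𝟙 (U ⊆ᵇ S) * 𝟙 (∣ S ∣ ≤ᵇ s)) U)) ⟩
      tup t (λ U → ∑ (all n) (λ S → 𝟙 (U ⊆ᵇ S) * 𝟙 (∣ S ∣ ≤ᵇ s)))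
        ≡⟨ tup-product (all n) _⊆ᵇ_ ∪-⊆ᵇ ⊥-⊆ᵇ t (λ S → 𝟙 (∣ S ∣ ≤ᵇ s)) ⟩
      ∑ (all n) (λ S → ∑ gs (λ v → 𝟙 (v ⊆ᵇ S)) ^ t * 𝟙 (∣ S ∣ ≤ᵇ s))
        ≤⟨ ∑-≤const ((2 ^ s) ^ t) (all n) _ (λ S → ≤-trans (≤-reflexive (*-comm (∑ gs (λ v → 𝟙 (v ⊆ᵇ S)) ^ t) (𝟙 (∣ S ∣ ≤ᵇ s))))
             (𝟙*≤ (∣ S ∣ ≤ᵇ s) (λ small → ^-monoˡ-≤ t (≤-trans (sparse S) (^-monoʳ-≤ 2 (≤ᵇ⇒≤ ∣ S ∣ s (subst T (sym small) _))))))) ⟩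
      length (all n) * (2 ^ s) ^ t
        ≡⟨ cong (_* (2 ^ s) ^ t) (length-all n) ⟩
      2 ^ n * (2 ^ s) ^ t ∎
      where open ≤-Reasoning

    module _ (N : ℕ) (N>0 : 0 < N) (gs≤ : length gs ≤ 3 * N) (k s : ℕ) where

      -- If the φ-degrees are large on average, the indices compatible with a
      -- random 2^k-tuple are dense on average, while few tuples have a small union.
      blow-up : ∀ {a} {I : Set a} (is : List I) (φ : Subset n → I → Bool) (c : I → Bool) →
                (∀ A B i → φ (A ∪ B) i ≡ φ A i ∧ φ B i) → (∀ i → φ ⊥ i ≡ true) →
                ∀ M q → length is ≤ M → 0 < M → 0 < q →
                2 * (q ^ (2 ^ k) * (2 ^ n * (2 ^ s) ^ (2 ^ k))) ≤ N ^ (2 ^ k) →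
                N * M ≤ q * ∑ is (λ i → ∑ gs (λ v → 𝟙 (φ v i ∧ c i))) →
                ∃ λ U → s < ∣ U ∣ × M ≤ grow k q * ∑ is (λ i → 𝟙 (φ U i ∧ c i))
      blow-up is φ c φ-∪ φ-⊥ M q len M>0 q>0 large dense
        with anySubset? (λ U → (s <? ∣ U ∣) ×-dec (M ≤? grow k q * ∑ is (λ i → 𝟙 (φ U i ∧ c i))))
      ... | yes found = found
      ... | no none = contradiction final (<⇒≱ (begin-strict
          2 * P     <⟨ *-monoˡ-< P {{>-nonZero P>0}} {2} {4} (s≤s (s≤s (s≤s z≤n))) ⟩
          4 * P     ∎))
        where
        open ≤-Reasoning
        t = 2 ^ k
        t>0 : 0 < t
        t>0 = m^n>0 2 k
        q′ = grow k q
        h : Subset n → ℕ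
        h U = ∑ is (λ i → 𝟙 (φ U i ∧ c i))
        P = (3 * q * N) ^ t
        P>0 : 0 < P
        P>0 = m^n>0 (3 * q * N) {{>-nonZero (*-mono-≤ (*-mono-≤ {1} {3} (s≤s z≤n) q>0) N>0)}} t
        B = 2 ^ n * (2 ^ s) ^ t
        d : ∀ i → ℕ
        d = deg is φ φ-∪ φ-⊥
        tup-h : tup t h ≡ ∑ is (λ i → d i ^ t * 𝟙 (c i))
        tup-h = trans (tup-cong t (λ U → ∑-cong is (λ i → 𝟙-∧ (φ U i) (c i))))
                      (tup-product is φ φ-∪ φ-⊥ t (λ i → 𝟙 (c i)))
        mean : N ^ t * M ≤ q ^ t * tup t h
        mean = begin
          N ^ t * M                                   ≤⟨ power-mean k is (λ i → d i * 𝟙 (c i)) N M q len M>0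
                                                           (≤-trans dense (≤-reflexive (cong (q *_) (∑-cong is (λ i →
                                                              trans (∑-cong gs (λ v → 𝟙-∧ (φ v i) (c i))) (∑-*ʳ (𝟙 (c i)) gs _)))))) ⟩
          q ^ t * ∑ is (λ i → (d i * 𝟙 (c i)) ^ t)    ≡⟨ cong (q ^ t *_) (trans (∑-cong is (λ i → ^-*𝟙 (d i) (c i) t t>0)) (sym tup-h)) ⟩
          q ^ t * tup t h                             ∎
        h≤M : ∀ U → h U ≤ M
        h≤M U = ≤-trans (∑-≤const 1 is _ (λ i → 𝟙≤1 _)) (≤-trans (≤-reflexive (*-identityʳ _)) len)
        -- If no large `U` works, then `q′ * h U` stays below `M`, except for small unions, where
        -- only the trivial `h U ≤ M` is known.
        pointwise : ∀ U → q′ * h U ≤ M + q′ * M * 𝟙 (∣ U ∣ ≤ᵇ s)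
        pointwise U with ∣ U ∣ ≤ᵇ s in eq
        ... | true  = ≤-trans (*-monoʳ-≤ q′ (h≤M U)) (≤-trans (≤-reflexive (sym (*-identityʳ _))) (m≤n+m _ M))
        ... | false with M ≤? q′ * h U
        ...   | yes big = contradiction (U , ≰⇒> (λ le → subst T eq (≤⇒≤ᵇ le)) , big) none
        ...   | no ¬big = ≤-trans (<⇒≤ (≰⇒> ¬big)) (m≤m+n M _)
        upper : q′ * tup t h ≤ (3 * N) ^ t * M + q′ * M * B
        upper = begin
          q′ * tup t h                                           ≡⟨ sym (tup-*ˡ t q′ h) ⟩
          tup t (λ U → q′ * h U)                                 ≤⟨ tup-mono t pointwise ⟩
          tup t (λ U → M + q′ * M * 𝟙 (∣ U ∣ ≤ᵇ s))              ≡⟨ tup-+ t _ _ ⟩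
          tup t (λ U → M) + tup t (λ U → q′ * M * 𝟙 (∣ U ∣ ≤ᵇ s)) ≡⟨ cong₂ _+_ (tup-const t M) (tup-*ˡ t (q′ * M) _) ⟩
          length gs ^ t * M + q′ * M * tup t (λ U → 𝟙 (∣ U ∣ ≤ᵇ s)) ≤⟨ +-mono-≤ (*-monoˡ-≤ M (^-monoˡ-≤ t gs≤))
                                                                       (*-monoʳ-≤ (q′ * M) (few-small-unions t s)) ⟩
          (3 * N) ^ t * M + q′ * M * B                           ∎
        powers : 4 * P ≡ q′ * N ^ t
        powers = trans (cong (4 *_) (^-distrib-* t (3 * q) N))
                 (trans (sym (*-assoc 4 ((3 * q) ^ t) (N ^ t))) (cong (_* N ^ t) (sym (grow-def k q))))
        powers′ : q ^ t * (3 * N) ^ t ≡ P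
        powers′ = trans (sym (^-distrib-* t q (3 * N))) (cong (_^ t) (lemma q N))
          where lemma : ∀ q N → q * (3 * N) ≡ 3 * q * N
                lemma = solve-∀
        -- The lower bound `mean` and the upper bound `upper`, divided by `M`. On the right, `2 * P`
        -- comes from all tuples and `4 * P` from those with a small union, by `large`.
        combined : 2 * (4 * P) ≤ 2 * P + 4 * P
        combined = *-cancelˡ-≤ M {{>-nonZero M>0}} (begin
          M * (2 * (4 * P))                                ≡⟨ cong (λ x → M * (2 * x)) powers ⟩
          M * (2 * (q′ * N ^ t))                           ≡⟨ lemma₁ M q′ (N ^ t) ⟩
          2 * q′ * (N ^ t * M)                             ≤⟨ *-monoʳ-≤ (2 * q′) mean ⟩
          2 * q′ * (q ^ t * tup t h)                       ≡⟨ lemma₂ q′ (q ^ t) (tup t h) ⟩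
          2 * q ^ t * (q′ * tup t h)                       ≤⟨ *-monoʳ-≤ (2 * q ^ t) upper ⟩
          2 * q ^ t * ((3 * N) ^ t * M + q′ * M * B)       ≡⟨ lemma₃ (q ^ t) ((3 * N) ^ t) M q′ B ⟩
          M * (2 * (q ^ t * (3 * N) ^ t) + q′ * (2 * (q ^ t * B))) ≤⟨ *-monoʳ-≤ M (+-monoʳ-≤ _ (*-monoʳ-≤ q′ large)) ⟩
          M * (2 * (q ^ t * (3 * N) ^ t) + q′ * N ^ t)     ≡⟨ cong₂ (λ x y → M * (2 * x + y)) powers′ (sym powers) ⟩
          M * (2 * P + 4 * P)                              ∎)
          where
          lemma₁ : ∀ a b c → a * (2 * (b * c)) ≡ 2 * b * (c * a)
          lemma₁ = solve-∀
          lemma₂ : ∀ a b c → 2 * a * (b * c) ≡ 2 * b * (a * c)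
          lemma₂ = solve-∀
          lemma₃ : ∀ a b M r B → 2 * a * (b * M + r * M * B) ≡ M * (2 * (a * b) + r * (2 * (a * B)))
          lemma₃ = solve-∀
        final : 4 * P ≤ 2 * P
        final = +-cancelʳ-≤ (4 * P) (4 * P) (2 * P) (≤-trans (≤-reflexive (lemma P)) combined)
          where lemma : ∀ P → 4 * P + 4 * P ≡ 2 * (4 * P)
                lemma = solve-∀

-- Opaque, so that the conjuncts of a condition can be inferred from it.
infixr 6 _⩓_ _&_

opaque

  _⩓_ : Bool → Bool → Bool
  _⩓_ = _∧_

  _&_ : ∀ {a b} → a ≡ true → b ≡ true → a ⩓ b ≡ true
  refl & refl = refl

  ⩓-true : ∀ {a b} → a ⩓ b ≡ true → a ≡ true × b ≡ true
  ⩓-true {true} e = refl , e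

  𝟙-⩓ : ∀ a b → 𝟙 (a ⩓ b) ≡ 𝟙 a * 𝟙 b
  𝟙-⩓ = 𝟙-∧

D-comm : ∀ {n} {A B : Subset n} → D A B ≡ true → D B A ≡ true
D-comm {A = A} {B} e = trans (D-sym B A) e

-- Odd cycles of pairwise disjoint sets

opaque
  unfolding D

  disjoint-sizes : ∀ {n} (A B : Subset n) → D A B ≡ true → ∣ A ∣ + ∣ B ∣ ≤ n
  disjoint-sizes []          []          e = z≤n
  disjoint-sizes (true ∷ A)  (false ∷ B) e = s≤s (disjoint-sizes A B e)
  disjoint-sizes (false ∷ A) (true ∷ B)  e = ≤-trans (≤-reflexive (+-suc ∣ A ∣ _)) (s≤s (disjoint-sizes A B e))
  disjoint-sizes (false ∷ A) (false ∷ B) e = m≤n⇒m≤1+n (disjoint-sizes A B e)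

∣∪∣+∣∩∣ : ∀ {n} (A B : Subset n) → ∣ A ∪ B ∣ + ∣ A ∩ B ∣ ≡ ∣ A ∣ + ∣ B ∣
∣∪∣+∣∩∣ []          []          = refl
∣∪∣+∣∩∣ (true ∷ A)  (true ∷ B)  = cong suc (trans (+-suc _ _) (trans (cong suc (∣∪∣+∣∩∣ A B)) (sym (+-suc ∣ A ∣ _))))
∣∪∣+∣∩∣ (true ∷ A)  (false ∷ B) = cong suc (∣∪∣+∣∩∣ A B)
∣∪∣+∣∩∣ (false ∷ A) (true ∷ B)  = trans (cong suc (∣∪∣+∣∩∣ A B)) (sym (+-suc ∣ A ∣ _))
∣∪∣+∣∩∣ (false ∷ A) (false ∷ B) = ∣∪∣+∣∩∣ A B

opaque
  unfolding D

  D-∩ : ∀ {n} (A B C : Subset n) → D A C ≡ true → D (A ∩ B) C ≡ true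
  D-∩ []          []          []          e = refl
  D-∩ (true ∷ A)  (true ∷ B)  (false ∷ C) e = D-∩ A B C e
  D-∩ (true ∷ A)  (false ∷ B) (false ∷ C) e = D-∩ A B C e
  D-∩ (false ∷ A) (b ∷ B)     (true ∷ C)  e = D-∩ A B C e
  D-∩ (false ∷ A) (b ∷ B)     (false ∷ C) e = D-∩ A B C e

  disjoint-sum : ∀ {n} (A B : Subset n) → D A B ≡ true → ∣ A ∪ B ∣ ≡ ∣ A ∣ + ∣ B ∣
  disjoint-sum []          []          e = refl
  disjoint-sum (true ∷ A)  (false ∷ B) e = cong suc (disjoint-sum A B e)
  disjoint-sum (false ∷ A) (true ∷ B)  e = trans (cong suc (disjoint-sum A B e)) (sym (+-suc ∣ A ∣ _))
  disjoint-sum (false ∷ A) (false ∷ B) e = disjoint-sum A B e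

D-∪-intro : ∀ {n} (A B C : Subset n) → D A C ≡ true → D B C ≡ true → D (A ∪ B) C ≡ true
D-∪-intro A B C e f = trans (D-∪ A B C) (cong₂ _∧_ e f)

triangle-sizes : ∀ {n} (A B C : Subset n) → D A B ≡ true → D B C ≡ true → D C A ≡ true →
                 ∣ A ∣ + ∣ B ∣ + ∣ C ∣ ≤ n
triangle-sizes A B C ab bc ca =
  ≤-trans (≤-reflexive (cong (_+ ∣ C ∣) (sym (disjoint-sum A B ab))))
          (disjoint-sizes (A ∪ B) C (D-∪-intro A B C (D-comm ca) bc))

-- Trading `B` and `F` for their union and intersection keeps the total size. The union is disjoint
-- from `A`, while the intersection, `C` and `E` are pairwise disjoint; each group fits into [n].
pentagon-sizes : ∀ {n} (A B C E F : Subset n) → D A B ≡ true → D B C ≡ true → D C E ≡ true →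
                 D E F ≡ true → D F A ≡ true → ∣ A ∣ + ∣ B ∣ + ∣ C ∣ + ∣ E ∣ + ∣ F ∣ ≤ n + n
pentagon-sizes {n} A B C E F ab bc ce ef fa = begin
  ∣ A ∣ + ∣ B ∣ + ∣ C ∣ + ∣ E ∣ + ∣ F ∣                     ≡⟨ lemma₁ (∣ A ∣) (∣ B ∣) (∣ C ∣) (∣ E ∣) (∣ F ∣) ⟩
  (∣ B ∣ + ∣ F ∣) + (∣ A ∣ + ∣ C ∣ + ∣ E ∣)                 ≡⟨ cong (_+ (∣ A ∣ + ∣ C ∣ + ∣ E ∣)) (sym (∣∪∣+∣∩∣ B F)) ⟩
  (∣ B ∪ F ∣ + ∣ B ∩ F ∣) + (∣ A ∣ + ∣ C ∣ + ∣ E ∣)         ≡⟨ lemma₂ (∣ B ∪ F ∣) (∣ B ∩ F ∣) (∣ A ∣) (∣ C ∣) (∣ E ∣) ⟩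
  (∣ B ∪ F ∣ + ∣ A ∣) + (∣ B ∩ F ∣ + ∣ C ∣ + ∣ E ∣)         ≤⟨ +-mono-≤
      (disjoint-sizes (B ∪ F) A (D-∪-intro B F A (D-comm ab) fa))
      (triangle-sizes (B ∩ F) C E (D-∩ B F C bc) ce (D-comm (D-∩F (D-comm ef)))) ⟩
  n + n                                                     ∎
  where
  open ≤-Reasoning
  D-∩F : D F E ≡ true → D (B ∩ F) E ≡ true
  D-∩F e = subst (λ X → D X E ≡ true) (∩-comm F B) (D-∩ F B E e)
  lemma₁ : ∀ a b c e f → a + b + c + e + f ≡ (b + f) + (a + c + e)
  lemma₁ = solve-∀
  lemma₂ : ∀ p q a c e → (p + q) + (a + c + e) ≡ (p + a) + (q + c + e)
  lemma₂ = solve-∀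

grow-> : ∀ k {q} → 0 < q → 0 < grow k q
grow-> k {q} q>0 = ≤-trans (*-mono-≤ {1} {4} (s≤s z≤n) (m^n>0 (3 * q) {{>-nonZero (*-mono-≤ {1} {3} (s≤s z≤n) q>0)}} (2 ^ k)))
                           (≤-reflexive (sym (grow-def k q)))

q≤grow : ∀ k {q} → 0 < q → q ≤ grow k q
q≤grow k {q} q>0 = ≤-trans (m≤n*m q 3) (≤-trans
  (≤-trans (≤-reflexive (sym (*-identityʳ (3 * q))))
           (^-monoʳ-≤ (3 * q) {{>-nonZero (*-mono-≤ {1} {3} (s≤s z≤n) q>0)}} (m^n>0 2 k)))
  (≤-trans (m≤n*m ((3 * q) ^ (2 ^ k)) 4) (≤-reflexive (sym (grow-def k q)))))

module Cycles {n} (gs : List (Subset n)) (sparse : ∀ S → ∑ gs (λ v → 𝟙 (v ⊆ᵇ S)) ≤ 2 ^ ∣ S ∣)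
              (N : ℕ) (N>0 : 0 < N) (gs≤ : length gs ≤ 3 * N) (k s : ℕ) where

  open Blowup gs

  -- What `blow-up` demands at density 1/q. By `Large-anti`, in a chain of blow-ups only the last
  -- density has to be checked.
  Large : ℕ → Set
  Large q = 2 * (q ^ (2 ^ k) * (2 ^ n * (2 ^ s) ^ (2 ^ k))) ≤ N ^ (2 ^ k)

  Large-anti : ∀ {q r} → q ≤ r → Large r → Large q
  Large-anti q≤r = ≤-trans (*-monoʳ-≤ 2 (*-monoˡ-≤ _ (^-monoˡ-≤ (2 ^ k) q≤r)))

  M : ℕ → ℕ
  M j = (3 * N) ^ j

  M>0 : ∀ j → 0 < M j
  M>0 j = m^n>0 (3 * N) {{>-nonZero (*-mono-≤ {1} {3} (s≤s z≤n) N>0)}} j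

  opaque
    unfolding _⩓_

    -- Replaces the first vertex v of a cyclic configuration, with neighbours
    -- l i and r i among the others, by a large set U.
    step : ∀ {I : Set} (is : List I) j q (b : Subset n × I → Bool) (l r : I → Subset n) (c : I → Bool) →
           (∀ v i → b (v , i) ≡ true → (D v (l i) ⩓ D v (r i)) ⩓ c i ≡ true) →
           length is ≤ M j → 0 < q → Large q →
           M (suc j) ≤ q * ∑ (cartesianProduct gs is) (λ x → 𝟙 (b x)) →
           ∀ {Z : Set} →
           (∀ U → s < ∣ U ∣ → M j ≤ grow k q * ∑ is (λ i → 𝟙 ((D U (l i) ⩓ D U (r i)) ⩓ c i)) → Z) → Z
    step is j q b l r c b⇒ len q>0 large dense continue =
      (λ (U , sU , d) → continue U sU d) (blow-up sparse N N>0 gs≤ k s is (λ v i → D v (l i) ⩓ D v (r i)) c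
        (λ A B i → trans (cong₂ _∧_ (D-∪ A B (l i)) (D-∪ A B (r i))) (∧-swap (D A (l i)) _ _ _))
        (λ i → D-⊥ (l i) & D-⊥ (r i)) (M j) q len (M>0 j) q>0 large (begin
          N * M j                                                   ≤⟨ *-monoˡ-≤ (M j) (m≤n*m N 3) ⟩
          3 * N * M j                                               ≤⟨ dense ⟩
          q * ∑ (cartesianProduct gs is) (λ x → 𝟙 (b x))            ≡⟨ cong (q *_) (trans (∑-× gs is _) (∑-swap gs is _)) ⟩
          q * ∑ is (λ i → ∑ gs (λ v → 𝟙 (b (v , i))))               ≤⟨ *-monoʳ-≤ q (∑-mono is (λ i → ∑-mono gs (λ v →
                                                                         𝟙≤ (b (v , i)) (λ e → ≤-reflexive (cong 𝟙 (sym (b⇒ v i e))))))) ⟩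
          q * ∑ is (λ i → ∑ gs (λ v → 𝟙 ((D v (l i) ⩓ D v (r i)) ⩓ c i))) ∎))
      where
      open ≤-Reasoning
      ∧-swap : ∀ a b c d → (a ∧ b) ∧ (c ∧ d) ≡ (a ∧ c) ∧ (b ∧ d)
      ∧-swap true  true  c d     = refl
      ∧-swap true  false true d  = refl
      ∧-swap true  false false d = refl
      ∧-swap false b c d         = refl

  V : Set
  V = Subset n

  len× : ∀ {I : Set} {is : List I} j → length is ≤ M j → length (cartesianProduct gs is) ≤ M (suc j)
  len× {is = is} j le = ≤-trans (≤-reflexive (trans (length-∑ (cartesianProduct gs is)) (trans (∑-× gs is _)
    (trans (∑-const _ gs) (cong (length gs *_) (sym (length-∑ is))))))) (*-mono-≤ gs≤ le)

  pt : List Unit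
  pt = tt ∷ []
  g1 = cartesianProduct gs pt
  g2 = cartesianProduct gs g1
  g3 = cartesianProduct gs g2
  g4 = cartesianProduct gs g3
  g5 = cartesianProduct gs g4

  len0 : length pt ≤ M 0
  len0 = ≤-refl
  len1 = len× {is = pt} 0 len0
  len2 = len× {is = g1} 1 len1
  len3 = len× {is = g2} 2 len2
  len4 = len× {is = g3} 3 len3

  witness : ∀ q b → 1 ≤ q * ∑ pt (λ _ → 𝟙 b) → b ≡ true
  witness q true  _ = refl
  witness q false h with () ← subst (1 ≤_) (*-zeroʳ q) h

  triangle : V × V × V × Unit → Bool
  triangle (A , B , C , _) = D A B ⩓ D B C ⩓ D C A

  pentagon : V × V × V × V × V × Unit → Bool
  pentagon (A , B , C , E , F , _) = D A B ⩓ D B C ⩓ D C E ⩓ D E F ⩓ D F A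

  module _ (short : n + n < 5 * suc s) where

    short-pentagon : ∀ (A B C E F : V) → s < ∣ A ∣ → s < ∣ B ∣ → s < ∣ C ∣ → s < ∣ E ∣ → s < ∣ F ∣ →
                     D A B ≡ true → D B C ≡ true → D C E ≡ true → D E F ≡ true → ¬ D F A ≡ true
    short-pentagon A B C E F sA sB sC sE sF ab bc ce ef fa = <⇒≱ short (≤-trans (≤-reflexive (lemma (suc s)))
      (≤-trans (+-mono-≤ (+-mono-≤ (+-mono-≤ (+-mono-≤ sA sB) sC) sE) sF) (pentagon-sizes A B C E F ab bc ce ef fa)))
      where
      lemma : ∀ s → 5 * s ≡ s + s + s + s + s
      lemma = solve-∀

    short-triangle : ∀ (A B C : V) → s < ∣ A ∣ → s < ∣ B ∣ → s < ∣ C ∣ →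
                     D A B ≡ true → D B C ≡ true → ¬ D C A ≡ true
    short-triangle A B C sA sB sC ab bc ca =
      <⇒≱ short (≤-trans (≤-trans (m≤m+n (5 * suc s) (suc s)) (≤-reflexive (lemma (suc s)))) (+-mono-≤ small small))
      where
      small : suc s + suc s + suc s ≤ n
      small = ≤-trans (+-mono-≤ (+-mono-≤ sA sB) sC) (triangle-sizes A B C ab bc ca)
      lemma : ∀ s → 5 * s + s ≡ s + s + s + (s + s + s)
      lemma = solve-∀

    -- Each `step` trades one vertex for a large set at the cost of one `grow`, and the remaining
    -- condition is rewritten with the next vertex in front. The last density only has to be
    -- positive to yield a forbidden triple of large sets, so two `grow`s appear in the hypothesis.
    few-triangles : ∀ q → 0 < q → Large (grow k (grow k q)) →
                    q * ∑ g3 (λ x → 𝟙 (triangle x)) < M 3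
    few-triangles q q>0 large = ≰⇒> λ dense →
      step g2 2 q triangle (λ (B , C , _) → B) (λ (B , C , _) → C) (λ (B , C , _) → D B C)
        (λ _ _ e → let ab , e = ⩓-true e ; bc , ca = ⩓-true e in (ab & D-comm ca) & bc)
        len2 q>0 L₀ dense λ A sA d₁ →
      step g1 1 q₁ (b₁ A) (λ _ → A) (λ (C , _) → C) (λ (C , _) → D A C)
        (λ _ _ e → let e , bc = ⩓-true e ; ab , ac = ⩓-true e in (D-comm ab & bc) & ac)
        len1 p₁ L₁ d₁ λ B sB d₂ →
      step pt 0 q₂ (b₂ A B) (λ _ → A) (λ _ → B) (λ _ → D B A)
        (λ _ _ e → let e , ac = ⩓-true e ; ba , bc = ⩓-true e in (D-comm ac & D-comm bc) & ba)
        len0 p₂ large d₂ λ C sC d₃ →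
      let e , ba = ⩓-true (witness (grow k q₂) ((D C A ⩓ D C B) ⩓ D B A) d₃)
          ca , cb = ⩓-true e
      in short-triangle A B C sA sB sC (D-comm ba) (D-comm cb) ca
      where
      q₁ = grow k q
      q₂ = grow k q₁
      p₁ : 0 < q₁
      p₁ = grow-> k q>0
      p₂ : 0 < q₂
      p₂ = grow-> k p₁
      L₁ : Large q₁
      L₁ = Large-anti (q≤grow k p₁) large
      L₀ : Large q
      L₀ = Large-anti (q≤grow k q>0) L₁
      b₁ : V → V × V × Unit → Bool
      b₁ A (B , C , _) = (D A B ⩓ D A C) ⩓ D B C
      b₂ : V → V → V × Unit → Bool
      b₂ A B (C , _) = (D B A ⩓ D B C) ⩓ D A C

    -- The same chain with five replacements. The conditions among the vertices already replaced are
    -- carried along in `c`, since they are needed only at the end.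
    few-pentagons : ∀ q → 0 < q → Large (grow k (grow k (grow k (grow k q)))) →
                    q * ∑ g5 (λ x → 𝟙 (pentagon x)) < M 5
    few-pentagons q q>0 large = ≰⇒> λ dense →
      step g4 4 q pentagon (λ (B , C , E , F , _) → B) (λ (B , C , E , F , _) → F)
        (λ (B , C , E , F , _) → D B C ⩓ D C E ⩓ D E F)
        (λ _ _ e → let ab , e = ⩓-true e ; bc , e = ⩓-true e ; ce , e = ⩓-true e ; ef , fa = ⩓-true e
                   in (ab & D-comm fa) & bc & ce & ef)
        len4 q>0 L₀ dense λ A sA d₁ →
      step g3 3 q₁ (b₁ A) (λ _ → A) (λ (C , E , F , _) → C) (λ (C , E , F , _) → D C E ⩓ D E F ⩓ D A F)
        (λ _ _ e → let e , e′ = ⩓-true e ; ab , af = ⩓-true e ; bc , e′ = ⩓-true e′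
                       ce , ef = ⩓-true e′ in (D-comm ab & bc) & ce & ef & af)
        len3 p₁ L₁ d₁ λ B sB d₂ →
      step g2 2 q₂ (b₂ A B) (λ _ → B) (λ (E , F , _) → E) (λ (E , F , _) → D E F ⩓ D A F ⩓ D B A)
        (λ _ _ e → let e , e′ = ⩓-true e ; ba , bc = ⩓-true e ; ce , e′ = ⩓-true e′
                       ef , af = ⩓-true e′ in (D-comm bc & ce) & ef & af & ba)
        len2 p₂ L₂ d₂ λ C sC d₃ →
      step g1 1 q₃ (b₃ A B C) (λ _ → C) (λ (F , _) → F) (λ (F , _) → D A F ⩓ D B A ⩓ D C B)
        (λ _ _ e → let e , e′ = ⩓-true e ; cb , ce = ⩓-true e ; ef , e′ = ⩓-true e′
                       af , ba = ⩓-true e′ in (D-comm ce & ef) & af & ba & cb)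
        len1 p₃ L₃ d₃ λ E sE d₄ →
      step pt 0 q₄ (b₄ A B C E) (λ _ → E) (λ _ → A) (λ _ → D B A ⩓ D C B ⩓ D E C)
        (λ _ _ e → let e , e′ = ⩓-true e ; ec , ef = ⩓-true e ; af , e′ = ⩓-true e′
                       ba , cb = ⩓-true e′ in (D-comm ef & D-comm af) & ba & cb & ec)
        len0 p₄ large d₄ λ F sF d₅ →
      let e , e′ = ⩓-true (witness (grow k q₄) ((D F E ⩓ D F A) ⩓ D B A ⩓ D C B ⩓ D E C) d₅)
          fe , fa = ⩓-true e
          ba , e′ = ⩓-true e′
          cb , ec = ⩓-true e′
      in short-pentagon A B C E F sA sB sC sE sF (D-comm ba) (D-comm cb) (D-comm ec) (D-comm fe) fa
      where
      q₁ = grow k q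
      q₂ = grow k q₁
      q₃ = grow k q₂
      q₄ = grow k q₃
      p₁ : 0 < q₁
      p₁ = grow-> k q>0
      p₂ : 0 < q₂
      p₂ = grow-> k p₁
      p₃ : 0 < q₃
      p₃ = grow-> k p₂
      p₄ : 0 < q₄
      p₄ = grow-> k p₃
      L₃ : Large q₃
      L₃ = Large-anti (q≤grow k p₃) large
      L₂ : Large q₂
      L₂ = Large-anti (q≤grow k p₂) L₃
      L₁ : Large q₁
      L₁ = Large-anti (q≤grow k p₁) L₂
      L₀ : Large q
      L₀ = Large-anti (q≤grow k q>0) L₁
      b₁ : V → V × V × V × V × Unit → Bool
      b₁ A (B , C , E , F , _) = (D A B ⩓ D A F) ⩓ D B C ⩓ D C E ⩓ D E F
      b₂ : V → V → V × V × V × Unit → Bool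
      b₂ A B (C , E , F , _) = (D B A ⩓ D B C) ⩓ D C E ⩓ D E F ⩓ D A F
      b₃ : V → V → V → V × V × Unit → Bool
      b₃ A B C (E , F , _) = (D C B ⩓ D C E) ⩓ D E F ⩓ D A F ⩓ D B A
      b₄ : V → V → V → V → V × Unit → Bool
      b₄ A B C E (F , _) = (D E C ⩓ D E F) ⩓ D A F ⩓ D B A ⩓ D C B

-- An edge of the disjointness graph whose neighbourhoods are large and nearly independent

module Graph {n} (gs : List (Subset n)) where

  V : Set
  V = Subset n

  e : V → V → ℕ
  e A B = 𝟙 (D A B)

  e-sym : ∀ A B → e A B ≡ e B A
  e-sym A B = cong 𝟙 (D-sym A B)

  e≤1 : ∀ A B → e A B ≤ 1
  e≤1 A B = 𝟙≤1 (D A B)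

  ∑² : (V → V → ℕ) → ℕ
  ∑² f = ∑ gs (λ A → ∑ gs (f A))

  ∑²-cong : ∀ {f g} → (∀ A B → f A B ≡ g A B) → ∑² f ≡ ∑² g
  ∑²-cong h = ∑-cong gs (λ A → ∑-cong gs (h A))

  ∑²-mono : ∀ {f g} → (∀ A B → f A B ≤ g A B) → ∑² f ≤ ∑² g
  ∑²-mono h = ∑-mono gs (λ A → ∑-mono gs (h A))

  ∑²-+ : ∀ f g → ∑² (λ A B → f A B + g A B) ≡ ∑² f + ∑² g
  ∑²-+ f g = trans (∑-cong gs (λ A → ∑-+ gs (f A) (g A))) (∑-+ gs _ _)

  ∑²-*ˡ : ∀ c f → ∑² (λ A B → c * f A B) ≡ c * ∑² f
  ∑²-*ˡ c f = trans (∑-cong gs (λ A → ∑-*ˡ c gs (f A))) (∑-*ˡ c gs _)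

  ∑²-swap : ∀ f → ∑² f ≡ ∑² (λ A B → f B A)
  ∑²-swap f = ∑-swap gs gs f

  ∑²-∑ : ∀ (f : V → V → V → ℕ) → ∑² (λ A B → ∑ gs (f A B)) ≡ ∑ gs (λ C → ∑² (λ A B → f A B C))
  ∑²-∑ f = trans (∑-cong gs (λ A → ∑-swap gs gs (f A))) (∑-swap gs gs _)

  d : V → ℕ
  d v = ∑ gs (e v)

  cod : V → V → ℕ
  cod u w = ∑ gs (λ y → e u y * e y w)

  cod-sym : ∀ u w → cod u w ≡ cod w u
  cod-sym u w = ∑-cong gs (λ y → trans (cong₂ _*_ (e-sym u y) (e-sym y w)) (*-comm (e y u) (e w y)))

  tri : V → ℕ
  tri u = ∑² (λ A B → e u A * e A B * e B u)

  -- Walks of length 4 from v to u.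
  path : V → V → ℕ
  path u v = ∑² (λ A B → e v A * e A B * cod B u)

  -- Closed walks of length 5 at `u`, organised around the edge `A B` opposite to `u`.
  pent : V → ℕ
  pent u = ∑² (λ A B → cod u A * e A B * cod B u)

  E T₃ T₅ : ℕ
  E  = ∑ gs d
  T₃ = ∑ gs tri
  T₅ = ∑ gs pent

  edge-degree : ∀ (f : V → ℕ) → ∑² (λ u v → e u v * f u) ≡ ∑ gs (λ u → d u * f u)
  edge-degree f = ∑-cong gs (λ u → ∑-*ʳ (f u) gs (e u))

  edge-cod : ∑² (λ u v → e u v * cod u v) ≡ T₃
  edge-cod = ∑-cong gs (λ u → trans
    (trans (∑-cong gs (λ v → sym (∑-*ˡ (e u v) gs _))) (∑-swap gs gs _))
    (∑²-cong (λ w v → trans (lemma (e u v) (e u w) (e w v)) (cong (e u w * e w v *_) (e-sym u v)))))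
    where lemma : ∀ a b c → a * (b * c) ≡ b * c * a
          lemma = solve-∀

  edge-path : ∑² (λ u v → e u v * path u v) ≡ T₅
  edge-path = ∑-cong gs (λ u → begin
    ∑ gs (λ v → e u v * path u v)
      ≡⟨ ∑-cong gs (λ v → sym (∑²-*ˡ (e u v) _)) ⟩
    ∑ gs (λ v → ∑² (λ A B → e u v * (e v A * e A B * cod B u)))
      ≡⟨ sym (∑²-∑ _) ⟩
    ∑² (λ A B → ∑ gs (λ v → e u v * (e v A * e A B * cod B u)))
      ≡⟨ ∑²-cong (λ A B → trans (∑-cong gs (λ v → lemma (e u v) (e v A) (e A B) (cod B u)))
                          (trans (∑-*ʳ (e A B * cod B u) gs _) (sym (*-assoc (cod u A) _ _)))) ⟩
    pent u ∎)
    where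
    open ≡-Reasoning
    lemma : ∀ a b c x → a * (b * c * x) ≡ a * b * (c * x)
    lemma = solve-∀

  sum-degrees² : ∑² (λ u v → e u v * (d u + d v)) ≡ 2 * ∑ gs (λ u → d u * d u)
  sum-degrees² = begin
    ∑² (λ u v → e u v * (d u + d v))                     ≡⟨ ∑²-cong (λ u v → *-distribˡ-+ (e u v) (d u) (d v)) ⟩
    ∑² (λ u v → e u v * d u + e u v * d v)               ≡⟨ ∑²-+ _ _ ⟩
    ∑² (λ u v → e u v * d u) + ∑² (λ u v → e u v * d v)  ≡⟨ cong (∑² (λ u v → e u v * d u) +_)
                                                              (trans (∑²-swap _) (∑²-cong (λ u v → cong (_* d u) (e-sym v u)))) ⟩
    ∑² (λ u v → e u v * d u) + ∑² (λ u v → e u v * d u)  ≡⟨ cong (λ x → x + x) (edge-degree d) ⟩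
    Q + Q                                                ≡⟨ cong (Q +_) (sym (+-identityʳ Q)) ⟩
    2 * Q                                                ∎
    where
    open ≡-Reasoning
    Q = ∑ gs (λ u → d u * d u)

  module _ (N : ℕ) (N>0 : 0 < N) (gs≤ : length gs ≤ 3 * N) where

    d≤ : ∀ v → d v ≤ 3 * N
    d≤ v = ≤-trans (∑-≤const 1 gs _ (e≤1 v)) (≤-trans (≤-reflexive (*-identityʳ _)) gs≤)

    -- The powers of `N` bring every summand to the order N⁴, so that the one inequality
    -- `p * pen u v ≤ N⁴` makes all these walk counts small at once.
    pen₁ : V → V → ℕ
    pen₁ u v = N * N * tri u + pent u + N * path u v + N * N * N * cod u v

    pen : V → V → ℕ
    pen u v = pen₁ u v + pen₁ v u

    -- The terms that depend on `u` alone are repeated `d u ≤ 3 * N` times; the other two sum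
    -- exactly to `T₅` and `T₃`. Hence 3 + 1 = 4.
    edge-pen₁ : ∑² (λ u v → e u v * pen₁ u v) ≤ 4 * (N * N * N * T₃ + N * T₅)
    edge-pen₁ = begin
      ∑² (λ u v → e u v * pen₁ u v)
        ≡⟨ ∑²-cong (λ u v → lemma₁ (e u v) (N * N) (tri u) (pent u) N (path u v) (N * N * N) (cod u v)) ⟩
      ∑² (λ u v → N * N * (e u v * tri u) + e u v * pent u + N * (e u v * path u v) + N * N * N * (e u v * cod u v))
        ≡⟨ trans (∑²-+ _ _) (cong₂ _+_ (trans (∑²-+ _ _) (cong₂ _+_ (trans (∑²-+ _ _)
             (cong₂ _+_ (∑²-*ˡ (N * N) _) refl)) (∑²-*ˡ N _))) (∑²-*ˡ (N * N * N) _)) ⟩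
      N * N * ∑² (λ u v → e u v * tri u) + ∑² (λ u v → e u v * pent u)
        + N * ∑² (λ u v → e u v * path u v) + N * N * N * ∑² (λ u v → e u v * cod u v)
        ≤⟨ +-mono-≤ (+-mono-≤ (+-mono-≤ (*-monoʳ-≤ (N * N) (weighted tri)) (weighted pent))
             (≤-reflexive (cong (N *_) edge-path))) (≤-reflexive (cong (N * N * N *_) edge-cod)) ⟩
      N * N * (3 * N * T₃) + 3 * N * T₅ + N * T₅ + N * N * N * T₃
        ≡⟨ lemma₂ N T₃ T₅ ⟩
      4 * (N * N * N * T₃ + N * T₅) ∎
      where
      open ≤-Reasoning
      weighted : ∀ f → ∑² (λ u v → e u v * f u) ≤ 3 * N * ∑ gs f
      weighted f = ≤-trans (≤-reflexive (edge-degree f))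
        (≤-trans (∑-mono gs (λ u → *-monoˡ-≤ (f u) (d≤ u))) (≤-reflexive (∑-*ˡ (3 * N) gs f)))
      lemma₁ : ∀ x a t p b r c k → x * (a * t + p + b * r + c * k) ≡ a * (x * t) + x * p + b * (x * r) + c * (x * k)
      lemma₁ = solve-∀
      lemma₂ : ∀ N s t → N * N * (3 * N * s) + 3 * N * t + N * t + N * N * N * s ≡ 4 * (N * N * N * s + N * t)
      lemma₂ = solve-∀

    edge-pen : ∑² (λ u v → e u v * pen u v) ≤ 8 * (N * N * N * T₃ + N * T₅)
    edge-pen = begin
      ∑² (λ u v → e u v * pen u v)
        ≡⟨ trans (∑²-cong (λ u v → *-distribˡ-+ (e u v) (pen₁ u v) (pen₁ v u))) (∑²-+ _ _) ⟩
      ∑² (λ u v → e u v * pen₁ u v) + ∑² (λ u v → e u v * pen₁ v u)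
        ≡⟨ cong (∑² (λ u v → e u v * pen₁ u v) +_)
             (trans (∑²-swap _) (∑²-cong (λ u v → cong (_* pen₁ u v) (e-sym v u)))) ⟩
      ∑² (λ u v → e u v * pen₁ u v) + ∑² (λ u v → e u v * pen₁ u v)
        ≤⟨ +-mono-≤ edge-pen₁ edge-pen₁ ⟩
      4 * (N * N * N * T₃ + N * T₅) + 4 * (N * N * N * T₃ + N * T₅)
        ≡⟨ lemma (N * N * N * T₃ + N * T₅) ⟩
      8 * (N * N * N * T₃ + N * T₅) ∎
      where
      open ≤-Reasoning
      lemma : ∀ x → 4 * x + 4 * x ≡ 8 * x
      lemma = solve-∀

    -- The average of d u + d v over the edges uv is at least 2E/|gs| ≥ (8/3 - o(1)) N,
    -- while the penalty is small on average.
    good-edge : ∀ p → 79 * (N * N) ≤ 20 * E →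
                1440 * p * T₃ ≤ N * N * N → 1440 * p * T₅ ≤ N * N * N * (N * N) →
                ∃ λ u → ∃ λ v → 13 * N ≤ 5 * (d u + d v) × p * pen u v ≤ (N * N * (N * N))
    good-edge p dense few₃ few₅
      with anySubset? (λ u → anySubset? (λ v → (13 * N ≤? 5 * (d u + d v)) ×-dec (p * pen u v ≤? (N * N * (N * N)))))
    ... | yes found = found
    ... | no none = contradiction (*-cancelʳ-≤ 79 40 (N * N) {{>-nonZero NN>0}} 79≤40) (<⇒≱ (m≤m+n 41 38))
      where
      open ≤-Reasoning
      NN>0 : 0 < N * N
      NN>0 = *-mono-≤ N>0 N>0
      N⁴ = (N * N * (N * N))
      Q = ∑ gs (λ u → d u * d u)
      tot = ∑² (λ u v → e u v * pen u v)
      pointwise : ∀ u v → 5 * N⁴ * (d u + d v) ≤ 13 * N * N⁴ + 30 * N * (p * pen u v)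
      pointwise u v with 13 * N ≤? 5 * (d u + d v)
      ... | no small = begin
        5 * N⁴ * (d u + d v)      ≡⟨ lemma N⁴ (d u + d v) ⟩
        5 * (d u + d v) * N⁴      ≤⟨ *-monoˡ-≤ N⁴ (<⇒≤ (≰⇒> small)) ⟩
        13 * N * N⁴               ≤⟨ m≤m+n _ _ ⟩
        13 * N * N⁴ + 30 * N * (p * pen u v) ∎
        where lemma : ∀ a b → 5 * a * b ≡ 5 * b * a
              lemma = solve-∀
      ... | yes big with p * pen u v ≤? N⁴
      ...   | yes ok = contradiction (u , v , big , ok) none
      ...   | no bad = begin
        5 * N⁴ * (d u + d v)       ≤⟨ *-mono-≤ (*-monoʳ-≤ 5 (<⇒≤ (≰⇒> bad))) (+-mono-≤ (d≤ u) (d≤ v)) ⟩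
        5 * (p * pen u v) * (3 * N + 3 * N) ≡⟨ lemma (p * pen u v) N ⟩
        30 * N * (p * pen u v)     ≤⟨ m≤n+m _ _ ⟩
        13 * N * N⁴ + 30 * N * (p * pen u v) ∎
        where lemma : ∀ a N → 5 * a * (3 * N + 3 * N) ≡ 30 * N * a
              lemma = solve-∀
      summed : 10 * N⁴ * Q ≤ 13 * N * N⁴ * E + 30 * N * p * tot
      summed = begin
        10 * N⁴ * Q
          ≡⟨ trans (lemma₁ N⁴ Q) (cong (5 * N⁴ *_) (sym sum-degrees²)) ⟩
        5 * N⁴ * ∑² (λ u v → e u v * (d u + d v))
          ≡⟨ sym (∑²-*ˡ (5 * N⁴) _) ⟩
        ∑² (λ u v → 5 * N⁴ * (e u v * (d u + d v)))
          ≤⟨ ∑²-mono (λ u v → ≤-trans (≤-reflexive (lemma₂ (5 * N⁴) (e u v) (d u + d v)))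
                        (≤-trans (*-monoʳ-≤ (e u v) (pointwise u v))
                                 (≤-reflexive (lemma₃ (e u v) (13 * N * N⁴) N p (pen u v))))) ⟩
        ∑² (λ u v → 13 * N * N⁴ * e u v + 30 * N * p * (e u v * pen u v))
          ≡⟨ trans (∑²-+ _ _) (cong₂ _+_ (∑²-*ˡ (13 * N * N⁴) _) (∑²-*ˡ (30 * N * p) _)) ⟩
        13 * N * N⁴ * E + 30 * N * p * tot ∎
        where
        lemma₁ : ∀ a q → 10 * a * q ≡ 5 * a * (2 * q)
        lemma₁ = solve-∀
        lemma₂ : ∀ a b c → a * (b * c) ≡ b * (a * c)
        lemma₂ = solve-∀
        lemma₃ : ∀ x a N p r → x * (a + 30 * N * (p * r)) ≡ a * x + 30 * N * p * (x * r)
        lemma₃ = solve-∀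
      -- 90 = 3 * 30 is the coefficient that arises in `quadratic`, and 1440 = 2 * 90 * 8 shares the
      -- bound equally between `T₃` and `T₅`.
      tot-bound : 90 * p * tot ≤ (N * N * (N * N * (N * N)))
      tot-bound = *-cancelˡ-≤ 2 (begin
        2 * (90 * p * tot)                    ≤⟨ *-monoʳ-≤ 2 (*-monoʳ-≤ (90 * p) edge-pen) ⟩
        2 * (90 * p * (8 * (N * N * N * T₃ + N * T₅)))
          ≡⟨ lemma₁ p N T₃ T₅ ⟩
        N * N * N * (1440 * p * T₃) + N * (1440 * p * T₅)
          ≤⟨ +-mono-≤ (*-monoʳ-≤ (N * N * N) few₃) (*-monoʳ-≤ N few₅) ⟩
        N * N * N * (N * N * N) + N * (N * N * N * (N * N))         ≡⟨ lemma₂ N ⟩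
        2 * (N * N * (N * N * (N * N)))                             ∎)
        where
        lemma₁ : ∀ p N s t → 2 * (90 * p * (8 * (N * N * N * s + N * t))) ≡ N * N * N * (1440 * p * s) + N * (1440 * p * t)
        lemma₁ = solve-∀
        lemma₂ : ∀ N → N * N * N * (N * N * N) + N * (N * N * N * (N * N)) ≡ 2 * (N * N * (N * N * (N * N)))
        lemma₂ = solve-∀
      -- In units of N², Cauchy-Schwarz gives 10 E² ≤ 39 E + 1 with 39 = 3 * 13. As 10 E ≥ 39.5 by
      -- `dense`, this leaves E / 2 ≤ 1, far from E ≥ 3.95.
      quadratic : 10 * (E * E) ≤ 39 * (N * N) * E + (N * N * (N * N))
      quadratic = *-cancelˡ-≤ ((N * N * (N * N))) {{>-nonZero (*-mono-≤ NN>0 NN>0)}} (begin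
        (N * N * (N * N)) * (10 * (E * E))                       ≤⟨ *-monoʳ-≤ ((N * N * (N * N))) (*-monoʳ-≤ 10
                                                          (≤-trans (∑-cauchy gs d) (*-monoˡ-≤ Q gs≤))) ⟩
        (N * N * (N * N)) * (10 * (3 * N * Q))                   ≡⟨ lemma₁ ((N * N * (N * N))) N Q ⟩
        3 * N * (10 * N⁴ * Q)                        ≤⟨ *-monoʳ-≤ (3 * N) summed ⟩
        3 * N * (13 * N * N⁴ * E + 30 * N * p * tot) ≡⟨ lemma₂ ((N * N * (N * N))) N E p tot ⟩
        (N * N * (N * N)) * (39 * (N * N) * E) + N * N * (90 * p * tot) ≤⟨ +-monoʳ-≤ _ (*-monoʳ-≤ (N * N) tot-bound) ⟩
        (N * N * (N * N)) * (39 * (N * N) * E) + N * N * (N * N * (N * N * (N * N)))   ≡⟨ lemma₃ N E ⟩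
        (N * N * (N * N)) * (39 * (N * N) * E + (N * N * (N * N)))           ∎)
        where
        lemma₁ : ∀ a N q → a * (10 * (3 * N * q)) ≡ 3 * N * (10 * a * q)
        lemma₁ = solve-∀
        lemma₂ : ∀ a N x p t → 3 * N * (13 * N * a * x + 30 * N * p * t) ≡ a * (39 * (N * N) * x) + N * N * (90 * p * t)
        lemma₂ = solve-∀
        lemma₃ : ∀ N x → (N * N * (N * N)) * (39 * (N * N) * x) + N * N * (N * N * (N * N * (N * N))) ≡ (N * N * (N * N)) * (39 * (N * N) * x + (N * N * (N * N)))
        lemma₃ = solve-∀
      E≤ : E ≤ 2 * (N * N)
      E≤ = *-cancelˡ-≤ (10 * (N * N)) {{>-nonZero (*-mono-≤ {1} {10} (s≤s z≤n) NN>0)}}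
        (+-cancelˡ-≤ (780 * (N * N) * E) _ _ (begin
        780 * (N * N) * E + 10 * (N * N) * E           ≡⟨ lemma₁ (N * N) E ⟩
        10 * E * (79 * (N * N))                        ≤⟨ *-monoʳ-≤ (10 * E) dense ⟩
        10 * E * (20 * E)                              ≡⟨ lemma₂ E ⟩
        20 * (10 * (E * E))                            ≤⟨ *-monoʳ-≤ 20 quadratic ⟩
        20 * (39 * (N * N) * E + (N * N * (N * N)))                ≡⟨ lemma₃ N E ⟩
        780 * (N * N) * E + 10 * (N * N) * (2 * (N * N)) ∎))
        where
        lemma₁ : ∀ a x → 780 * a * x + 10 * a * x ≡ 10 * x * (79 * a)
        lemma₁ = solve-∀
        lemma₂ : ∀ x → 10 * x * (20 * x) ≡ 20 * (10 * (x * x))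
        lemma₂ = solve-∀
        lemma₃ : ∀ N x → 20 * (39 * (N * N) * x + (N * N * (N * N))) ≡ 780 * (N * N) * x + 10 * (N * N) * (2 * (N * N))
        lemma₃ = solve-∀
      79≤40 : 79 * (N * N) ≤ 40 * (N * N)
      79≤40 = ≤-trans dense (≤-trans (*-monoʳ-≤ 20 E≤) (≤-reflexive (lemma (N * N))))
        where lemma : ∀ a → 20 * (2 * a) ≡ 40 * a
              lemma = solve-∀

-- From the edge to a bipartition of the family

record Covered {n} (X Y : Family n) (A : Subset n) : Set where
  constructor covered
  field
    {left right} : Subset n
    left∈    : X left ≡ true
    right∈   : Y right ≡ true
    disjoint : D left right ≡ true
    union    : left ∪ right ≡ A

covered? : ∀ {n} (X Y : Family n) A → Dec (Covered X Y A)
covered? X Y A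
  with anySubset? (λ B → anySubset? (λ C → (X B Bool.≟ true) ×-dec (Y C Bool.≟ true) ×-dec
                                           (D B C Bool.≟ true) ×-dec (≡-dec Bool._≟_ (B ∪ C) A)))
... | yes (B , C , x , y , disj , u) = yes (covered x y disj u)
... | no none = no λ (covered x y disj u) → none (_ , _ , x , y , disj , u)

uncovered : ∀ {n} (X Y : Family n) → ℕ
uncovered X Y = # (λ A → not (does (covered? X Y A)))

true≢false : ∀ {b : Bool} → b ≡ true → ¬ b ≡ false
true≢false refl ()

any-true : ∀ {a} {A : Set a} (p : A → Bool) xs → any p xs ≡ true → ∃ λ x → p x ≡ true
any-true p (x ∷ xs) h with p x in eq
... | true  = x , eq
... | false = any-true p xs h

∧-true : ∀ {a b} → a ∧ b ≡ true → a ≡ true × b ≡ true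
∧-true {true} e = refl , e

generated : ∀ {n} (G : Family n) A → union≤2ᵇ G A ≡ true → eqᵇ A ⊥ ≡ false → G A ≡ false → Covered G G A
generated {n} G A h A≢⊥ A∉G rewrite A≢⊥ | A∉G
  with B , hB ← any-true _ (allSubsets n) h
  with C , hC ← any-true _ (allSubsets n) hB
  with b , hC ← ∧-true {G B} hC
  with c , hC ← ∧-true {G C} hC
  with disj , u ← ∧-true {disjointᵇ B C} hC = covered b c (trans (D-def B C) disj) (eqᵇ⇒≡ _ _ u)

∧-intro : ∀ {a b} → a ≡ true → b ≡ true → a ∧ b ≡ true
∧-intro refl refl = refl

∀𝔹 : (Bool → Bool) → Bool
∀𝔹 f = f true ∧ f false

∀𝔹-elim : ∀ f → ∀𝔹 f ≡ true → ∀ b → f b ≡ true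
∀𝔹-elim f h true  = proj₁ (∧-true h)
∀𝔹-elim f h false = proj₂ (∧-true {f true} h)

-- The flags of a set w are: v ~ w, w is a popular second neighbour of u,
-- u ~ w, w is a popular second neighbour of v.
Flags : Set
Flags = Bool × Bool × Bool × Bool

inX inY inF inR : Flags → Bool
inX (a , b , c , d) = a ∨ b
inY (a , b , c , d) = not (a ∨ b) ∧ (c ∨ d)
inF (a , b , c , d) = not (a ∨ b) ∧ not (c ∨ d)
inR (a , b , c , d) = not a ∧ not c

-- The reasons why a disjoint pair may fail to run between the sides. Two neighbours of v close a
-- triangle; a neighbour of v and a popular second neighbour of u give walks of length 4 from v to
-- u; two popular second neighbours of u give pentagons; likewise with u and v exchanged. A member
-- of F next to a neighbour of u or v is an unpopular second neighbour, hence in few such pairs.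
-- Only the pairs in F × R, where R holds the sets adjacent to neither u nor v, can be numerous.
loss : Flags → Flags → ℕ
loss s@(a , b , c , d) t@(a′ , b′ , c′ , d′) =
  (𝟙 a * 𝟙 a′ + 𝟙 a * 𝟙 b′ + 𝟙 b * 𝟙 b′) + (𝟙 c * 𝟙 c′ + 𝟙 c * 𝟙 d′ + 𝟙 d * 𝟙 d′) +
  (𝟙 (inF s) * (𝟙 c′ + 𝟙 a′) + 𝟙 (inF s) * 𝟙 (inR t))

classifyᵇ : Flags → Flags → Bool
classifyᵇ s t = (inX s ∧ inY t) ∨ (inY s ∧ inX t) ∨ (1 ≤ᵇ loss s t) ∨ (1 ≤ᵇ loss t s)

-- Decided by evaluating all 256 combinations of flags; `∀𝔹-elim` then recovers the given one.
classifyᵇ-true : ∀ s t → classifyᵇ s t ≡ true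
classifyᵇ-true (a , b , c , d) (a′ , b′ , c′ , d′) =
  ∀𝔹-elim (λ d′ → classifyᵇ (a , b , c , d) (a′ , b′ , c′ , d′))
  (∀𝔹-elim (λ c′ → ∀𝔹 λ d′ → classifyᵇ (a , b , c , d) (a′ , b′ , c′ , d′))
  (∀𝔹-elim (λ b′ → ∀𝔹 λ c′ → ∀𝔹 λ d′ → classifyᵇ (a , b , c , d) (a′ , b′ , c′ , d′))
  (∀𝔹-elim (λ a′ → ∀𝔹 λ b′ → ∀𝔹 λ c′ → ∀𝔹 λ d′ → classifyᵇ (a , b , c , d) (a′ , b′ , c′ , d′))
  (∀𝔹-elim (λ d → ∀𝔹 λ a′ → ∀𝔹 λ b′ → ∀𝔹 λ c′ → ∀𝔹 λ d′ → classifyᵇ (a , b , c , d) (a′ , b′ , c′ , d′))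
  (∀𝔹-elim (λ c → ∀𝔹 λ d → ∀𝔹 λ a′ → ∀𝔹 λ b′ → ∀𝔹 λ c′ → ∀𝔹 λ d′ → classifyᵇ (a , b , c , d) (a′ , b′ , c′ , d′))
  (∀𝔹-elim (λ b → ∀𝔹 λ c → ∀𝔹 λ d → ∀𝔹 λ a′ → ∀𝔹 λ b′ → ∀𝔹 λ c′ → ∀𝔹 λ d′ → classifyᵇ (a , b , c , d) (a′ , b′ , c′ , d′))
  (∀𝔹-elim (λ a → ∀𝔹 λ b → ∀𝔹 λ c → ∀𝔹 λ d → ∀𝔹 λ a′ → ∀𝔹 λ b′ → ∀𝔹 λ c′ → ∀𝔹 λ d′ →
      classifyᵇ (a , b , c , d) (a′ , b′ , c′ , d′)) refl a) b) c) d) a′) b′) c′) d′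

∨-true : ∀ {a b} → a ∨ b ≡ true → a ≡ true ⊎ b ≡ true
∨-true {true}  e = inj₁ refl
∨-true {false} e = inj₂ e

classify : ∀ s t → (inX s ≡ true × inY t ≡ true) ⊎ (inY s ≡ true × inX t ≡ true) ⊎ 1 ≤ loss s t ⊎ 1 ≤ loss t s
classify s t with ∨-true {inX s ∧ inY t} (classifyᵇ-true s t)
... | inj₁ h = inj₁ (∧-true h)
... | inj₂ h with ∨-true {inY s ∧ inX t} h
...   | inj₁ h = inj₂ (inj₁ (∧-true h))
...   | inj₂ h with ∨-true {1 ≤ᵇ loss s t} h
...     | inj₁ h = inj₂ (inj₂ (inj₁ (≤ᵇ⇒≤ 1 _ (subst T (sym h) _))))
...     | inj₂ h = inj₂ (inj₂ (inj₂ (≤ᵇ⇒≤ 1 _ (subst T (sym h) _))))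

F⊆R : ∀ s → 𝟙 (inF s) ≤ 𝟙 (inR s)
F⊆R (false , false , false , false) = ≤-refl
F⊆R (false , false , false , true)  = z≤n
F⊆R (false , false , true , d)      = z≤n
F⊆R (false , true , c , d)          = z≤n
F⊆R (true , b , c , d)              = z≤n

R-inclusion-exclusion : ∀ (s : Flags) → let (a , b , c , d) = s in 𝟙 (inR s) + (𝟙 c + 𝟙 a) ≡ 1 + 𝟙 c * 𝟙 a
R-inclusion-exclusion (true , b , true , d)   = refl
R-inclusion-exclusion (true , b , false , d)  = refl
R-inclusion-exclusion (false , b , true , d)  = refl
R-inclusion-exclusion (false , b , false , d) = refl

parts : ∀ g s → 𝟙 (g ∧ inX s) + 𝟙 (g ∧ inY s) + 𝟙 (g ∧ inF s) ≡ 𝟙 g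
parts false s = refl
parts true (true , b , c , d)          = refl
parts true (false , true , c , d)      = refl
parts true (false , false , true , d)  = refl
parts true (false , false , false , true)  = refl
parts true (false , false , false , false) = refl

parts-or : ∀ {g} s → g ≡ true → (g ∧ inX s ≡ true) ⊎ (g ∧ inY s ≡ true) ⊎ (g ∧ inF s ≡ true)
parts-or (true , b , c , d) refl                 = inj₁ refl
parts-or (false , true , c , d) refl             = inj₁ refl
parts-or (false , false , true , d) refl         = inj₂ (inj₁ refl)
parts-or (false , false , false , true) refl     = inj₂ (inj₁ refl)
parts-or (false , false , false , false) refl    = inj₂ (inj₂ refl)

-- `Λ` collects the errors that can be made arbitrarily small. The term `# F * N` need not be small:
-- it is the loss caused by `F`, paid for later by the place that `F` takes in `size`.
record Bipartition {n} (G : Family n) (N K : ℕ) : Set where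
  field
    X Y F    : Family n
    X⊆G      : ∀ A → X A ≡ true → G A ≡ true
    Y⊆G      : ∀ A → Y A ≡ true → G A ≡ true
    G⊆X∪Y∪F  : ∀ A → G A ≡ true → X A ≡ true ⊎ Y A ≡ true ⊎ F A ≡ true
    Λ        : ℕ
    size     : # X + # Y + # F ≤ 3 * N
    F-small  : 2 * # F ≤ N
    covering : 2 * uncovered X Y ≤ 2 * Λ + # F * N
    Λ-small  : K * Λ ≤ N * N

module Members {n} (G : Family n) where

  gs : List (Subset n)
  gs = filter (λ A → T? (G A)) (all n)

  open Graph gs

  ∑-gs : ∀ f → ∑ gs f ≡ ∑ (all n) (λ A → 𝟙 (G A) * f A)
  ∑-gs f = ∑-filter G (all n) f

  ≤∑-gs : ∀ f A → G A ≡ true → f A ≤ ∑ gs f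
  ≤∑-gs f A A∈G = ≤-trans (≤-reflexive (sym (trans (cong (λ b → 𝟙 b * f A) A∈G) (+-identityʳ (f A)))))
    (≤-trans (≤∑ (λ A → 𝟙 (G A) * f A) A) (≤-reflexive (sym (∑-gs f))))

  sparse : ∀ S → ∑ gs (λ v → 𝟙 (v ⊆ᵇ S)) ≤ 2 ^ ∣ S ∣
  sparse S = ≤-trans (≤-reflexive (∑-gs (λ v → 𝟙 (v ⊆ᵇ S)))) (≤-trans
    (∑-mono (all n) {λ v → 𝟙 (G v) * 𝟙 (v ⊆ᵇ S)} {λ v → 𝟙 (v ⊆ᵇ S)} (λ A → 𝟙*≤ (G A) (λ _ → ≤-refl))) (≤-reflexive (#-powerset S)))

  #-gs : ∀ (P : Subset n → Bool) → ∑ gs (λ A → 𝟙 (P A)) ≡ # (λ A → G A ∧ P A)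
  #-gs P = trans (∑-gs (λ A → 𝟙 (P A))) (∑-cong (all n) (λ A → sym (𝟙-∧ (G A) (P A))))

  trivially-generated : ∀ (P : Subset n → Bool) →
    # P ≤ nonGenerated2 G + 1 + card G + # (λ A → P A ∧ (union≤2ᵇ G A ∧ (not (eqᵇ A ⊥) ∧ not (G A))))
  trivially-generated P = begin
    # P
      ≤⟨ ∑-mono (all n) (λ A → split (P A) (union≤2ᵇ G A) (eqᵇ A ⊥) (G A)) ⟩
    ∑ (all n) (λ A → f₀ A + f₁ A + f₂ A + f₃ A)
      ≡⟨ trans (∑-+ (all n) (λ A → f₀ A + f₁ A + f₂ A) f₃) (cong (_+ ∑ (all n) f₃)
           (trans (∑-+ (all n) (λ A → f₀ A + f₁ A) f₂) (cong₂ _+_ (trans (∑-+ (all n) f₀ f₁)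
             (cong₂ _+_ (sym (countᵇ≡# (λ A → not (union≤2ᵇ G A)))) empty)) (sym (countᵇ≡# G))))) ⟩
    nonGenerated2 G + 1 + card G + ∑ (all n) f₃ ∎
    where
    open ≤-Reasoning
    f₀ f₁ f₂ f₃ : Subset n → ℕ
    f₀ A = 𝟙 (not (union≤2ᵇ G A))
    f₁ A = 𝟙 (eqᵇ A ⊥)
    f₂ A = 𝟙 (G A)
    f₃ A = 𝟙 (P A ∧ (union≤2ᵇ G A ∧ (not (eqᵇ A ⊥) ∧ not (G A))))
    split : ∀ p u e g → 𝟙 p ≤ 𝟙 (not u) + 𝟙 e + 𝟙 g + 𝟙 (p ∧ (u ∧ (not e ∧ not g)))
    split false u e g = z≤n
    split true false e g = s≤s z≤n
    split true true true g = s≤s z≤n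
    split true true false true = s≤s z≤n
    split true true false false = s≤s z≤n
    eqᵇ-sym : ∀ {n} (A B : Subset n) → eqᵇ A B ≡ eqᵇ B A
    eqᵇ-sym [] [] = refl
    eqᵇ-sym (true ∷ A) (true ∷ B) = eqᵇ-sym A B
    eqᵇ-sym (true ∷ A) (false ∷ B) = refl
    eqᵇ-sym (false ∷ A) (true ∷ B) = refl
    eqᵇ-sym (false ∷ A) (false ∷ B) = eqᵇ-sym A B
    empty : ∑ (all n) f₁ ≡ 1
    empty = trans (∑-cong (all n) (λ A → cong 𝟙 (eqᵇ-sym A ⊥))) (#-singleton {n} ⊥)

  nontrivial : ∀ {p} A → p ∧ (union≤2ᵇ G A ∧ (not (eqᵇ A ⊥) ∧ not (G A))) ≡ true →
               p ≡ true × G A ≡ false × Covered G G A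
  nontrivial {p} A h =
    let p≡ , h = ∧-true {p} h
        u , h = ∧-true {union≤2ᵇ G A} h
        e , g = ∧-true {not (eqᵇ A ⊥)} h
    in p≡ , not-true g , generated G A u (not-true e) (not-true g)
    where
    not-true : ∀ {b} → not b ≡ true → b ≡ false
    not-true {false} refl = refl

module Edges {n} (G : Family n) where

  open Members G
  open Graph gs

  -- Each generated set outside G ∪ {∅} has two ordered representations.
  many-edges : 2 * 2 ^ n ≤ E + 2 * (nonGenerated2 G + 1 + card G)
  many-edges = begin
    2 * 2 ^ n                                          ≡⟨ cong (2 *_) (sym (#-true n)) ⟩
    2 * # {n} (λ _ → true)                             ≤⟨ *-monoʳ-≤ 2 (trivially-generated (λ _ → true)) ⟩
    2 * (nonGenerated2 G + 1 + card G + # P)           ≡⟨ lemma (nonGenerated2 G + 1 + card G) (# P) ⟩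
    2 * # P + 2 * (nonGenerated2 G + 1 + card G)       ≤⟨ +-monoˡ-≤ _ twice ⟩
    E + 2 * (nonGenerated2 G + 1 + card G)             ∎
    where
    open ≤-Reasoning
    P : Subset n → Bool
    P A = true ∧ (union≤2ᵇ G A ∧ (not (eqᵇ A ⊥) ∧ not (G A)))
    lemma : ∀ a b → 2 * (a + b) ≡ 2 * b + 2 * a
    lemma = solve-∀
    r : Subset n → Subset n → Subset n → ℕ
    r A B C = e B C * 𝟙 (eqᵇ (B ∪ C) A)
    single : ∀ A B C → G C ≡ true → D B C ≡ true → B ∪ C ≡ A → 1 ≤ ∑ gs (r A B)
    single A B C c disj refl = ≤-trans (≤-reflexive (sym (cong₂ _*_ (cong 𝟙 disj) (cong 𝟙 (eqᵇ-refl (B ∪ C))))))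
                                       (≤∑-gs (r (B ∪ C) B) C c)
    two : ∀ A → P A ≡ true → 2 ≤ ∑² (r A)
    two A h with nontrivial {true} A h
    ... | _ , A∉G , covered {B} {C} b c disj u = begin
      2                                                        ≤⟨ +-mono-≤ (single A B C c disj u)
                                                                    (single A C B b (D-comm disj) (trans (∪-comm C B) u)) ⟩
      ∑ gs (r A B) + ∑ gs (r A C)                              ≡⟨ sym (cong₂ _+_ (drop b) (drop c)) ⟩
      𝟙 (G B) * ∑ gs (r A B) + 𝟙 (G C) * ∑ gs (r A C)          ≤⟨ ≤∑-distinct (λ B → 𝟙 (G B) * ∑ gs (r A B)) B C B≢C ⟩
      ∑ (all n) (λ B → 𝟙 (G B) * ∑ gs (r A B))                 ≡⟨ sym (∑-gs (λ B → ∑ gs (r A B))) ⟩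
      ∑² (r A)                                                 ∎
      where
      drop : ∀ {b x} → b ≡ true → 𝟙 b * x ≡ x
      drop refl = +-identityʳ _
      -- Otherwise `A` would equal `B` and belong to `G`; so the two orders of the pair are counted
      -- separately.
      B≢C : ¬ B ≡ C
      B≢C refl = true≢false (subst (λ S → G S ≡ true) (trans (sym (∪-idem B)) u) b) A∉G
    twice : 2 * # P ≤ E
    twice = begin
      2 * # P                                        ≡⟨ sym (∑-*ˡ 2 (all n) _) ⟩
      ∑ (all n) (λ A → 2 * 𝟙 (P A))                  ≤⟨ ∑-mono (all n) (λ A → ≤-trans (≤-reflexive (*-comm 2 (𝟙 (P A)))) (𝟙*≤ (P A) (two A))) ⟩
      ∑ (all n) (λ A → ∑² (r A))                     ≡⟨ ∑-swap (all n) gs _ ⟩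
      ∑ gs (λ B → ∑ (all n) (λ A → ∑ gs (r A B)))    ≡⟨ ∑-cong gs (λ B → ∑-swap (all n) gs _) ⟩
      ∑² (λ B C → ∑ (all n) (λ A → r A B C))         ≡⟨ ∑²-cong (λ B C → trans (∑-*ˡ (e B C) (all n) _)
                                                          (trans (cong (e B C *_) (#-singleton (B ∪ C))) (*-identityʳ _))) ⟩
      E                                              ∎

module Splitting {n} (G : Family n) (N K : ℕ) (N>0 : 0 < N) (K>0 : 0 < K) (small : card G ≤ 3 * N) where

  open Members G
  open Graph gs

  -- A second neighbour is popular when its codegree is at least N/h; 24K makes the unpopular ones
  -- contribute at most N²/(4K). `H` adds up the weights 1, h, h² of the three kinds of walks in
  -- `half≤`, and `p` brings each `half` down to N²/(8K).
  h H p : ℕ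
  h = 24 * K
  H = 1 + h + h * h
  p = 8 * K * H

  module FromEdge (u v : Subset n)
                  (degrees : 13 * N ≤ 5 * (d u + d v)) (penalty : p * pen N N>0 small u v ≤ N * N * (N * N))
                  (few-exceptions : 4 * K * (nonGenerated2 G + 1 + card G) ≤ N * N) where

    big : Subset n → Subset n → Bool
    big x w = N ≤ᵇ h * cod x w

    flags : Subset n → Flags
    flags w = D v w , big u w , D u w , big v w

    a b c d′ : Subset n → ℕ
    a w = e v w
    b w = 𝟙 (big u w)
    c w = e u w
    d′ w = 𝟙 (big v w)

    f r : Subset n → ℕ
    f w = 𝟙 (inF (flags w))
    r w = 𝟙 (inR (flags w))

    open ≤-Reasoning

    N*big : ∀ x w → N * 𝟙 (big x w) ≤ h * cod x w
    N*big x w = ≤-trans (≤-reflexive (*-comm N _)) (𝟙*≤ (big x w) (λ t → ≤ᵇ⇒≤ N _ (subst T (sym t) _)))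

    -- Disjoint pairs of which both members are on the side of x.
    half : (x y : Subset n) → ℕ
    half x y = ∑² (λ B C → e B C * (e y B * e y C + e y B * 𝟙 (big x C) + 𝟙 (big x B) * 𝟙 (big x C)))

    -- By `N*big`, each indicator of popularity can be traded for a codegree at the price h/N. The
    -- three kinds of pairs then become `tri y`, `path x y` and `pent x`, all controlled by the
    -- penalty.
    half≤ : ∀ x y → p * pen N N>0 small x y ≤ N * N * (N * N) → p * half x y ≤ H * (N * N)
    half≤ x y pen≤ = *-cancelʳ-≤ (p * half x y) (H * (N * N)) (N * N) {{>-nonZero (*-mono-≤ N>0 N>0)}} (begin
      p * half x y * (N * N)                ≡⟨ lemma₁ p (half x y) (N * N) ⟩
      p * (N * N * half x y)                ≤⟨ *-monoʳ-≤ p weighted ⟩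
      p * (H * pen N N>0 small x y)         ≡⟨ lemma₂ p H (pen N N>0 small x y) ⟩
      H * (p * pen N N>0 small x y)         ≤⟨ *-monoʳ-≤ H pen≤ ⟩
      H * (N * N * (N * N))                 ≡⟨ sym (*-assoc H (N * N) (N * N)) ⟩
      H * (N * N) * (N * N)                 ∎)
      where
      lemma₁ : ∀ a b c → a * b * c ≡ a * (c * b)
      lemma₁ = solve-∀
      lemma₂ : ∀ a b c → a * (b * c) ≡ b * (a * c)
      lemma₂ = solve-∀
      t₁ t₂ t₃ : Subset n → Subset n → ℕ
      t₁ B C = e y B * e B C * e C y
      t₂ B C = e y B * e B C * cod C x
      t₃ B C = cod x B * e B C * cod C x
      pointwise : ∀ B C → N * N * (e B C * (e y B * e y C + e y B * 𝟙 (big x C) + 𝟙 (big x B) * 𝟙 (big x C)))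
                          ≤ N * N * t₁ B C + N * h * t₂ B C + h * h * t₃ B C
      pointwise B C = begin
        N * N * (e B C * (e y B * e y C + e y B * 𝟙 (big x C) + 𝟙 (big x B) * 𝟙 (big x C)))
          ≡⟨ expand N (e B C) (e y B) (e y C) (𝟙 (big x C)) (𝟙 (big x B)) ⟩
        N * N * (e y B * e B C * e y C) + N * (e y B * e B C) * (N * 𝟙 (big x C))
          + e B C * ((N * 𝟙 (big x B)) * (N * 𝟙 (big x C)))
          ≤⟨ +-mono-≤ (+-monoʳ-≤ (N * N * (e y B * e B C * e y C)) (*-monoʳ-≤ (N * (e y B * e B C)) (N*big x C)))
               (*-monoʳ-≤ (e B C) (*-mono-≤ (N*big x B) (N*big x C))) ⟩
        N * N * (e y B * e B C * e y C) + N * (e y B * e B C) * (h * cod x C)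
          + e B C * ((h * cod x B) * (h * cod x C))
          ≡⟨ cong₂ (λ s t → N * N * (e y B * e B C * s) + N * (e y B * e B C) * (h * t) + e B C * ((h * cod x B) * (h * t)))
               (e-sym y C) (cod-sym x C) ⟩
        N * N * (e y B * e B C * e C y) + N * (e y B * e B C) * (h * cod C x)
          + e B C * ((h * cod x B) * (h * cod C x))
          ≡⟨ collect N h (e y B * e B C * e C y) (e y B * e B C) (cod C x) (e B C) (cod x B) ⟩
        N * N * t₁ B C + N * h * t₂ B C + h * h * t₃ B C ∎
        where
        expand : ∀ N z p q s t → N * N * (z * (p * q + p * s + t * s)) ≡
                 N * N * (p * z * q) + N * (p * z) * (N * s) + z * ((N * t) * (N * s))
        expand = solve-∀
        collect : ∀ N h w pz s z t → N * N * w + N * pz * (h * s) + z * ((h * t) * (h * s)) ≡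
                  N * N * w + N * h * (pz * s) + h * h * (t * z * s)
        collect = solve-∀
      weighted : N * N * half x y ≤ H * pen N N>0 small x y
      weighted = begin
        N * N * half x y
          ≡⟨ sym (∑²-*ˡ (N * N) _) ⟩
        ∑² (λ B C → N * N * (e B C * (e y B * e y C + e y B * 𝟙 (big x C) + 𝟙 (big x B) * 𝟙 (big x C))))
          ≤⟨ ∑²-mono pointwise ⟩
        ∑² (λ B C → N * N * t₁ B C + N * h * t₂ B C + h * h * t₃ B C)
          ≡⟨ trans (∑²-+ (λ B C → N * N * t₁ B C + N * h * t₂ B C) (λ B C → h * h * t₃ B C))
               (cong₂ _+_ (trans (∑²-+ (λ B C → N * N * t₁ B C) (λ B C → N * h * t₂ B C))
                  (cong₂ _+_ (∑²-*ˡ (N * N) t₁) (∑²-*ˡ (N * h) t₂))) (∑²-*ˡ (h * h) t₃)) ⟩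
        N * N * tri y + N * h * path x y + h * h * pent x
          ≤⟨ m≤m+n _ _ ⟩
        N * N * tri y + N * h * path x y + h * h * pent x + rest
          ≡⟨ lemma h N (tri y) (path x y) (pent x) (tri x) (cod x y) (pent y) (path y x) (cod y x) ⟩
        H * pen N N>0 small x y ∎
        where
        rest : ℕ
        rest = (1 + h * h) * (N * path x y) + (1 + h) * pent x + (h + h * h) * (N * N * tri y)
             + (1 + h + h * h) * (N * N * tri x + N * N * N * cod x y + (pent y + N * path y x + N * N * N * cod y x))
        lemma : ∀ h N ty pxy px tx cxy py pyx cyx →
          N * N * ty + N * h * pxy + h * h * px
            + ((1 + h * h) * (N * pxy) + (1 + h) * px + (h + h * h) * (N * N * ty)
               + (1 + h + h * h) * (N * N * tx + N * N * N * cxy + (py + N * pyx + N * N * N * cyx)))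
          ≡ (1 + h + h * h) * ((N * N * tx + px + N * pxy + N * N * N * cxy) + (N * N * ty + py + N * pyx + N * N * N * cyx))
        lemma = solve-∀

    third : ℕ
    third = ∑ gs (λ B → f B * (cod u B + cod v B))

    -- Members of F are unpopular for both u and v, so each codegree is at most N/h, and at most 3N
    -- members are summed.
    third≤ : 4 * K * third ≤ N * N
    third≤ = *-cancelˡ-≤ 6 (begin
      6 * (4 * K * third)                                ≡⟨ lemma₁ K third ⟩
      h * third                                          ≡⟨ sym (∑-*ˡ h gs _) ⟩
      ∑ gs (λ B → h * (f B * (cod u B + cod v B)))       ≤⟨ ∑-≤const (2 * N) gs _ pointwise ⟩
      length gs * (2 * N)                                ≤⟨ *-monoˡ-≤ (2 * N) small ⟩
      3 * N * (2 * N)                                    ≡⟨ lemma₂ N ⟩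
      6 * (N * N)                                        ∎)
      where
      lemma₁ : ∀ K t → 6 * (4 * K * t) ≡ 24 * K * t
      lemma₁ = solve-∀
      lemma₂ : ∀ N → 3 * N * (2 * N) ≡ 6 * (N * N)
      lemma₂ = solve-∀
      rare : ∀ x B → big x B ≡ false → h * cod x B ≤ N
      rare x B eq with N ≤? h * cod x B
      ... | yes le = contradiction eq (true≢false (T⇒true (≤⇒≤ᵇ le)))
        where T⇒true : ∀ {b} → T b → b ≡ true
              T⇒true {true} _ = refl
      ... | no  gt = <⇒≤ (≰⇒> gt)
      pointwise : ∀ B → h * (f B * (cod u B + cod v B)) ≤ 2 * N
      pointwise B = begin
        h * (f B * (cod u B + cod v B))     ≡⟨ lemma₃ h (f B) (cod u B) (cod v B) ⟩
        f B * (h * cod u B + h * cod v B)   ≤⟨ 𝟙*≤ (inF (flags B)) (λ F → let fu , fv = F-flags (D v B) (big u B) (D u B) (big v B) F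
                                                 in +-mono-≤ (rare u B fu) (rare v B fv)) ⟩
        N + N                               ≡⟨ cong (N +_) (sym (+-identityʳ N)) ⟩
        2 * N                               ∎
        where
        lemma₃ : ∀ h f x y → h * (f * (x + y)) ≡ f * (h * x + h * y)
        lemma₃ = solve-∀
        F-flags : ∀ a b c d → inF (a , b , c , d) ≡ true → b ≡ false × d ≡ false
        F-flags false false false false _ = refl , refl

    rest : ℕ
    rest = ∑ gs r

    F-count : ℕ
    F-count = ∑ gs f

    rest≤ : 2 * rest ≤ N
    rest≤ = *-cancelˡ-≤ 5 (+-cancelʳ-≤ (26 * N) (5 * (2 * rest)) (5 * N) (begin
      5 * (2 * rest) + 26 * N                     ≤⟨ +-monoʳ-≤ (5 * (2 * rest)) (≤-trans (≤-reflexive (lemma₁ N)) (*-monoʳ-≤ 2 degrees)) ⟩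
      5 * (2 * rest) + 2 * (5 * (d u + d v))      ≡⟨ lemma₂ rest (d u) (d v) ⟩
      10 * (rest + (d u + d v))                   ≡⟨ cong (10 *_) inclusion-exclusion ⟩
      10 * (length gs + cod u v)                  ≡⟨ *-distribˡ-+ 10 (length gs) (cod u v) ⟩
      10 * length gs + 10 * cod u v               ≤⟨ +-mono-≤ (*-monoʳ-≤ 10 small) cod≤ ⟩
      10 * (3 * N) + N                            ≡⟨ lemma₃ N ⟩
      5 * N + 26 * N                              ∎))
      where
      lemma₁ : ∀ N → 26 * N ≡ 2 * (13 * N)
      lemma₁ = solve-∀
      lemma₂ : ∀ a b c → 5 * (2 * a) + 2 * (5 * (b + c)) ≡ 10 * (a + (b + c))
      lemma₂ = solve-∀
      lemma₃ : ∀ N → 10 * (3 * N) + N ≡ 5 * N + 26 * N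
      lemma₃ = solve-∀
      inclusion-exclusion : rest + (d u + d v) ≡ length gs + cod u v
      inclusion-exclusion = trans (cong (rest +_) (sym (∑-+ gs (e u) (e v)))) (trans (sym (∑-+ gs r _))
        (trans (∑-cong gs (λ w → R-inclusion-exclusion (flags w))) (trans (∑-+ gs (λ _ → 1) _)
          (cong₂ _+_ (sym (length-∑ gs)) (∑-cong gs (λ w → cong (e u w *_) (e-sym v w)))))))
      p≥10 : 10 ≤ p
      p≥10 = ≤-trans (m≤m+n 10 6) (*-mono-≤ {8} {8 * K} {2} {H} (*-mono-≤ {8} {8} {1} {K} ≤-refl K>0)
               (s≤s (≤-trans (*-mono-≤ {1} {24} {1} {K} (s≤s z≤n) K>0) (m≤m+n h (h * h)))))
      cod≤ : 10 * cod u v ≤ N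
      cod≤ = *-cancelˡ-≤ (N * N * N) {{>-nonZero (*-mono-≤ (*-mono-≤ N>0 N>0) N>0)}} (begin
        N * N * N * (10 * cod u v)      ≡⟨ lemma₄ (N * N * N) (cod u v) ⟩
        10 * (N * N * N * cod u v)      ≤⟨ *-mono-≤ p≥10 (≤-trans (m≤n+m (N * N * N * cod u v) (N * N * tri u + pent u + N * path u v))
                                             (m≤m+n (pen₁ N N>0 small u v) (pen₁ N N>0 small v u))) ⟩
        p * pen N N>0 small u v         ≤⟨ penalty ⟩
        N * N * (N * N)                 ≡⟨ sym (*-assoc (N * N) N N) ⟩
        N * N * N * N                   ∎)
        where lemma₄ : ∀ a b → a * (10 * b) ≡ 10 * (a * b)
              lemma₄ = solve-∀

    X Y F : Family n
    X w = G w ∧ inX (flags w)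
    Y w = G w ∧ inY (flags w)
    F w = G w ∧ inF (flags w)

    unc : Subset n → Bool
    unc A = not (does (covered? X Y A))

    L : Subset n → Subset n → ℕ
    L B C = e B C * loss (flags B) (flags C)

    Λ₀ : ℕ
    Λ₀ = nonGenerated2 G + 1 + card G

    sum-L : ∑² L ≤ half u v + half v u + (third + F-count * rest)
    sum-L = begin
      ∑² L
        ≡⟨ ∑²-cong (λ B C → expand (e B C) (a B * a C + a B * b C + b B * b C) (c B * c C + c B * d′ C + d′ B * d′ C)
                              (f B) (c C) (a C) (r C)) ⟩
      ∑² (λ B C → g₁ B C + g₂ B C + (g₃ B C + f B * (e B C * r C)))
        ≤⟨ ∑²-mono (λ B C → +-monoʳ-≤ (g₁ B C + g₂ B C) (+-monoʳ-≤ (g₃ B C) (*-monoʳ-≤ (f B) (𝟙*≤ (D B C) (λ _ → ≤-refl))))) ⟩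
      ∑² (λ B C → g₁ B C + g₂ B C + (g₃ B C + f B * r C))
        ≡⟨ trans (∑²-+ (λ B C → g₁ B C + g₂ B C) (λ B C → g₃ B C + f B * r C))
             (cong₂ _+_ (∑²-+ g₁ g₂) (trans (∑²-+ g₃ (λ B C → f B * r C)) (cong₂ _+_ third≡ (∑-product gs gs f r)))) ⟩
      half u v + half v u + (third + F-count * rest) ∎
      where
      g₁ g₂ g₃ : Subset n → Subset n → ℕ
      g₁ B C = e B C * (a B * a C + a B * b C + b B * b C)
      g₂ B C = e B C * (c B * c C + c B * d′ C + d′ B * d′ C)
      g₃ B C = f B * (e B C * c C + e B C * a C)
      expand : ∀ e x y f c a r → e * (x + y + (f * (c + a) + f * r)) ≡ e * x + e * y + (f * (e * c + e * a) + f * (e * r))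
      expand = solve-∀
      third≡ : ∑² g₃ ≡ third
      third≡ = ∑-cong gs (λ B → trans (∑-*ˡ (f B) gs (λ C → e B C * c C + e B C * a C)) (cong (f B *_)
        (trans (∑-+ gs (λ C → e B C * c C) (λ C → e B C * a C)) (cong₂ _+_ (back B u) (back B v)))))
        where
        back : ∀ B x → ∑ gs (λ C → e B C * e x C) ≡ cod x B
        back B x = trans (∑-cong gs (λ C → cong (e B C *_) (e-sym x C))) (cod-sym B x)

    -- By `classify`, a representation of an uncovered set has a positive loss in at least one of
    -- its two orders, and both orders have the same union.
    uncovered≤ : uncovered X Y ≤ Λ₀ + ∑² L
    uncovered≤ = ≤-trans (trivially-generated unc) (+-monoʳ-≤ Λ₀ (≤-trans
      (#-image P (cartesianProduct gs gs) (λ (B , C) → L B C) (λ (B , C) → B ∪ C) witness)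
      (≤-reflexive (∑-× gs gs (λ (B , C) → L B C)))))
      where
      P : Subset n → Bool
      P A = unc A ∧ (union≤2ᵇ G A ∧ (not (eqᵇ A ⊥) ∧ not (G A)))
      pair : ∀ B C → G B ≡ true → G C ≡ true → D B C ≡ true → 1 ≤ loss (flags B) (flags C) →
             1 ≤ ∑² (λ B′ C′ → L B′ C′ * 𝟙 (eqᵇ (B′ ∪ C′) (B ∪ C)))
      pair B C x y disj big = ≤-trans (*-mono-≤ (*-mono-≤ (≤-reflexive (sym (cong 𝟙 disj))) big) (≤-reflexive (sym (cong 𝟙 (eqᵇ-refl (B ∪ C))))))
        (≤-trans (≤∑-gs (λ C′ → L B C′ * 𝟙 (eqᵇ (B ∪ C′) (B ∪ C))) C y)
                 (≤∑-gs (λ B′ → ∑ gs (λ C′ → L B′ C′ * 𝟙 (eqᵇ (B′ ∪ C′) (B ∪ C)))) B x))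
      not-covered : ∀ A → unc A ≡ true → ¬ Covered X Y A
      not-covered A h cov with covered? X Y A
      not-covered A () cov | yes _
      ... | no no-cov = no-cov cov
      decide : ∀ A → unc A ≡ true → Covered G G A → 1 ≤ ∑² (λ B C → L B C * 𝟙 (eqᵇ (B ∪ C) A))
      decide A unc-A (covered {B} {C} x y disj refl) with classify (flags B) (flags C)
      ... | inj₁ (p , q) = contradiction (covered (∧-intro x p) (∧-intro y q) disj refl) (not-covered A unc-A)
      ... | inj₂ (inj₁ (p , q)) = contradiction (covered (∧-intro y q) (∧-intro x p) (D-comm disj) (∪-comm C B)) (not-covered A unc-A)
      ... | inj₂ (inj₂ (inj₁ l)) = pair B C x y disj l
      ... | inj₂ (inj₂ (inj₂ l)) = subst (λ A → 1 ≤ ∑² (λ B C → L B C * 𝟙 (eqᵇ (B ∪ C) A))) (∪-comm C B) (pair C B y x (D-comm disj) l)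
      witness : ∀ A → P A ≡ true → 1 ≤ ∑ (cartesianProduct gs gs) (λ (B , C) → L B C * 𝟙 (eqᵇ (B ∪ C) A))
      witness A h with nontrivial {unc A} A h
      ... | unc-A , _ , cov = ≤-trans (decide A unc-A cov) (≤-reflexive (sym (∑-× gs gs (λ (B , C) → L B C * 𝟙 (eqᵇ (B ∪ C) A)))))

    Λ′ : ℕ
    Λ′ = Λ₀ + (half u v + half v u + third)

    Λ′-small : K * Λ′ ≤ N * N
    Λ′-small = *-cancelˡ-≤ 4 (begin
      4 * (K * Λ′)                                                            ≡⟨ lemma₁ K Λ₀ (half u v + half v u) third ⟩
      4 * K * Λ₀ + 4 * K * (half u v + half v u) + 4 * K * third              ≤⟨ +-mono-≤ (+-mono-≤ few-exceptions halves) third≤ ⟩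
      N * N + N * N + N * N                                                   ≤⟨ m≤m+n _ (N * N) ⟩
      N * N + N * N + N * N + N * N                                           ≡⟨ lemma₂ (N * N) ⟩
      4 * (N * N)                                                             ∎)
      where
      lemma₁ : ∀ K a b c → 4 * (K * (a + (b + c))) ≡ 4 * K * a + 4 * K * b + 4 * K * c
      lemma₁ = solve-∀
      lemma₂ : ∀ x → x + x + x + x ≡ 4 * x
      lemma₂ = solve-∀
      penalty′ : p * pen N N>0 small v u ≤ N * N * (N * N)
      penalty′ = ≤-trans (≤-reflexive (cong (p *_) (+-comm (pen₁ N N>0 small v u) (pen₁ N N>0 small u v)))) penalty
      halves : 4 * K * (half u v + half v u) ≤ N * N
      halves = *-cancelˡ-≤ (2 * H) (begin
        2 * H * (4 * K * (half u v + half v u))      ≡⟨ lemma₃ H K (half u v) (half v u) ⟩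
        p * half u v + p * half v u                  ≤⟨ +-mono-≤ (half≤ u v penalty) (half≤ v u penalty′) ⟩
        H * (N * N) + H * (N * N)                    ≡⟨ lemma₄ H (N * N) ⟩
        2 * H * (N * N)                              ∎)
        where
        lemma₃ : ∀ H K x y → 2 * H * (4 * K * (x + y)) ≡ 8 * K * H * x + 8 * K * H * y
        lemma₃ = solve-∀
        lemma₄ : ∀ H x → H * x + H * x ≡ 2 * H * x
        lemma₄ = solve-∀

    bipartition : Bipartition G N K
    bipartition = record
      { X = X ; Y = Y ; F = F
      ; X⊆G = λ A h → proj₁ (∧-true h)
      ; Y⊆G = λ A h → proj₁ (∧-true h)
      ; G⊆X∪Y∪F = λ A h → parts-or (flags A) h
      ; Λ = Λ′
      ; size = ≤-trans (≤-reflexive (trans (sym (trans (∑-+ (all n) (λ A → 𝟙 (X A) + 𝟙 (Y A)) (λ A → 𝟙 (F A)))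
                  (cong (_+ # F) (∑-+ (all n) (λ A → 𝟙 (X A)) (λ A → 𝟙 (Y A))))))
                  (trans (∑-cong (all n) (λ A → parts (G A) (flags A))) (sym (countᵇ≡# G))))) small
      ; F-small = ≤-trans (*-monoʳ-≤ 2 (≤-trans (≤-reflexive (sym (#-gs (λ A → inF (flags A)))))
                                                (∑-mono gs (λ A → F⊆R (flags A))))) rest≤
      ; covering = begin
          2 * uncovered X Y                                     ≤⟨ *-monoʳ-≤ 2 (≤-trans uncovered≤ (+-monoʳ-≤ Λ₀ sum-L)) ⟩
          2 * (Λ₀ + (half u v + half v u + (third + F-count * rest))) ≡⟨ lemma Λ₀ (half u v + half v u) third F-count rest ⟩
          2 * Λ′ + F-count * (2 * rest)                         ≤⟨ +-monoʳ-≤ (2 * Λ′) (*-mono-≤ (≤-reflexive (#-gs (λ A → inF (flags A)))) rest≤) ⟩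
          2 * Λ′ + # F * N                                      ∎
      ; Λ-small = Λ′-small
      }
      where
      lemma : ∀ l x t f r → 2 * (l + (x + (t + f * r))) ≡ 2 * (l + (x + t)) + f * (2 * r)
      lemma = solve-∀

-- Certificates for polynomial inequalities

-- A separate normaliser, because the cost of the library's ring solver is linear in
-- the coefficients, which are large below.
Horner : ℕ → Set
Horner zero    = ℕ
Horner (suc k) = List (Horner k)

evalᴴ : ∀ {k} → Horner k → Vec ℕ k → ℕ
evalᴴ {zero}  c       []      = c
evalᴴ {suc k} []      (x ∷ ρ) = 0
evalᴴ {suc k} (c ∷ p) (x ∷ ρ) = evalᴴ c ρ + x * evalᴴ p (x ∷ ρ)

zeroᴴ : ∀ {k} → Horner k
zeroᴴ {zero}  = 0
zeroᴴ {suc k} = []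

conᴴ : ∀ {k} → ℕ → Horner k
conᴴ {zero}  c = c
conᴴ {suc k} c = conᴴ c ∷ []

varᴴ : ∀ {k} → Fin k → Horner k
varᴴ zero    = zeroᴴ ∷ conᴴ 1 ∷ []
varᴴ (suc i) = varᴴ i ∷ []

shift : ∀ {k} → Horner (suc k) → Horner (suc k)
shift []      = []
shift (c ∷ p) = zeroᴴ ∷ c ∷ p

infixl 6 _+ᴴ_
infixl 7 _*ᴴ_

_+ᴴ_ : ∀ {k} → Horner k → Horner k → Horner k
_+ᴴ_ {zero}  c       d       = c + d
_+ᴴ_ {suc k} []      q       = q
_+ᴴ_ {suc k} (c ∷ p) []      = c ∷ p
_+ᴴ_ {suc k} (c ∷ p) (d ∷ q) = (c +ᴴ d) ∷ (p +ᴴ q)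

mutual

  _*ᴴ_ : ∀ {k} → Horner k → Horner k → Horner k
  _*ᴴ_ {zero}  c       d       = c * d
  _*ᴴ_ {suc k} []      q       = []
  _*ᴴ_ {suc k} (c ∷ p) []      = []
  _*ᴴ_ {suc k} (c ∷ p) (d ∷ q) = scale c (d ∷ q) +ᴴ shift (p *ᴴ (d ∷ q))

  scale : ∀ {k} → Horner k → Horner (suc k) → Horner (suc k)
  scale c []      = []
  scale c (d ∷ q) = (c *ᴴ d) ∷ scale c q

zeroᴴ-sound : ∀ {k} (ρ : Vec ℕ k) → evalᴴ zeroᴴ ρ ≡ 0
zeroᴴ-sound []      = refl
zeroᴴ-sound (x ∷ ρ) = refl

conᴴ-sound : ∀ {k} c (ρ : Vec ℕ k) → evalᴴ (conᴴ c) ρ ≡ c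
conᴴ-sound c []      = refl
conᴴ-sound c (x ∷ ρ) = trans (cong₂ _+_ (conᴴ-sound c ρ) (*-zeroʳ x)) (+-identityʳ c)

varᴴ-sound : ∀ {k} (i : Fin k) (ρ : Vec ℕ k) → evalᴴ (varᴴ i) ρ ≡ Vec.lookup ρ i
varᴴ-sound zero    (x ∷ ρ) = trans (cong₂ (λ a b → a + x * b) (zeroᴴ-sound ρ) (conᴴ-sound 1 (x ∷ ρ))) (*-identityʳ x)
varᴴ-sound (suc i) (x ∷ ρ) = trans (cong₂ _+_ (varᴴ-sound i ρ) (*-zeroʳ x)) (+-identityʳ _)

shift-sound : ∀ {k} (p : Horner (suc k)) x ρ → evalᴴ (shift p) (x ∷ ρ) ≡ x * evalᴴ p (x ∷ ρ)
shift-sound []      x ρ = sym (*-zeroʳ x)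
shift-sound (c ∷ p) x ρ = cong (_+ x * evalᴴ (c ∷ p) (x ∷ ρ)) (zeroᴴ-sound ρ)

+ᴴ-sound : ∀ {k} (p q : Horner k) ρ → evalᴴ (p +ᴴ q) ρ ≡ evalᴴ p ρ + evalᴴ q ρ
+ᴴ-sound {zero}  c       d       []      = refl
+ᴴ-sound {suc k} []      q       (x ∷ ρ) = refl
+ᴴ-sound {suc k} (c ∷ p) []      (x ∷ ρ) = sym (+-identityʳ _)
+ᴴ-sound {suc k} (c ∷ p) (d ∷ q) (x ∷ ρ) =
  trans (cong₂ (λ a b → a + x * b) (+ᴴ-sound c d ρ) (+ᴴ-sound p q (x ∷ ρ)))
        (lemma (evalᴴ c ρ) (evalᴴ d ρ) x (evalᴴ p (x ∷ ρ)) (evalᴴ q (x ∷ ρ)))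
  where lemma : ∀ a b x c d → a + b + x * (c + d) ≡ a + x * c + (b + x * d)
        lemma = solve-∀

mutual

  *ᴴ-sound : ∀ {k} (p q : Horner k) ρ → evalᴴ (p *ᴴ q) ρ ≡ evalᴴ p ρ * evalᴴ q ρ
  *ᴴ-sound {zero}  c       d       []      = refl
  *ᴴ-sound {suc k} []      q       (x ∷ ρ) = refl
  *ᴴ-sound {suc k} (c ∷ p) []      (x ∷ ρ) = sym (*-zeroʳ (evalᴴ (c ∷ p) (x ∷ ρ)))
  *ᴴ-sound {suc k} (c ∷ p) (d ∷ q) (x ∷ ρ) =
    trans (+ᴴ-sound (scale c (d ∷ q)) (shift (p *ᴴ (d ∷ q))) (x ∷ ρ))
    (trans (cong₂ _+_ (scale-sound c (d ∷ q) x ρ) (trans (shift-sound (p *ᴴ (d ∷ q)) x ρ) (cong (x *_) (*ᴴ-sound p (d ∷ q) (x ∷ ρ)))))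
           (lemma (evalᴴ c ρ) (evalᴴ (d ∷ q) (x ∷ ρ)) x (evalᴴ p (x ∷ ρ))))
    where lemma : ∀ c q x p → c * q + x * (p * q) ≡ (c + x * p) * q
          lemma = solve-∀

  scale-sound : ∀ {k} (c : Horner k) q x ρ → evalᴴ (scale c q) (x ∷ ρ) ≡ evalᴴ c ρ * evalᴴ q (x ∷ ρ)
  scale-sound c []      x ρ = sym (*-zeroʳ (evalᴴ c ρ))
  scale-sound c (d ∷ q) x ρ = trans (cong₂ (λ a b → a + x * b) (*ᴴ-sound c d ρ) (scale-sound c q x ρ))
    (lemma (evalᴴ c ρ) (evalᴴ d ρ) x (evalᴴ q (x ∷ ρ)))
    where lemma : ∀ c d x q → c * d + x * (c * q) ≡ c * (d + x * q)
          lemma = solve-∀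

infixl 6 _⊕_
infixl 7 _⊗_

data Expr (k : ℕ) : Set where
  con     : ℕ → Expr k
  var     : Fin k → Expr k
  _⊕_ _⊗_ : Expr k → Expr k → Expr k

⟦_⟧ : ∀ {k} → Expr k → Vec ℕ k → ℕ
⟦ con c ⟧ ρ = c
⟦ var i ⟧ ρ = Vec.lookup ρ i
⟦ p ⊕ q ⟧ ρ = ⟦ p ⟧ ρ + ⟦ q ⟧ ρ
⟦ p ⊗ q ⟧ ρ = ⟦ p ⟧ ρ * ⟦ q ⟧ ρ

norm : ∀ {k} → Expr k → Horner k
norm (con c) = conᴴ c
norm (var i) = varᴴ i
norm (p ⊕ q) = norm p +ᴴ norm q
norm (p ⊗ q) = norm p *ᴴ norm q

norm-sound : ∀ {k} (p : Expr k) ρ → evalᴴ (norm p) ρ ≡ ⟦ p ⟧ ρ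
norm-sound (con c) ρ = conᴴ-sound c ρ
norm-sound (var i) ρ = varᴴ-sound i ρ
norm-sound (p ⊕ q) ρ = trans (+ᴴ-sound (norm p) (norm q) ρ) (cong₂ _+_ (norm-sound p ρ) (norm-sound q ρ))
norm-sound (p ⊗ q) ρ = trans (*ᴴ-sound (norm p) (norm q) ρ) (cong₂ _*_ (norm-sound p ρ) (norm-sound q ρ))

record Ineq {k} (ρ : Vec ℕ k) : Set where
  constructor ineq
  field
    lhs rhs : Expr k
    holds   : ⟦ lhs ⟧ ρ ≤ ⟦ rhs ⟧ ρ

open Ineq

module _ {k} {ρ : Vec ℕ k} where

  infixl 6 _⊞_
  infixr 7 _⊡_

  _⊞_ : Ineq ρ → Ineq ρ → Ineq ρ
  ineq l r h ⊞ ineq l′ r′ h′ = ineq (l ⊕ l′) (r ⊕ r′) (+-mono-≤ h h′)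

  _⊡_ : Expr k → Ineq ρ → Ineq ρ
  e ⊡ ineq l r h = ineq (e ⊗ l) (e ⊗ r) (*-monoʳ-≤ (⟦ e ⟧ ρ) h)

  -- 0 ≤ (r - l) (r′ - l′), rearranged.
  cross : Ineq ρ → Ineq ρ → Ineq ρ
  cross (ineq l r h) (ineq l′ r′ h′) = ineq (l ⊗ r′ ⊕ r ⊗ l′) (r ⊗ r′ ⊕ l ⊗ l′) (*-cross-≤ h h′)
    where
    *-cross-≤ : ∀ {a b c d} → a ≤ b → c ≤ d → a * d + b * c ≤ b * d + a * c
    *-cross-≤ {a} {b} {c} {d} a≤b c≤d with k , refl ← m≤n⇒∃[o]m+o≡n a≤b | m , refl ← m≤n⇒∃[o]m+o≡n c≤d =
      ≤-trans (m≤m+n _ (k * m)) (≤-reflexive (lemma a k c m))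
      where
      lemma : ∀ a k c m → a * (c + m) + (a + k) * c + k * m ≡ (a + k) * (c + m) + a * c
      lemma = solve-∀

  square : Expr k → Expr k → Ineq ρ
  square p q = ineq (con 2 ⊗ (p ⊗ q)) (p ⊗ p ⊕ q ⊗ q) (2ab≤a²+b² (⟦ p ⟧ ρ) (⟦ q ⟧ ρ))

  -- The combination `c` proves `lhs ≤ rhs`, while as polynomials `lhs = rhs + slack`; so a slack
  -- that is positive at `ρ` is absurd. The polynomial identity is a comparison of normal forms.
  refute : (c : Ineq ρ) (slack : Expr k) → norm (lhs c) ≡ norm (rhs c ⊕ slack) → ¬ 0 < ⟦ slack ⟧ ρ
  refute c slack eq positive = <⇒≱ (m<m+n (⟦ rhs c ⟧ ρ) positive) (≤-trans (≤-reflexive sound) (holds c))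
    where
    sound : ⟦ rhs c ⟧ ρ + ⟦ slack ⟧ ρ ≡ ⟦ lhs c ⟧ ρ
    sound = trans (sym (norm-sound (rhs c ⊕ slack) ρ)) (trans (cong (λ p → evalᴴ p ρ) (sym eq)) (norm-sound (lhs c) ρ))

  conclude : (c : Ineq ρ) (l r slack : Expr k) → norm (lhs c ⊕ r) ≡ norm (rhs c ⊕ (l ⊕ slack)) → ⟦ l ⟧ ρ ≤ ⟦ r ⟧ ρ
  conclude c l r slack eq = +-cancelˡ-≤ (⟦ rhs c ⟧ ρ) _ _ (begin
    ⟦ rhs c ⟧ ρ + ⟦ l ⟧ ρ               ≤⟨ +-monoʳ-≤ (⟦ rhs c ⟧ ρ) (m≤m+n (⟦ l ⟧ ρ) (⟦ slack ⟧ ρ)) ⟩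
    ⟦ rhs c ⊕ (l ⊕ slack) ⟧ ρ           ≡⟨ trans (sym (norm-sound (rhs c ⊕ (l ⊕ slack)) ρ))
                                             (trans (cong (λ p → evalᴴ p ρ) (sym eq)) (norm-sound (lhs c ⊕ r) ρ)) ⟩
    ⟦ lhs c ⟧ ρ + ⟦ r ⟧ ρ               ≤⟨ +-monoˡ-≤ (⟦ r ⟧ ρ) (holds c) ⟩
    ⟦ rhs c ⟧ ρ + ⟦ r ⟧ ρ               ∎)
    where open ≤-Reasoning

by-contradiction : ∀ {m n} → (n ≤ m → Void) → m ≤ n
by-contradiction {m} {n} h with m ≤? n
... | yes m≤n = m≤n
... | no  m≰n with () ← h (<⇒≤ (≰⇒> m≰n))

-- Here a and z count the sets of X inside and not inside S, b and w the sets
-- of Y inside and not inside the complement of S, f the sets of F, and u the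
-- sets that are not covered. The combinations were found by linear programming.
module Numerics (N a z b w f u L s t : ℕ) (N>0 : 0 < N)
                (h₀ : a + z + (b + w) + f ≤ 3 * N) (h₁ : 2 * f ≤ N)
                (hᵤ : 2 * u ≤ 2 * L + f * N) (hₗ : 100 * (100 * L) ≤ N * N) where

  ρ : Vec ℕ 10
  ρ = N ∷ a ∷ z ∷ b ∷ w ∷ f ∷ u ∷ L ∷ s ∷ t ∷ []

  vN va vz vb vw vf vu vL vs vt : Expr 10
  vN = var zero
  va = var (suc zero)
  vz = var (suc (suc zero))
  vb = var (suc (suc (suc zero)))
  vw = var (suc (suc (suc (suc zero))))
  vf = var (suc (suc (suc (suc (suc zero)))))
  vu = var (suc (suc (suc (suc (suc (suc zero))))))
  vL = var (suc (suc (suc (suc (suc (suc (suc zero)))))))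
  vs = var (suc (suc (suc (suc (suc (suc (suc (suc zero))))))))
  vt = var (suc (suc (suc (suc (suc (suc (suc (suc (suc zero)))))))))

  h0 h1 hU hL : Ineq ρ
  h0 = ineq (va ⊕ vz ⊕ (vb ⊕ vw) ⊕ vf) (con 3 ⊗ vN) h₀
  h1 = ineq (con 2 ⊗ vf) (vN) h₁
  hU = ineq (con 2 ⊗ vu) (con 2 ⊗ vL ⊕ vf ⊗ vN) hᵤ
  hL = ineq (con 100 ⊗ (con 100 ⊗ vL)) (vN ⊗ vN) hₗ

  positive₀ : ∀ D .{{_ : NonZero D}} → 0 < D * (N * N)
  positive₀ D = *-mono-≤ {1} {D} {1} {N * N} (>-nonZero⁻¹ D) (*-mono-≤ N>0 N>0)

  positive : ∀ D M .{{_ : NonZero D}} → 0 < D * (N * N) + M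
  positive D M = ≤-trans (positive₀ D) (m≤m+n (D * (N * N)) M)

  -- Here `a` and `b` count the members of X and Y that contain a fixed element, `z` and `w` those
  -- that do not. At the extreme, the frequencies are 8/25 and both sides have size 3N/2, which
  -- gives 2(8/25)(17/25)(9/4) = 0.98 < 1 in units of N².
  element-numerics : 17 * a ≤ 8 * z → 17 * b ≤ 8 * w → N * N ≤ u + (a * w + z * b) → Void
  element-numerics p q g = refute
    (con 425000 ⊡ hU
     ⊞ con 85 ⊡ hL
     ⊞ con 850000 ⊡ hG
     ⊞ con 1280 ⊡ (cross hP hQ)
     ⊞ con 92480 ⊡ (square (va ⊕ vz) (vb ⊕ vw))
     ⊞ con 18000 ⊡ (vw ⊡ hP)
     ⊞ con 18000 ⊡ (vz ⊡ hQ)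
     ⊞ con 92480 ⊡ ((va ⊕ vz) ⊡ h0)
     ⊞ con 92480 ⊡ ((vb ⊕ vw) ⊡ h0)
     ⊞ con 247928 ⊡ (vN ⊡ h0)
     ⊞ con 29512 ⊡ (vf ⊡ h1)
     ⊞ con 29512 ⊡ (cross h1 h0))
    (con 17595 ⊗ (vN ⊗ vN) ⊕ (con 33456 ⊗ (va ⊗ vf) ⊕ con 33456 ⊗ (vz ⊗ vf) ⊕ con 33456 ⊗ (vb ⊗ vf) ⊕ con 33456 ⊗ (vw ⊗ vf))) refl (positive 17595 _)
    where
    hP = ineq (con 17 ⊗ va) (con 8 ⊗ vz) p
    hQ = ineq (con 17 ⊗ vb) (con 8 ⊗ vw) q
    hG = ineq (vN ⊗ vN) (vu ⊕ (va ⊗ vw ⊕ vz ⊗ vb)) g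

  -- Otherwise there are, up to the errors, at most 0.8 * 2.2 < 2 pairs in units of N². What matters
  -- later is 0.8 > 1/2: a member of F then costs more pairs with Y than the N/2 sets it can make up
  -- for.
  y-lower : 50 * (N * N) ≤ 25 * u + (25 * (a * (b + w)) + 17 * (z * (b + w))) → 8 * N ≤ 10 * (b + w)
  y-lower f₁ = by-contradiction λ h → refute
    (con 5000 ⊡ hU
     ⊞ con 1 ⊡ hL
     ⊞ con 400 ⊡ hF₁
     ⊞ con 900 ⊡ (vN ⊡ ((ineq (con 10 ⊗ (vb ⊕ vw)) (con 8 ⊗ vN) h)))
     ⊞ con 500 ⊡ (cross ((ineq (con 10 ⊗ (vb ⊕ vw)) (con 8 ⊗ vN) h)) h1)
     ⊞ con 100 ⊡ (square (con 10 ⊗ (vb ⊕ vw)) (con 8 ⊗ vN))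
     ⊞ con 10000 ⊡ ((vb ⊕ vw) ⊡ h0))
    (con 2399 ⊗ (vN ⊗ vN) ⊕ (con 3000 ⊗ (vN ⊗ vf) ⊕ con 3200 ⊗ (vz ⊗ vb) ⊕ con 3200 ⊗ (vz ⊗ vw))) refl (positive 2399 _)
    where
    hF₁ = ineq (con 50 ⊗ (vN ⊗ vN)) (con 25 ⊗ vu ⊕ (con 25 ⊗ (va ⊗ (vb ⊕ vw)) ⊕ con 17 ⊗ (vz ⊗ (vb ⊕ vw)))) f₁

  -- With y = b + w, N = 1 and no errors, f₁ and h₀ give z ≤ (25/8)(3 - y - 2/y), whose maximum 0.54
  -- is at y = √2. The two squares are centred at 1.4 and 1.45, on either side of this point.
  z-upper : 50 * (N * N) ≤ 25 * u + (25 * (a * (b + w)) + 17 * (z * (b + w))) → 8 * N ≤ 10 * (b + w) → 100 * z + 60 * f ≤ 55 * N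
  z-upper f₁ y = by-contradiction λ h → refute
    (con 5000 ⊡ hU
     ⊞ con 1 ⊡ hL
     ⊞ con 400 ⊡ hF₁
     ⊞ con 32 ⊡ ((vb ⊕ vw) ⊡ ((ineq (con 55 ⊗ vN) (con 100 ⊗ vz ⊕ con 60 ⊗ vf) h)))
     ⊞ con 808 ⊡ (vf ⊡ hY)
     ⊞ con 76 ⊡ (square (con 10 ⊗ (vb ⊕ vw)) (con 14 ⊗ vN))
     ⊞ con 6 ⊡ (square (con 20 ⊗ (vb ⊕ vw)) (con 29 ⊗ vN))
     ⊞ con 10000 ⊡ ((vb ⊕ vw) ⊡ h0))
    (con 57 ⊗ (vN ⊗ vN) ⊕ (con 1464 ⊗ (vN ⊗ vf))) refl (positive 57 _)
    where
    hF₁ = ineq (con 50 ⊗ (vN ⊗ vN)) (con 25 ⊗ vu ⊕ (con 25 ⊗ (va ⊗ (vb ⊕ vw)) ⊕ con 17 ⊗ (vz ⊗ (vb ⊕ vw)))) f₁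
    hY = ineq (con 8 ⊗ vN) (con 10 ⊗ (vb ⊕ vw)) y

  -- With y = b + w, N = 1 and no errors, a ≥ (50/y + 17y - 51)/8, whose minimum 0.91 is near y =
  -- 1.7, where the square is centred. Any bound above 1/2 determines the power of two in
  -- `large-power`.
  a-lower : 50 * (N * N) ≤ 25 * u + (25 * (a * (b + w)) + 17 * (z * (b + w))) → 8 * N ≤ 10 * (b + w) → 88 * N ≤ 100 * a
  a-lower f₁ y = by-contradiction λ h → refute
    (con 20000 ⊡ hU
     ⊞ con 4 ⊡ hL
     ⊞ con 1600 ⊡ hF₁
     ⊞ con 125 ⊡ ((vb ⊕ vw) ⊡ ((ineq (con 100 ⊗ va) (con 88 ⊗ vN) h)))
     ⊞ con 2750 ⊡ (vf ⊡ hY)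
     ⊞ con 275 ⊡ (square (con 10 ⊗ (vb ⊕ vw)) (con 17 ⊗ vN))
     ⊞ con 27500 ⊡ ((vb ⊕ vw) ⊡ h0))
    (con 521 ⊗ (vN ⊗ vN) ⊕ (con 2000 ⊗ (vN ⊗ vf) ⊕ con 300 ⊗ (vz ⊗ vb) ⊕ con 300 ⊗ (vz ⊗ vw))) refl (positive 521 _)
    where
    hF₁ = ineq (con 50 ⊗ (vN ⊗ vN)) (con 25 ⊗ vu ⊕ (con 25 ⊗ (va ⊗ (vb ⊕ vw)) ⊕ con 17 ⊗ (vz ⊗ (vb ⊕ vw)))) f₁
    hY = ineq (con 8 ⊗ vN) (con 10 ⊗ (vb ⊕ vw)) y

  -- Since b + t = 2N, the conclusion says b + w ≤ 1.68 N. With y = b + w and N = 1 it comes from (3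
  -- - y) y - 0.32 z y ≥ 2 and z ≥ 0.42; the remaining term of f₃, -(a - 1/2) w, is negative by the
  -- bound on a.
  t-lower : 100 * (N * N) ≤ 50 * u + (50 * (a * b) + 34 * (z * (b + w)) + 25 * (N * w)) → 8 * N ≤ 10 * (b + w) → 42 * N ≤ 100 * z → 88 * N ≤ 100 * a → b + t ≡ 2 * N → 32 * N + 100 * w ≤ 100 * t
  t-lower f₃ y z≥ a≥ eb = by-contradiction λ h → refute
    (con 125000 ⊡ hU
     ⊞ con 25 ⊡ hL
     ⊞ con 5000 ⊡ hF₃
     ⊞ con 2500 ⊡ (vw ⊡ hA)
     ⊞ con 800 ⊡ ((vb ⊕ vw) ⊡ hZ)
     ⊞ con 25000 ⊡ (vf ⊡ hY)
     ⊞ con 519 ⊡ (vN ⊡ ((ineq (con 100 ⊗ vt) (con 32 ⊗ vN ⊕ con 100 ⊗ vw) h)))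
     ⊞ con 475 ⊡ ((vb ⊕ vw) ⊡ ((ineq (con 100 ⊗ vt) (con 32 ⊗ vN ⊕ con 100 ⊗ vw) h)))
     ⊞ con 2025 ⊡ (square (con 10 ⊗ (vb ⊕ vw)) (con 17 ⊗ vN))
     ⊞ con 250000 ⊡ ((vb ⊕ vw) ⊡ h0)
     ⊞ con 51900 ⊡ (vN ⊡ hB′)
     ⊞ con 47500 ⊡ (vb ⊡ hB′)
     ⊞ con 37500 ⊡ (vf ⊡ hB))
    (con 1942 ⊗ (vN ⊗ vN) ⊕ (con 47500 ⊗ (vb ⊗ vw) ⊕ con 37500 ⊗ (vb ⊗ vf) ⊕ con 47500 ⊗ (vw ⊗ vt) ⊕ con 37500 ⊗ (vf ⊗ vt))) refl (positive 1942 _)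
    where
    hF₃ = ineq (con 100 ⊗ (vN ⊗ vN)) (con 50 ⊗ vu ⊕ (con 50 ⊗ (va ⊗ vb) ⊕ con 34 ⊗ (vz ⊗ (vb ⊕ vw)) ⊕ con 25 ⊗ (vN ⊗ vw))) f₃
    hY = ineq (con 8 ⊗ vN) (con 10 ⊗ (vb ⊕ vw)) y
    hZ = ineq (con 42 ⊗ vN) (con 100 ⊗ vz) z≥
    hA = ineq (con 88 ⊗ vN) (con 100 ⊗ va) a≥
    hB = ineq (vb ⊕ vt) (con 2 ⊗ vN) (≤-reflexive eb)
    hB′ = ineq (con 2 ⊗ vN) (vb ⊕ vt) (≤-reflexive (sym eb))

  -- Up to the errors and with N = 1, f₃ leaves (a - 1/2) w ≤ 0.053, hence w ≤ 0.14. But f₅ gives (1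
  -- - z) t ≤ (1/2 + z) w, and with z ≤ 0.55 and t ≥ 0.32 + w this demands w ≥ 0.24.
  large-z : 100 * (N * N) ≤ 50 * u + (50 * (a * b) + 34 * (z * (b + w)) + 25 * (N * w)) → 2 * (t * N) ≤ 2 * u + (2 * (z * t) + N * w + 2 * (z * w)) → 8 * N ≤ 10 * (b + w) → 42 * N ≤ 100 * z → 100 * z + 60 * f ≤ 55 * N → 88 * N ≤ 100 * a → 32 * N + 100 * w ≤ 100 * t → Void
  large-z f₃ f₅ y z≥ z≤ a≥ t≥ = refute
    (con 12760000 ⊡ hU
     ⊞ con 2552 ⊡ hL
     ⊞ con 319000 ⊡ hF₃
     ⊞ con 4785000 ⊡ hF₅
     ⊞ con 159500 ⊡ (vw ⊡ hA)
     ⊞ con 51040 ⊡ ((vb ⊕ vw) ⊡ hZ)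
     ⊞ con 1595000 ⊡ (vf ⊡ hY)
     ⊞ con 43065 ⊡ (vN ⊡ hT)
     ⊞ con 95700 ⊡ (vt ⊡ hZ′)
     ⊞ con 101500 ⊡ (vw ⊡ hZ′)
     ⊞ con 39402 ⊡ (square (con 20 ⊗ (vb ⊕ vw)) (con 29 ⊗ vN))
     ⊞ con 15950000 ⊡ ((vb ⊕ vw) ⊡ h0))
    (con 138446 ⊗ (vN ⊗ vN) ⊕ (con 580000 ⊗ (vz ⊗ vw) ⊕ con 189200 ⊗ (vb ⊗ vb) ⊕ con 378400 ⊗ (vb ⊗ vw) ⊕ con 189200 ⊗ (vw ⊗ vw) ⊕ con 6090000 ⊗ (vw ⊗ vf) ⊕ con 5742000 ⊗ (vf ⊗ vt))) refl (positive 138446 _)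
    where
    hF₃ = ineq (con 100 ⊗ (vN ⊗ vN)) (con 50 ⊗ vu ⊕ (con 50 ⊗ (va ⊗ vb) ⊕ con 34 ⊗ (vz ⊗ (vb ⊕ vw)) ⊕ con 25 ⊗ (vN ⊗ vw))) f₃
    hF₅ = ineq (con 2 ⊗ (vt ⊗ vN)) (con 2 ⊗ vu ⊕ (con 2 ⊗ (vz ⊗ vt) ⊕ vN ⊗ vw ⊕ con 2 ⊗ (vz ⊗ vw))) f₅
    hY = ineq (con 8 ⊗ vN) (con 10 ⊗ (vb ⊕ vw)) y
    hZ = ineq (con 42 ⊗ vN) (con 100 ⊗ vz) z≥
    hZ′ = ineq (con 100 ⊗ vz ⊕ con 60 ⊗ vf) (con 55 ⊗ vN) z≤
    hA = ineq (con 88 ⊗ vN) (con 100 ⊗ va) a≥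
    hT = ineq (con 32 ⊗ vN ⊕ con 100 ⊗ vw) (con 100 ⊗ vt) t≥

  -- Up to the errors and with N = 1, f₅ reads (1 - z) t ≤ (1/2 + z) w, so t is at most 0.92 * 0.55
  -- / 0.58 < 0.88.
  t-upper : 2 * (t * N) ≤ 2 * u + (2 * (z * t) + N * w + 2 * (z * w)) → 100 * z ≤ 42 * N → 100 * w + 60 * f ≤ 55 * N → 100 * t ≤ 95 * N
  t-upper f₅ z≤ w≤ = by-contradiction λ h → refute
    (con 5000 ⊡ hU
     ⊞ con 1 ⊡ hL
     ⊞ con 5000 ⊡ hF₅
     ⊞ con 58 ⊡ (vN ⊡ ((ineq (con 95 ⊗ vN) (con 100 ⊗ vt) h)))
     ⊞ con 1 ⊡ (cross hZ ((ineq (con 95 ⊗ vN) (con 100 ⊗ vt) h)))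
     ⊞ con 100 ⊡ (vw ⊡ hZ)
     ⊞ con 95 ⊡ (vN ⊡ hZ)
     ⊞ con 92 ⊡ (vN ⊡ hW))
    (con 449 ⊗ (vN ⊗ vN) ⊕ (con 520 ⊗ (vN ⊗ vf))) refl (positive 449 _)
    where
    hF₅ = ineq (con 2 ⊗ (vt ⊗ vN)) (con 2 ⊗ vu ⊕ (con 2 ⊗ (vz ⊗ vt) ⊕ vN ⊗ vw ⊕ con 2 ⊗ (vz ⊗ vw))) f₅
    hZ = ineq (con 100 ⊗ vz) (con 42 ⊗ vN) z≤
    hW = ineq (con 100 ⊗ vw ⊕ con 60 ⊗ vf) (con 55 ⊗ vN) w≤

  -- Put N = 1, a = 1 - s and b = 2 - t. Then h₀ reads z + w + f ≤ s + t, and with f₄ it gives 2s +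
  -- w + f ≤ 2L + 2zw + 2st. The products are absorbed because z < 1/2 and t < 1, which bounds s, w
  -- and f by multiples of L. Next f₅ bounds t, and h₀ bounds z.
  conclusion : 4 * (N * N) ≤ 2 * u + (2 * (a * b) + 2 * (N * z) + N * w + 2 * (z * w)) → 2 * (t * N) ≤ 2 * u + (2 * (z * t) + N * w + 2 * (z * w)) → 100 * z ≤ 42 * N → 100 * t ≤ 95 * N → b + t ≡ 2 * N → a + s ≡ N → N * (z + w + f + s + t) ≤ 200 * L
  conclusion f₄ f₅ z≤ t≤ eb ea = *-cancelˡ-≤ 24990 (conclude
    (con 2499000 ⊡ hU
     ⊞ con 2157920 ⊡ hF₄
     ⊞ con 341080 ⊡ hF₅
     ⊞ con 41932 ⊡ (vs ⊡ hT)
     ⊞ con 49980 ⊡ (vw ⊡ hZ)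
     ⊞ con 5410 ⊡ (vt ⊡ hZ)
     ⊞ con 4623150 ⊡ (vN ⊡ h0)
     ⊞ con 2618885 ⊡ (vN ⊡ hB′)
     ⊞ con 2311575 ⊡ (va ⊡ hB)
     ⊞ con 2004265 ⊡ (vb ⊡ hS)
     ⊞ con 2004265 ⊡ (vs ⊡ hB′)
     ⊞ con 2188935 ⊡ (vt ⊡ hS′)
     ⊞ con 141160 ⊡ (vz ⊡ hB))
    (con 24990 ⊗ (vN ⊗ (vz ⊕ vw ⊕ vf ⊕ vs ⊕ vt))) (con 24990 ⊗ (con 200 ⊗ vL))
    (con 2099160 ⊗ (vN ⊗ vf) ⊕ con 122640 ⊗ (va ⊗ vt) ⊕ con 141160 ⊗ (vz ⊗ vb)) refl)
    where
    hF₄ = ineq (con 4 ⊗ (vN ⊗ vN)) (con 2 ⊗ vu ⊕ (con 2 ⊗ (va ⊗ vb) ⊕ con 2 ⊗ (vN ⊗ vz) ⊕ vN ⊗ vw ⊕ con 2 ⊗ (vz ⊗ vw))) f₄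
    hF₅ = ineq (con 2 ⊗ (vt ⊗ vN)) (con 2 ⊗ vu ⊕ (con 2 ⊗ (vz ⊗ vt) ⊕ vN ⊗ vw ⊕ con 2 ⊗ (vz ⊗ vw))) f₅
    hZ = ineq (con 100 ⊗ vz) (con 42 ⊗ vN) z≤
    hT = ineq (con 100 ⊗ vt) (con 95 ⊗ vN) t≤
    hB = ineq (vb ⊕ vt) (con 2 ⊗ vN) (≤-reflexive eb)
    hB′ = ineq (con 2 ⊗ vN) (vb ⊕ vt) (≤-reflexive (sym eb))
    hS = ineq (va ⊕ vs) (vN) (≤-reflexive ea)
    hS′ = ineq (vN) (va ⊕ vs) (≤-reflexive (sym ea))

-- Counting subsets by their trace

#-member : ∀ {m} (i : Fin (suc m)) → # (λ A → lookup A i) ≡ 2 ^ m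
#-member {m} zero = trans (∑-all-suc {m} (λ A → 𝟙 (lookup A zero))) (cong₂ _+_ (∑-zero (all m)) (#-true m))
#-member {suc m} (suc i) = trans (∑-all-suc (λ A → 𝟙 (lookup A (suc i))))
  (cong₂ _+_ (#-member i) (trans (#-member i) (sym (+-identityʳ _))))

∣S∣+∣∁S∣ : ∀ {n} (S : Subset n) → ∣ S ∣ + ∣ ∁ S ∣ ≡ n
∣S∣+∣∁S∣ []          = refl
∣S∣+∣∁S∣ (true ∷ S)  = cong suc (∣S∣+∣∁S∣ S)
∣S∣+∣∁S∣ (false ∷ S) = trans (+-suc ∣ S ∣ _) (cong suc (∣S∣+∣∁S∣ S))

opaque
  unfolding D _⊆ᵇ_

  D-member : ∀ {n} (B C : Subset n) i → D B C ≡ true → lookup B i ≡ true → lookup C i ≡ false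
  D-member (true ∷ B)  (false ∷ C) zero    e h = refl
  D-member (true ∷ B)  (false ∷ C) (suc i) e h = D-member B C i e h
  D-member (false ∷ B) (c ∷ C)     (suc i) e h = D-member B C i e h

  ⊈-member : ∀ {n} (A S : Subset n) → A ⊆ᵇ S ≡ false → ∃ λ i → lookup A i ≡ true × lookup S i ≡ false
  ⊈-member []          []          ()
  ⊈-member (true ∷ A)  (true ∷ S)  e = let i , h = ⊈-member A S e in suc i , h
  ⊈-member (true ∷ A)  (false ∷ S) e = zero , refl , refl
  ⊈-member (false ∷ A) (x ∷ S)     e = let i , h = ⊈-member A S e in suc i , h

  -- A set disjoint from `B` must omit `i`, which excludes half of the subsets of `T`.
  #-avoiding : ∀ {n} (B T : Subset n) i → lookup B i ≡ true → lookup T i ≡ true →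
               2 * # (λ C → (C ⊆ᵇ T) ∧ D B C) ≤ 2 ^ ∣ T ∣
  #-avoiding {suc n} (true ∷ B) (true ∷ T) zero hB hT = *-monoʳ-≤ 2 (begin
    # (λ C → (C ⊆ᵇ (true ∷ T)) ∧ D (true ∷ B) C)
      ≡⟨ ∑-all-suc (λ C → 𝟙 ((C ⊆ᵇ (true ∷ T)) ∧ D (true ∷ B) C)) ⟩
    # (λ C → (C ⊆ᵇ T) ∧ D B C) + # (λ C → (C ⊆ᵇ T) ∧ false)
      ≡⟨ cong (# (λ C → (C ⊆ᵇ T) ∧ D B C) +_) (trans (∑-cong (all n) (λ C → cong 𝟙 (∧-false (C ⊆ᵇ T)))) (∑-zero (all n))) ⟩
    # (λ C → (C ⊆ᵇ T) ∧ D B C) + 0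
      ≡⟨ +-identityʳ _ ⟩
    # (λ C → (C ⊆ᵇ T) ∧ D B C)
      ≤⟨ #-mono {P = λ C → (C ⊆ᵇ T) ∧ D B C} {Q = _⊆ᵇ T} (λ C h → proj₁ (∧-true h)) ⟩
    # (_⊆ᵇ T)
      ≡⟨ #-powerset T ⟩
    2 ^ ∣ T ∣ ∎)
    where open ≤-Reasoning
  #-avoiding {suc n} (x ∷ B) (false ∷ T) (suc i) hB hT = ≤-trans (*-monoʳ-≤ 2 (≤-reflexive
    (trans (∑-all-suc (λ C → 𝟙 ((C ⊆ᵇ (false ∷ T)) ∧ D (x ∷ B) C)))
    (trans (cong₂ _+_ (∑-cong (all n) (λ C → cong (λ d → 𝟙 ((C ⊆ᵇ T) ∧ d)) (head-false x C))) (∑-zero (all n)))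
           (+-identityʳ _))))) (#-avoiding B T i hB hT)
    where head-false : ∀ x C → D (x ∷ B) (false ∷ C) ≡ D B C
          head-false true  C = refl
          head-false false C = refl
  #-avoiding {suc n} (true ∷ B) (true ∷ T) (suc i) hB hT = ≤-trans (*-monoʳ-≤ 2 (≤-reflexive
    (trans (∑-all-suc (λ C → 𝟙 ((C ⊆ᵇ (true ∷ T)) ∧ D (true ∷ B) C)))
    (trans (cong (# (λ C → (C ⊆ᵇ T) ∧ D B C) +_) (trans (∑-cong (all n) (λ C → cong 𝟙 (∧-false (C ⊆ᵇ T)))) (∑-zero (all n))))
           (+-identityʳ _))))) (≤-trans (#-avoiding B T i hB hT) (m≤m+n _ _))
  #-avoiding {suc n} (false ∷ B) (true ∷ T) (suc i) hB hT = ≤-trans (≤-reflexive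
    (trans (cong (2 *_) (∑-all-suc (λ C → 𝟙 ((C ⊆ᵇ (true ∷ T)) ∧ D (false ∷ B) C))))
           (*-distribˡ-+ 2 (# (λ C → (C ⊆ᵇ T) ∧ D B C)) _)))
    (≤-trans (+-mono-≤ (#-avoiding B T i hB hT) (#-avoiding B T i hB hT)) (≤-reflexive (cong (2 ^ ∣ T ∣ +_) (sym (+-identityʳ _)))))

  -- A set corresponds to the pair of its traces on `S` and on the complement of `S`.
  ∑-traces : ∀ {n} (S : Subset n) (f : Subset n → Subset n → ℕ) →
             ∑ (all n) (λ A → f (A ∩ S) (A ∩ ∁ S)) ≡
             ∑ (all n) (λ P → 𝟙 (P ⊆ᵇ S) * ∑ (all n) (λ Q → 𝟙 (Q ⊆ᵇ ∁ S) * f P Q))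
  ∑-traces [] f = lemma (f [] [])
    where lemma : ∀ x → x + 0 ≡ x + 0 + 0 + 0 + 0
          lemma = solve-∀
  ∑-traces {suc n} (true ∷ S) f = trans (∑-all-suc (λ A → f (A ∩ (true ∷ S)) (A ∩ ∁ (true ∷ S))))
    (sym (trans (∑-all-suc (λ P → 𝟙 (P ⊆ᵇ (true ∷ S)) * ∑ (all (suc n)) (λ Q → 𝟙 (Q ⊆ᵇ ∁ (true ∷ S)) * f P Q)))
      (cong₂ _+_ (part false) (part true))))
    where
    part : ∀ x → ∑ (all n) (λ P → 𝟙 ((x ∷ P) ⊆ᵇ (true ∷ S)) * ∑ (all (suc n)) (λ Q → 𝟙 (Q ⊆ᵇ (false ∷ ∁ S)) * f (x ∷ P) Q))
                 ≡ ∑ (all n) (λ A → f ((x ∧ true) ∷ (A ∩ S)) ((x ∧ false) ∷ (A ∩ ∁ S)))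
    part true  = trans (∑-cong (all n) (λ P → cong (𝟙 (P ⊆ᵇ S) *_) (trans (∑-all-suc (λ Q → 𝟙 (Q ⊆ᵇ (false ∷ ∁ S)) * f (true ∷ P) Q))
                   (trans (cong (∑ (all n) (λ Q → 𝟙 (Q ⊆ᵇ ∁ S) * f (true ∷ P) (false ∷ Q)) +_) (∑-zero (all n))) (+-identityʳ _)))))
                   (sym (∑-traces S (λ P Q → f (true ∷ P) (false ∷ Q))))
    part false = trans (∑-cong (all n) (λ P → cong (𝟙 (P ⊆ᵇ S) *_) (trans (∑-all-suc (λ Q → 𝟙 (Q ⊆ᵇ (false ∷ ∁ S)) * f (false ∷ P) Q))
                   (trans (cong (∑ (all n) (λ Q → 𝟙 (Q ⊆ᵇ ∁ S) * f (false ∷ P) (false ∷ Q)) +_) (∑-zero (all n))) (+-identityʳ _)))))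
                   (sym (∑-traces S (λ P Q → f (false ∷ P) (false ∷ Q))))
  ∑-traces {suc n} (false ∷ S) f = trans (∑-all-suc (λ A → f (A ∩ (false ∷ S)) (A ∩ ∁ (false ∷ S))))
    (sym (trans (∑-all-suc (λ P → 𝟙 (P ⊆ᵇ (false ∷ S)) * ∑ (all (suc n)) (λ Q → 𝟙 (Q ⊆ᵇ ∁ (false ∷ S)) * f P Q)))
      (trans (cong₂ _+_ heads (∑-zero (all n))) (trans (+-identityʳ _) (∑-+ (all n) (F false) (F true))))))
    where
    open ≡-Reasoning
    F R : Bool → Subset n → ℕ
    F x A = f (false ∷ (A ∩ S)) (x ∷ (A ∩ ∁ S))
    R x P = ∑ (all n) (λ Q → 𝟙 (Q ⊆ᵇ ∁ S) * f (false ∷ P) (x ∷ Q))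
    heads : ∑ (all n) (λ P → 𝟙 (P ⊆ᵇ S) * ∑ (all (suc n)) (λ Q → 𝟙 (Q ⊆ᵇ (true ∷ ∁ S)) * f (false ∷ P) Q))
            ≡ ∑ (all n) (λ A → F false A + F true A)
    heads = begin
      ∑ (all n) (λ P → 𝟙 (P ⊆ᵇ S) * ∑ (all (suc n)) (λ Q → 𝟙 (Q ⊆ᵇ (true ∷ ∁ S)) * f (false ∷ P) Q))
        ≡⟨ ∑-cong (all n) (λ P → trans (cong (𝟙 (P ⊆ᵇ S) *_) (∑-all-suc (λ Q → 𝟙 (Q ⊆ᵇ (true ∷ ∁ S)) * f (false ∷ P) Q)))
             (*-distribˡ-+ (𝟙 (P ⊆ᵇ S)) (R false P) (R true P))) ⟩
      ∑ (all n) (λ P → 𝟙 (P ⊆ᵇ S) * R false P + 𝟙 (P ⊆ᵇ S) * R true P)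
        ≡⟨ ∑-+ (all n) (λ P → 𝟙 (P ⊆ᵇ S) * R false P) (λ P → 𝟙 (P ⊆ᵇ S) * R true P) ⟩
      ∑ (all n) (λ P → 𝟙 (P ⊆ᵇ S) * R false P) + ∑ (all n) (λ P → 𝟙 (P ⊆ᵇ S) * R true P)
        ≡⟨ sym (cong₂ _+_ (∑-traces S (λ P Q → f (false ∷ P) (false ∷ Q))) (∑-traces S (λ P Q → f (false ∷ P) (true ∷ Q)))) ⟩
      ∑ (all n) (F false) + ∑ (all n) (F true)
        ≡⟨ sym (∑-+ (all n) (F false) (F true)) ⟩
      ∑ (all n) (λ A → F false A + F true A) ∎

  trace-left : ∀ {n} (B C S : Subset n) → C ⊆ᵇ ∁ S ≡ true → (B ∪ C) ∩ S ≡ B ∩ S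
  trace-left []      []          []          h = refl
  trace-left (b ∷ B) (true ∷ C)  (false ∷ S) h = cong₂ _∷_ (trans (∧-false _) (sym (∧-false b))) (trace-left B C S h)
  trace-left (b ∷ B) (false ∷ C) (s ∷ S)     h = cong₂ _∷_ (cong (_∧ s) (∨-false b)) (trace-left B C S h)
    where ∨-false : ∀ b → b ∨ false ≡ b
          ∨-false true  = refl
          ∨-false false = refl

  traces-union : ∀ {n} (A S : Subset n) → (A ∩ S) ∪ (A ∩ ∁ S) ≡ A
  traces-union []          []          = refl
  traces-union (true ∷ A)  (true ∷ S)  = cong (true ∷_) (traces-union A S)
  traces-union (true ∷ A)  (false ∷ S) = cong (true ∷_) (traces-union A S)
  traces-union (false ∷ A) (s ∷ S)     = cong (false ∷_) (traces-union A S)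

  trace-⊆ : ∀ {n} (A S : Subset n) → (A ∩ S) ⊆ᵇ S ≡ true
  trace-⊆ []          []          = refl
  trace-⊆ (true ∷ A)  (true ∷ S)  = trace-⊆ A S
  trace-⊆ (true ∷ A)  (false ∷ S) = trace-⊆ A S
  trace-⊆ (false ∷ A) (s ∷ S)     = trace-⊆ A S

  trace-right : ∀ {n} (B C S : Subset n) → B ⊆ᵇ S ≡ true → C ⊆ᵇ ∁ S ≡ true → (B ∪ C) ∩ ∁ S ≡ C
  trace-right []          []          []          h k = refl
  trace-right (true ∷ B)  (false ∷ C) (true ∷ S)  h k = cong (false ∷_) (trace-right B C S h k)
  trace-right (false ∷ B) (false ∷ C) (s ∷ S)     h k = cong (false ∷_) (trace-right B C S h k)
  trace-right (false ∷ B) (true ∷ C)  (false ∷ S) h k = cong (true ∷_) (trace-right B C S h k)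

-- Bipartite generators

not-true : ∀ {b} → not b ≡ true → b ≡ false
not-true {false} refl = refl

not-false : ∀ {b} → not b ≡ false → b ≡ true
not-false {true} refl = refl

𝟙-split : ∀ x g → 𝟙 x ≡ 𝟙 (x ∧ g) + 𝟙 (x ∧ not g)
𝟙-split false g     = refl
𝟙-split true  true  = refl
𝟙-split true  false = refl

1≤𝟙 : ∀ {b} → b ≡ true → 1 ≤ 𝟙 b
1≤𝟙 refl = ≤-refl

#-split : ∀ {n} (P Q : Subset n → Bool) → # P ≡ # (λ A → P A ∧ Q A) + # (λ A → P A ∧ not (Q A))
#-split {n} P Q = trans (∑-cong (all n) (λ A → 𝟙-split (P A) (Q A)))
                        (∑-+ (all n) (λ A → 𝟙 (P A ∧ Q A)) (λ A → 𝟙 (P A ∧ not (Q A))))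

module _ {n : ℕ} where

  deg : Family n → Subset n → ℕ
  deg ψ B = ∑ (all n) (λ C → 𝟙 (ψ C) * 𝟙 (D B C))

  edges : Family n → Family n → ℕ
  edges φ ψ = ∑ (all n) (λ B → 𝟙 (φ B) * deg ψ B)

  deg≤ : ∀ ψ B → deg ψ B ≤ # ψ
  deg≤ ψ B = ∑-mono (all n) (λ C → ≤-trans (*-monoʳ-≤ (𝟙 (ψ C)) (𝟙≤1 (D B C))) (≤-reflexive (*-identityʳ _)))

  edges-sym : ∀ (φ ψ : Family n) → edges φ ψ ≡ edges ψ φ
  edges-sym φ ψ = trans (∑-cong (all n) (λ B → sym (∑-*ˡ (𝟙 (φ B)) (all n) _)))
    (trans (∑-swap (all n) (all n) _) (∑-cong (all n) (λ C → trans
      (∑-cong (all n) (λ B → trans (lemma (𝟙 (φ B)) (𝟙 (ψ C)) _) (cong (λ d → 𝟙 (ψ C) * (𝟙 (φ B) * 𝟙 d)) (D-sym B C))))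
      (∑-*ˡ (𝟙 (ψ C)) (all n) _))))
    where lemma : ∀ a b c → a * (b * c) ≡ b * (a * c)
          lemma = solve-∀

  edges-split : ∀ (φ Q ψ : Family n) → edges φ ψ ≡ edges (λ A → φ A ∧ Q A) ψ + edges (λ A → φ A ∧ not (Q A)) ψ
  edges-split φ Q ψ = trans (∑-cong (all n) (λ B → trans (cong (_* deg ψ B) (𝟙-split (φ B) (Q B)))
                                                       (*-distribʳ-+ (deg ψ B) (𝟙 (φ B ∧ Q B)) _)))
                            (∑-+ (all n) _ _)

  edges-row : ∀ c m (φ ψ : Family n) → (∀ B → φ B ≡ true → c * deg ψ B ≤ m) → c * edges φ ψ ≤ # φ * m
  edges-row c m φ ψ h = begin
    c * edges φ ψ                                  ≡⟨ sym (∑-*ˡ c (all n) _) ⟩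
    ∑ (all n) (λ B → c * (𝟙 (φ B) * deg ψ B))      ≤⟨ ∑-mono (all n) (λ B → row (φ B) (h B)) ⟩
    ∑ (all n) (λ B → 𝟙 (φ B) * m)                  ≡⟨ ∑-*ʳ m (all n) _ ⟩
    # φ * m                                        ∎
    where
    open ≤-Reasoning
    row : ∀ b {x} → (b ≡ true → c * x ≤ m) → c * (𝟙 b * x) ≤ 𝟙 b * m
    row true  {x} h = ≤-trans (≤-reflexive (cong (c *_) (+-identityʳ x))) (≤-trans (h refl) (≤-reflexive (sym (+-identityʳ m))))
    row false h = ≤-reflexive (*-zeroʳ c)

  edges≤ : ∀ (φ ψ : Family n) → edges φ ψ ≤ # φ * # ψ
  edges≤ φ ψ = ≤-trans (≤-reflexive (sym (+-identityʳ _)))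
    (edges-row 1 (# ψ) φ ψ (λ B _ → ≤-trans (≤-reflexive (+-identityʳ _)) (deg≤ ψ B)))

  cover : ∀ (X Y : Family n) (P : Subset n → Bool) {I : Set} (is : List I) (w : I → ℕ) (g : I → Subset n) →
          (∀ A → P A ≡ true → Covered X Y A → 1 ≤ ∑ is (λ j → w j * 𝟙 (eqᵇ (g j) A))) →
          # P ≤ uncovered X Y + ∑ is w
  cover X Y P is w g h = begin
    # P                                                       ≤⟨ ∑-mono (all n) (λ A → split (P A) (does (covered? X Y A))) ⟩
    ∑ (all n) (λ A → 𝟙 (not (does (covered? X Y A))) + 𝟙 (P A ∧ does (covered? X Y A)))
                                                              ≡⟨ ∑-+ (all n) (λ A → 𝟙 (not (does (covered? X Y A)))) _ ⟩
    uncovered X Y + # (λ A → P A ∧ does (covered? X Y A))     ≤⟨ +-monoʳ-≤ (uncovered X Y)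
                                                                   (#-image _ is w g (λ A e → h A (proj₁ (∧-true e)) (witness A (proj₂ (∧-true {P A} e))))) ⟩
    uncovered X Y + ∑ is w                                    ∎
    where
    open ≤-Reasoning
    split : ∀ p c → 𝟙 p ≤ 𝟙 (not c) + 𝟙 (p ∧ c)
    split false c     = z≤n
    split true  true  = ≤-refl
    split true  false = ≤-refl
    witness : ∀ A → does (covered? X Y A) ≡ true → Covered X Y A
    witness A e with covered? X Y A
    ... | yes c = c

  pair-weight : ∀ (w : Subset n → Subset n → ℕ) B C → 1 ≤ w B C →
                1 ≤ ∑ (cartesianProduct (all n) (all n)) (λ (B′ , C′) → w B′ C′ * 𝟙 (eqᵇ (B′ ∪ C′) (B ∪ C)))
  pair-weight w B C h = ≤-trans (*-mono-≤ h (1≤𝟙 (eqᵇ-refl (B ∪ C))))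
    (≤-trans (≤∑ (λ C′ → w B C′ * 𝟙 (eqᵇ (B ∪ C′) (B ∪ C))) C)
    (≤-trans (≤∑ (λ B′ → ∑ (all n) (λ C′ → w B′ C′ * 𝟙 (eqᵇ (B′ ∪ C′) (B ∪ C)))) B)
             (≤-reflexive (sym (∑-× (all n) (all n) _)))))

  cover-pairs : ∀ (X Y : Family n) P (w : Subset n → Subset n → ℕ) →
                (∀ B C → X B ≡ true → Y C ≡ true → D B C ≡ true → P (B ∪ C) ≡ true → 1 ≤ w B C) →
                # P ≤ uncovered X Y + ∑ (all n) (λ B → ∑ (all n) (w B))
  cover-pairs X Y P w h = ≤-trans
    (cover X Y P (cartesianProduct (all n) (all n)) (λ (B , C) → w B C) (λ (B , C) → B ∪ C)
      (λ { A p (covered {B} {C} x y disj refl) → pair-weight w B C (h B C x y disj p) }))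
    (≤-reflexive (cong (uncovered X Y +_) (∑-× (all n) (all n) _)))

  covering-bound : ∀ (X Y : Family n) → 2 ^ n ≤ uncovered X Y + edges X Y
  covering-bound X Y = ≤-trans (≤-reflexive (sym (#-true n)))
    (≤-trans (cover-pairs X Y (λ _ → true) (λ B C → 𝟙 (X B) * (𝟙 (Y C) * 𝟙 (D B C)))
               (λ B C x y disj _ → *-mono-≤ (1≤𝟙 x) (*-mono-≤ (1≤𝟙 y) (1≤𝟙 disj))))
             (≤-reflexive (cong (uncovered X Y +_) (∑-cong (all n) (λ B → ∑-*ˡ (𝟙 (X B)) (all n) _)))))

  uncovered-sym : ∀ (X Y : Family n) → uncovered Y X ≤ uncovered X Y
  uncovered-sym X Y = ∑-mono (all n) bound
    where
    bound : ∀ A → 𝟙 (not (does (covered? Y X A))) ≤ 𝟙 (not (does (covered? X Y A)))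
    bound A with covered? X Y A | covered? Y X A
    ... | _      | yes _ = z≤n
    ... | no _   | no _  = ≤-refl
    ... | yes (covered {B} {C} x y disj refl) | no none =
      contradiction (covered y x (D-comm disj) (∪-comm C B)) none

  with-member without-member : Family n → Fin n → ℕ
  with-member    X i = # (λ A → X A ∧ lookup A i)
  without-member X i = # (λ A → X A ∧ not (lookup A i))

  -- Members of `Y` disjoint from `B` must omit `i`, and at most 17/25 of `Y` does.
  deg-member : ∀ Y B i → lookup B i ≡ true → 8 * without-member Y i ≤ 17 * with-member Y i → 25 * deg Y B ≤ 17 * # Y
  deg-member Y B i i∈B h = begin
    25 * deg Y B                                        ≤⟨ *-monoʳ-≤ 25 (∑-mono (all n) (λ C → bound C (D B C) refl)) ⟩
    25 * without-member Y i                             ≡⟨ lemma₁ (without-member Y i) ⟩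
    8 * without-member Y i + 17 * without-member Y i    ≤⟨ +-monoˡ-≤ _ h ⟩
    17 * with-member Y i + 17 * without-member Y i      ≡⟨ trans (sym (*-distribˡ-+ 17 (with-member Y i) (without-member Y i)))
                                                             (cong (17 *_) (sym (#-split Y (λ A → lookup A i)))) ⟩
    17 * # Y                                            ∎
    where
    open ≤-Reasoning
    lemma₁ : ∀ x → 25 * x ≡ 8 * x + 17 * x
    lemma₁ = solve-∀
    bound : ∀ C d → D B C ≡ d → 𝟙 (Y C) * 𝟙 d ≤ 𝟙 (Y C ∧ not (lookup C i))
    bound C false _ = ≤-trans (≤-reflexive (*-zeroʳ (𝟙 (Y C)))) z≤n
    bound C true  e = ≤-trans (≤-reflexive (*-identityʳ _)) (≤-reflexive (cong 𝟙 (sym (trans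
                        (cong (λ b → Y C ∧ not b) (D-member B C i e i∈B)) (∧-identityʳ (Y C))))))

-- In a disjoint pair whose union contains `i`, exactly one of the two members contains `i`.
element-bound : ∀ {m} (X Y : Family (suc m)) i →
  2 ^ m ≤ uncovered X Y + (with-member X i * without-member Y i + without-member X i * with-member Y i)
element-bound {m} X Y i = begin
  2 ^ m                        ≡⟨ sym (#-member i) ⟩
  # (λ A → lookup A i)         ≤⟨ cover-pairs X Y (λ A → lookup A i) (λ B C → p B * q̄ C + p̄ B * q C) weight ⟩
  uncovered X Y + ∑ (all (suc m)) (λ B → ∑ (all (suc m)) (λ C → p B * q̄ C + p̄ B * q C))
    ≡⟨ cong (uncovered X Y +_) (trans (∑-cong (all (suc m)) (λ B → ∑-+ (all (suc m)) (λ C → p B * q̄ C) (λ C → p̄ B * q C)))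
         (trans (∑-+ (all (suc m)) _ _) (cong₂ _+_ (∑-product (all (suc m)) (all (suc m)) p q̄) (∑-product (all (suc m)) (all (suc m)) p̄ q)))) ⟩
  uncovered X Y + (with-member X i * without-member Y i + without-member X i * with-member Y i) ∎
  where
  open ≤-Reasoning
  p p̄ q q̄ : Subset (suc m) → ℕ
  p A = 𝟙 (X A ∧ lookup A i)
  p̄ A = 𝟙 (X A ∧ not (lookup A i))
  q A = 𝟙 (Y A ∧ lookup A i)
  q̄ A = 𝟙 (Y A ∧ not (lookup A i))
  bits : ∀ b c → b ∨ c ≡ true → (b ≡ true → c ≡ false) → 1 ≤ 𝟙 b * 𝟙 (not c) + 𝟙 (not b) * 𝟙 c
  bits true  true  _ h with () ← h refl
  bits true  false _ _ = ≤-refl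
  bits false true  _ _ = ≤-refl
  weight : ∀ B C → X B ≡ true → Y C ≡ true → D B C ≡ true → lookup (B ∪ C) i ≡ true → 1 ≤ p B * q̄ C + p̄ B * q C
  weight B C x y disj h rewrite x | y =
    bits (lookup B i) (lookup C i) (trans (sym (lookup-zipWith _∨_ i B C)) h) (D-member B C i disj)

module Sides {n} (X Y : Family n) (S : Subset n)
             (hX : ∀ i → lookup S i ≡ true  → 8 * without-member X i ≤ 17 * with-member X i)
             (hY : ∀ i → lookup S i ≡ false → 8 * without-member Y i ≤ 17 * with-member Y i) where

  X₀ X₁ Y₀ Y₁ : Family n
  X₀ A = X A ∧ (A ⊆ᵇ S)
  X₁ A = X A ∧ not (A ⊆ᵇ S)
  Y₀ A = Y A ∧ (A ⊆ᵇ ∁ S)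
  Y₁ A = Y A ∧ not (A ⊆ᵇ ∁ S)

  a z b w s t u : ℕ
  a = # X₀
  z = # X₁
  b = # Y₀
  w = # Y₁
  s = # (λ A → (A ⊆ᵇ S) ∧ not (X A))
  t = # (λ A → (A ⊆ᵇ ∁ S) ∧ not (Y A))
  u = uncovered X Y

  #X : # X ≡ a + z
  #X = #-split X (_⊆ᵇ S)

  #Y : # Y ≡ b + w
  #Y = #-split Y (_⊆ᵇ ∁ S)

  missing : ∀ (Z : Family n) R → # (λ A → Z A ∧ (A ⊆ᵇ R)) + # (λ A → (A ⊆ᵇ R) ∧ not (Z A)) ≡ 2 ^ ∣ R ∣
  missing Z R = trans (cong (_+ # (λ A → (A ⊆ᵇ R) ∧ not (Z A))) (∑-cong (all n) (λ A → cong 𝟙 (∧-comm (Z A) (A ⊆ᵇ R)))))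
                      (trans (sym (#-split (_⊆ᵇ R) Z)) (#-powerset R))

  a+s : a + s ≡ 2 ^ ∣ S ∣
  a+s = missing X S

  b+t : b + t ≡ 2 ^ ∣ ∁ S ∣
  b+t = missing Y (∁ S)

  outside-S : ∀ B → X₁ B ≡ true → ∃ λ i → lookup B i ≡ true × lookup S i ≡ false
  outside-S B h = ⊈-member B S (not-true (proj₂ (∧-true {X B} h)))

  inside-S : ∀ C → Y₁ C ≡ true → ∃ λ i → lookup C i ≡ true × lookup S i ≡ true
  inside-S C h = let i , i∈C , i∉∁S = ⊈-member C (∁ S) (not-true (proj₂ (∧-true {Y C} h)))
                 in i , i∈C , not-false (trans (sym (lookup-map i not S)) i∉∁S)

  X₁-degree : ∀ B → X₁ B ≡ true → 25 * deg Y B ≤ 17 * (b + w)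
  X₁-degree B h = let i , i∈B , i∉S = outside-S B h
                  in ≤-trans (deg-member Y B i i∈B (hY i i∉S)) (≤-reflexive (cong (17 *_) #Y))

  Y₁-degree : ∀ C → Y₁ C ≡ true → 25 * deg X C ≤ 17 * (a + z)
  Y₁-degree C h = let i , i∈C , i∈S = inside-S C h
                  in ≤-trans (deg-member X C i i∈C (hX i i∈S)) (≤-reflexive (cong (17 *_) #X))

  -- The members of `Z` inside `R` are bounded by the whole power set of `R`, so no knowledge of `Z`
  -- enters.
  deg-half : ∀ (Z : Family n) B R i → lookup B i ≡ true → lookup R i ≡ true →
             2 * deg (λ A → Z A ∧ (A ⊆ᵇ R)) B ≤ 2 ^ ∣ R ∣
  deg-half Z B R i i∈B i∈R = ≤-trans (*-monoʳ-≤ 2 (∑-mono (all n) (λ C →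
      ≤-trans (≤-reflexive (sym (𝟙-∧ (Z C ∧ (C ⊆ᵇ R)) (D B C)))) (drop (Z C) ((C ⊆ᵇ R)) (D B C)))))
    (#-avoiding B R i i∈B i∈R)
    where
    drop : ∀ x y d → 𝟙 ((x ∧ y) ∧ d) ≤ 𝟙 (y ∧ d)
    drop true  y d = ≤-refl
    drop false y d = z≤n

  X₁Y₀ : 2 * edges X₁ Y₀ ≤ z * 2 ^ ∣ ∁ S ∣
  X₁Y₀ = edges-row 2 _ X₁ Y₀ (λ B h → let i , i∈B , i∉S = outside-S B h
           in deg-half Y B (∁ S) i i∈B (trans (lookup-map i not S) (cong not i∉S)))

  X₀Y₁ : 2 * edges X₀ Y₁ ≤ w * 2 ^ ∣ S ∣
  X₀Y₁ = ≤-trans (≤-reflexive (cong (2 *_) (edges-sym X₀ Y₁)))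
           (edges-row 2 _ Y₁ X₀ (λ C h → let i , i∈C , i∈S = inside-S C h in deg-half X C S i i∈C i∈S))

  split-X : ∀ ψ → edges X ψ ≡ edges X₀ ψ + edges X₁ ψ
  split-X = edges-split X (_⊆ᵇ S)

  split-Y : ∀ φ → edges φ Y ≡ edges φ Y₀ + edges φ Y₁
  split-Y φ = trans (edges-sym φ Y) (trans (edges-split Y (_⊆ᵇ ∁ S) φ) (cong₂ _+_ (edges-sym Y₀ φ) (edges-sym Y₁ φ)))

  open ≤-Reasoning

  -- Only the frequencies of elements enter, not the size of `S`; this makes the bound available for
  -- determining that size.
  fact₁ : 25 * 2 ^ n ≤ 25 * u + (25 * (a * (b + w)) + 17 * (z * (b + w)))
  fact₁ = begin
    25 * 2 ^ n                                          ≤⟨ *-monoʳ-≤ 25 (covering-bound X Y) ⟩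
    25 * (u + edges X Y)                                ≡⟨ trans (cong (λ e → 25 * (u + e)) (split-X Y)) (lemma₁ u (edges X₀ Y) (edges X₁ Y)) ⟩
    25 * u + (25 * edges X₀ Y + 25 * edges X₁ Y)        ≤⟨ +-monoʳ-≤ (25 * u) (+-mono-≤
                                                             (*-monoʳ-≤ 25 (≤-trans (edges≤ X₀ Y) (≤-reflexive (cong (a *_) #Y))))
                                                             (edges-row 25 _ X₁ Y X₁-degree)) ⟩
    25 * u + (25 * (a * (b + w)) + z * (17 * (b + w)))  ≡⟨ cong (λ e → 25 * u + (25 * (a * (b + w)) + e)) (lemma₂ z (b + w)) ⟩
    25 * u + (25 * (a * (b + w)) + 17 * (z * (b + w)))  ∎
    where
    lemma₁ : ∀ u x y → 25 * (u + (x + y)) ≡ 25 * u + (25 * x + 25 * y)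
    lemma₁ = solve-∀
    lemma₂ : ∀ z y → z * (17 * y) ≡ 17 * (z * y)
    lemma₂ = solve-∀

  fact₂ : 25 * 2 ^ n ≤ 25 * u + (25 * (b * (a + z)) + 17 * (w * (a + z)))
  fact₂ = begin
    25 * 2 ^ n                                          ≤⟨ *-monoʳ-≤ 25 (covering-bound X Y) ⟩
    25 * (u + edges X Y)                                ≡⟨ trans (cong (λ e → 25 * (u + e)) (split-Y X)) (lemma₁ u (edges X Y₀) (edges X Y₁)) ⟩
    25 * u + (25 * edges X Y₀ + 25 * edges X Y₁)        ≡⟨ cong₂ (λ p q → 25 * u + (25 * p + 25 * q)) (edges-sym X Y₀) (edges-sym X Y₁) ⟩
    25 * u + (25 * edges Y₀ X + 25 * edges Y₁ X)        ≤⟨ +-monoʳ-≤ (25 * u) (+-mono-≤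
                                                             (*-monoʳ-≤ 25 (≤-trans (edges≤ Y₀ X) (≤-reflexive (cong (b *_) #X))))
                                                             (edges-row 25 _ Y₁ X Y₁-degree)) ⟩
    25 * u + (25 * (b * (a + z)) + w * (17 * (a + z)))  ≡⟨ cong (λ e → 25 * u + (25 * (b * (a + z)) + e)) (lemma₂ w (a + z)) ⟩
    25 * u + (25 * (b * (a + z)) + 17 * (w * (a + z)))  ∎
    where
    lemma₁ : ∀ u x y → 25 * (u + (x + y)) ≡ 25 * u + (25 * x + 25 * y)
    lemma₁ = solve-∀
    lemma₂ : ∀ z y → z * (17 * y) ≡ 17 * (z * y)
    lemma₂ = solve-∀

  -- Pairs with a member of `X₁` are bounded by frequencies, those in `X₀` × `Y₁` by half a power
  -- set. This mixture serves the case of large `z`.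
  fact₃ : 50 * 2 ^ n ≤ 50 * u + (50 * (a * b) + 34 * (z * (b + w)) + 25 * (2 ^ ∣ S ∣ * w))
  fact₃ = begin
    50 * 2 ^ n
      ≤⟨ *-monoʳ-≤ 50 (covering-bound X Y) ⟩
    50 * (u + edges X Y)
      ≡⟨ trans (cong (λ e → 50 * (u + e)) (trans (split-X Y) (cong (_+ edges X₁ Y) (split-Y X₀))))
               (lemma₁ u (edges X₀ Y₀) (edges X₀ Y₁) (edges X₁ Y)) ⟩
    50 * u + (50 * edges X₀ Y₀ + 2 * (25 * edges X₁ Y) + 25 * (2 * edges X₀ Y₁))
      ≤⟨ +-monoʳ-≤ (50 * u) (+-mono-≤ (+-mono-≤ (*-monoʳ-≤ 50 (edges≤ X₀ Y₀))
           (*-monoʳ-≤ 2 (edges-row 25 _ X₁ Y X₁-degree))) (*-monoʳ-≤ 25 X₀Y₁)) ⟩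
    50 * u + (50 * (a * b) + 2 * (z * (17 * (b + w))) + 25 * (w * 2 ^ ∣ S ∣))
      ≡⟨ cong₂ (λ p q → 50 * u + (50 * (a * b) + p + 25 * q)) (lemma₂ z (b + w)) (*-comm w _) ⟩
    50 * u + (50 * (a * b) + 34 * (z * (b + w)) + 25 * (2 ^ ∣ S ∣ * w)) ∎
    where
    lemma₁ : ∀ u p q r → 50 * (u + ((p + q) + r)) ≡ 50 * u + (50 * p + 2 * (25 * r) + 25 * (2 * q))
    lemma₁ = solve-∀
    lemma₂ : ∀ z y → 2 * (z * (17 * y)) ≡ 34 * (z * y)
    lemma₂ = solve-∀

  -- Both kinds of mixed pairs are bounded by half a power set, which is sharp enough once `z` is
  -- small.
  fact₄ : 2 * 2 ^ n ≤ 2 * u + (2 * (a * b) + z * 2 ^ ∣ ∁ S ∣ + w * 2 ^ ∣ S ∣ + 2 * (z * w))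
  fact₄ = begin
    2 * 2 ^ n
      ≤⟨ *-monoʳ-≤ 2 (covering-bound X Y) ⟩
    2 * (u + edges X Y)
      ≡⟨ trans (cong (λ e → 2 * (u + e)) (trans (split-X Y) (cong₂ _+_ (split-Y X₀) (split-Y X₁))))
               (lemma u (edges X₀ Y₀) (edges X₀ Y₁) (edges X₁ Y₀) (edges X₁ Y₁)) ⟩
    2 * u + (2 * edges X₀ Y₀ + 2 * edges X₁ Y₀ + 2 * edges X₀ Y₁ + 2 * edges X₁ Y₁)
      ≤⟨ +-monoʳ-≤ (2 * u) (+-mono-≤ (+-mono-≤ (+-mono-≤ (*-monoʳ-≤ 2 (edges≤ X₀ Y₀)) X₁Y₀) X₀Y₁) (*-monoʳ-≤ 2 (edges≤ X₁ Y₁))) ⟩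
    2 * u + (2 * (a * b) + z * 2 ^ ∣ ∁ S ∣ + w * 2 ^ ∣ S ∣ + 2 * (z * w)) ∎
    where
    lemma : ∀ u p q r v → 2 * (u + ((p + q) + (r + v))) ≡ 2 * u + (2 * p + 2 * r + 2 * q + 2 * v)
    lemma = solve-∀

  -- A set whose trace τ on ∁ S is not in Y can only be covered by a pair (B , C) with
  -- B in X₁, and then it is determined by B and τ, or with C in Y₁.
  fact₅ : 2 * (t * 2 ^ ∣ S ∣) ≤ 2 * u + (2 * (z * t) + w * 2 ^ ∣ S ∣ + 2 * (z * w))
  fact₅ = begin
    2 * (t * 2 ^ ∣ S ∣)
      ≡⟨ cong (2 *_) (trans (*-comm t _) (sym fibres)) ⟩
    2 * # P
      ≤⟨ *-monoʳ-≤ 2 (cover X Y P tagged wt target witness) ⟩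
    2 * (u + ∑ tagged wt)
      ≡⟨ cong (λ e → 2 * (u + e)) total ⟩
    2 * (u + (z * t + (edges X₀ Y₁ + edges X₁ Y₁)))
      ≡⟨ lemma u (z * t) (edges X₀ Y₁) (edges X₁ Y₁) ⟩
    2 * u + (2 * (z * t) + 2 * edges X₀ Y₁ + 2 * edges X₁ Y₁)
      ≤⟨ +-monoʳ-≤ (2 * u) (+-mono-≤ (+-monoʳ-≤ (2 * (z * t)) X₀Y₁) (*-monoʳ-≤ 2 (edges≤ X₁ Y₁))) ⟩
    2 * u + (2 * (z * t) + w * 2 ^ ∣ S ∣ + 2 * (z * w)) ∎
    where
    lemma : ∀ u p q r → 2 * (u + (p + (q + r))) ≡ 2 * u + (2 * p + 2 * q + 2 * r)
    lemma = solve-∀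
    P : Subset n → Bool
    P A = not (Y (A ∩ ∁ S))
    τ : Subset n → Bool
    τ Q = (Q ⊆ᵇ ∁ S) ∧ not (Y Q)
    fibres : # P ≡ 2 ^ ∣ S ∣ * t
    fibres = trans (∑-traces S (λ _ Q → 𝟙 (not (Y Q))))
      (trans (∑-cong (all n) (λ A → cong (𝟙 (A ⊆ᵇ S) *_) (∑-cong (all n) (λ Q → sym (𝟙-∧ (Q ⊆ᵇ ∁ S) (not (Y Q)))))))
      (trans (∑-*ʳ t (all n) _) (cong (_* t) (#-powerset S))))
    pairs : List (Subset n × Subset n)
    pairs = cartesianProduct (all n) (all n)
    tagged : List (Bool × Subset n × Subset n)
    tagged = cartesianProduct (true ∷ false ∷ []) pairs
    wt : Bool × Subset n × Subset n → ℕ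
    wt (true  , B , Q) = 𝟙 (X₁ B) * 𝟙 (τ Q)
    wt (false , B , C) = 𝟙 (X B) * (𝟙 (Y₁ C) * 𝟙 (D B C))
    target : Bool × Subset n × Subset n → Subset n
    target (true  , B , Q) = (B ∩ S) ∪ Q
    target (false , B , C) = B ∪ C
    total : ∑ tagged wt ≡ z * t + (edges X₀ Y₁ + edges X₁ Y₁)
    total = trans (∑-× (true ∷ false ∷ []) pairs wt) (cong₂ _+_
      (trans (∑-× (all n) (all n) _) (∑-product (all n) (all n) _ _))
      (trans (+-identityʳ _) (trans (∑-× (all n) (all n) _)
        (trans (∑-cong (all n) (λ B → ∑-*ˡ (𝟙 (X B)) (all n) _)) (split-X Y₁)))))
    tag₁ : ∀ {A} B → X₁ B ≡ true → τ (A ∩ ∁ S) ≡ true → (B ∩ S) ∪ (A ∩ ∁ S) ≡ A →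
           1 ≤ ∑ tagged (λ j → wt j * 𝟙 (eqᵇ (target j) A))
    tag₁ {A} B x h eq = ≤-trans
      (*-mono-≤ (*-mono-≤ (1≤𝟙 x) (1≤𝟙 h)) (1≤𝟙 (trans (cong (λ Z → eqᵇ Z A) eq) (eqᵇ-refl A))))
      (≤-trans (≤∑ (λ Q → 𝟙 (X₁ B) * 𝟙 (τ Q) * 𝟙 (eqᵇ ((B ∩ S) ∪ Q) A)) (A ∩ ∁ S))
      (≤-trans (≤∑ (λ B → ∑ (all n) (λ Q → 𝟙 (X₁ B) * 𝟙 (τ Q) * 𝟙 (eqᵇ ((B ∩ S) ∪ Q) A))) B)
      (≤-trans (≤-reflexive (sym (∑-× (all n) (all n) (λ (B , Q) → 𝟙 (X₁ B) * 𝟙 (τ Q) * 𝟙 (eqᵇ ((B ∩ S) ∪ Q) A)))))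
      (≤-trans (m≤m+n _ _) (≤-reflexive (sym (∑-× (true ∷ false ∷ []) pairs (λ j → wt j * 𝟙 (eqᵇ (target j) A)))))))))
    tag₂ : ∀ B C → 1 ≤ wt (false , B , C) → 1 ≤ ∑ tagged (λ j → wt j * 𝟙 (eqᵇ (target j) (B ∪ C)))
    tag₂ B C h = ≤-trans (pair-weight (λ B C → wt (false , B , C)) B C h)
      (≤-trans (≤-trans (m≤m+n _ 0) (m≤n+m _ (∑ pairs (λ j → wt (true , j) * 𝟙 (eqᵇ (target (true , j)) (B ∪ C))))))
      (≤-reflexive (sym (∑-× (true ∷ false ∷ []) pairs (λ j → wt j * 𝟙 (eqᵇ (target j) (B ∪ C)))))))
    witness : ∀ A → P A ≡ true → Covered X Y A → 1 ≤ ∑ tagged (λ j → wt j * 𝟙 (eqᵇ (target j) A))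
    witness A p (covered {B} {C} x y disj refl) with C ⊆ᵇ ∁ S in c | B ⊆ᵇ S in b
    ... | false | _     = tag₂ B C (*-mono-≤ (1≤𝟙 x) (*-mono-≤ (1≤𝟙 (∧-intro y (cong not c))) (1≤𝟙 disj)))
    -- The trace of `B ∪ C` on the complement of `S` is then `C` itself, which lies in `Y`.
    ... | true  | true  = contradiction (not-true p) (true≢false (subst (λ Z → Y Z ≡ true) (sym (trace-right B C S b c)) y))
    ... | true  | false = tag₁ {B ∪ C} B (∧-intro x (cong not b)) (∧-intro (trace-⊆ (B ∪ C) (∁ S)) p)
                            (trans (cong (_∪ ((B ∪ C) ∩ ∁ S)) (sym (trace-left B C S c))) (traces-union (B ∪ C) S))

-- Stability of bipartite generators

2^[2l] : ∀ l → 2 ^ (2 * l) ≡ 2 ^ l * 2 ^ l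
2^[2l] l = trans (cong (λ m → 2 ^ (l + m)) (+-identityʳ l)) (^-distribˡ-+-* 2 l l)

2^[2l+1] : ∀ c l → c * 2 ^ suc (2 * l) ≡ (c * 2) * (2 ^ l * 2 ^ l)
2^[2l+1] c l = trans (cong (λ x → c * (2 * x)) (2^[2l] l)) (sym (*-assoc c 2 _))

-- A power of two below `2 ^ l` is at most half of it, and 88/100 exceeds one half.
large-power : ∀ l k → 88 * 2 ^ l ≤ 100 * 2 ^ k → l ≤ k
large-power l k h with l ≤? k
... | yes l≤k = l≤k
... | no  l≰k = contradiction (begin
  176 * 2 ^ k       ≡⟨ *-assoc 88 2 (2 ^ k) ⟩
  88 * 2 ^ suc k    ≤⟨ *-monoʳ-≤ 88 (^-monoʳ-≤ 2 (≰⇒> l≰k)) ⟩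
  88 * 2 ^ l        ≤⟨ h ⟩
  100 * 2 ^ k       ∎) (<⇒≱ (*-monoˡ-< (2 ^ k) {{m^n≢0 2 k}} {100} {176} (m≤m+n 101 75)))
  where open ≤-Reasoning

module Stability (l : ℕ) (f L : ℕ) (h₁ : 2 * f ≤ 2 ^ l) (hₗ : 100 * (100 * L) ≤ 2 ^ l * 2 ^ l) where

  n N : ℕ
  n = suc (2 * l)
  N = 2 ^ l

  N>0 : 0 < N
  N>0 = m^n>0 2 l

  module OneSide (X Y : Family n) (S : Subset n)
                 (hX : ∀ i → lookup S i ≡ true  → 8 * without-member X i ≤ 17 * with-member X i)
                 (hY : ∀ i → lookup S i ≡ false → 8 * without-member Y i ≤ 17 * with-member Y i)
                 (h₀ : # X + # Y + f ≤ 3 * N) (hᵤ : 2 * uncovered X Y ≤ 2 * L + f * N) where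

    open Sides X Y S hX hY public

    h₀′ : a + z + (b + w) + f ≤ 3 * N
    h₀′ = subst₂ (λ p q → p + q + f ≤ 3 * N) #X #Y h₀

    h₀″ : b + w + (a + z) + f ≤ 3 * N
    h₀″ = subst (λ p → p + f ≤ 3 * N) (+-comm (a + z) (b + w)) h₀′

    -- The second instance exchanges the sides, so that each bound on `a` and `z` also becomes one
    -- on `b` and `w`.
    module NX = Numerics N a z b w f u L s t N>0 h₀′ h₁ hᵤ hₗ
    module NY = Numerics N b w a z f u L t s N>0 h₀″ h₁ hᵤ hₗ

    F₁ : 50 * (N * N) ≤ 25 * u + (25 * (a * (b + w)) + 17 * (z * (b + w)))
    F₁ = ≤-trans (≤-reflexive (sym (2^[2l+1] 25 l))) fact₁

    F₂ : 50 * (N * N) ≤ 25 * u + (25 * (b * (a + z)) + 17 * (w * (a + z)))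
    F₂ = ≤-trans (≤-reflexive (sym (2^[2l+1] 25 l))) fact₂

    a≥ : 88 * N ≤ 100 * a
    a≥ = NX.a-lower F₁ (NX.y-lower F₁)

    b≥ : 88 * N ≤ 100 * b
    b≥ = NY.a-lower F₂ (NY.y-lower F₂)

    l≤∣S∣ : l ≤ ∣ S ∣
    l≤∣S∣ = large-power l (∣ S ∣) (≤-trans a≥ (*-monoʳ-≤ 100 (≤-trans (m≤m+n a s) (≤-reflexive a+s))))

    l≤∣∁S∣ : l ≤ ∣ ∁ S ∣
    l≤∣∁S∣ = large-power l (∣ ∁ S ∣) (≤-trans b≥ (*-monoʳ-≤ 100 (≤-trans (m≤m+n b t) (≤-reflexive b+t))))

    module _ (∣S∣≡l : ∣ S ∣ ≡ l) where

      ∣∁S∣ : ∣ ∁ S ∣ ≡ suc l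
      ∣∁S∣ = +-cancelˡ-≡ (∣ S ∣) (∣ ∁ S ∣) (suc l) (trans (∣S∣+∣∁S∣ S)
        (trans (cong (λ m → suc (l + m)) (+-identityʳ l)) (trans (sym (+-suc l l)) (cong (_+ suc l) (sym ∣S∣≡l)))))

      2^S : 2 ^ ∣ S ∣ ≡ N
      2^S = cong (2 ^_) ∣S∣≡l

      2^∁S : 2 ^ ∣ ∁ S ∣ ≡ 2 * N
      2^∁S = cong (2 ^_) ∣∁S∣

      F₃ : 100 * (N * N) ≤ 50 * u + (50 * (a * b) + 34 * (z * (b + w)) + 25 * (N * w))
      F₃ = ≤-trans (≤-reflexive (sym (2^[2l+1] 50 l)))
             (≤-trans fact₃ (≤-reflexive (cong (λ x → 50 * u + (50 * (a * b) + 34 * (z * (b + w)) + 25 * (x * w))) 2^S)))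

      F₄ : 4 * (N * N) ≤ 2 * u + (2 * (a * b) + 2 * (N * z) + N * w + 2 * (z * w))
      F₄ = ≤-trans (≤-reflexive (sym (2^[2l+1] 2 l)))
             (≤-trans fact₄ (≤-reflexive (cong₂ (λ x y → 2 * u + (2 * (a * b) + x + y + 2 * (z * w)))
               (trans (cong (z *_) 2^∁S) (lemma z N)) (trans (cong (w *_) 2^S) (*-comm w N)))))
        where lemma : ∀ z N → z * (2 * N) ≡ 2 * (N * z)
              lemma = solve-∀

      F₅ : 2 * (t * N) ≤ 2 * u + (2 * (z * t) + N * w + 2 * (z * w))
      F₅ = ≤-trans (≤-reflexive (cong (λ x → 2 * (t * x)) (sym 2^S)))
             (≤-trans fact₅ (≤-reflexive (cong (λ x → 2 * u + (2 * (z * t) + x + 2 * (z * w)))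
               (trans (cong (w *_) 2^S) (*-comm w N)))))

      b+t≡2N : b + t ≡ 2 * N
      b+t≡2N = trans b+t 2^∁S

      y≥ : 8 * N ≤ 10 * (b + w)
      y≥ = NX.y-lower F₁

      close-small : 100 * z ≤ 42 * N → N * (z + w + f + s + t) ≤ 200 * L
      close-small z≤ = NX.conclusion F₄ F₅ z≤ (NX.t-upper F₅ z≤ (NY.z-upper F₂ (NY.y-lower F₂))) b+t≡2N (trans a+s 2^S)

      not-large : 42 * N ≤ 100 * z → Void
      not-large z≥ = NX.large-z F₃ F₅ y≥ z≥ (NX.z-upper F₁ y≥) a≥ (NX.t-lower F₃ y≥ z≥ a≥ b+t≡2N)

      -- The cases are separated at z = 0.42 N: below it the products in `conclusion` can be
      -- absorbed, above it `large-z` applies.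
      close : N * (z + w + f + s + t) ≤ 200 * L
      close = close-small (by-contradiction not-large)

  module _ (G X Y F : Family n) (F≡f : # F ≡ f)
           (X⊆G : ∀ A → X A ≡ true → G A ≡ true) (Y⊆G : ∀ A → Y A ≡ true → G A ≡ true)
           (G⊆X∪Y∪F : ∀ A → G A ≡ true → X A ≡ true ⊎ Y A ≡ true ⊎ F A ≡ true)
           (h₀ : # X + # Y + f ≤ 3 * N) (hᵤ : 2 * uncovered X Y ≤ 2 * L + f * N) where

    difference : ∀ S hX hY → card (G Δ F₀ S) ≤
      let open OneSide X Y S hX hY h₀ hᵤ in z + w + f + s + t
    difference S hX hY = begin
      card (G Δ F₀ S)
        ≡⟨ countᵇ≡# (G Δ F₀ S) ⟩
      # (G Δ F₀ S)
        ≤⟨ ∑-mono (all n) (λ A → pointwise (G A) (X A) (Y A) (F A) _ _ _ _ (⊆ᵇ-def A S) (⊆ᵇ-def A (∁ S)) (X⊆G A) (Y⊆G A) (G⊆X∪Y∪F A)) ⟩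
      ∑ (all n) (λ A → f₁ A + f₂ A + f₃ A + f₄ A + f₅ A)
        ≡⟨ trans (∑-+ (all n) (λ A → f₁ A + f₂ A + f₃ A + f₄ A) f₅) (cong (_+ ∑ (all n) f₅)
             (trans (∑-+ (all n) (λ A → f₁ A + f₂ A + f₃ A) f₄) (cong (_+ ∑ (all n) f₄)
             (trans (∑-+ (all n) (λ A → f₁ A + f₂ A) f₃) (cong₂ _+_ (∑-+ (all n) f₁ f₂) F≡f))))) ⟩
      z + w + f + s + t ∎
      where
      open ≤-Reasoning
      open OneSide X Y S hX hY h₀ hᵤ
      f₁ f₂ f₃ f₄ f₅ : Subset n → ℕ
      f₁ A = 𝟙 (X₁ A)
      f₂ A = 𝟙 (Y₁ A)
      f₃ A = 𝟙 (F A)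
      f₄ A = 𝟙 ((A ⊆ᵇ S) ∧ not (X A))
      f₅ A = 𝟙 ((A ⊆ᵇ ∁ S) ∧ not (Y A))
      pointwise : ∀ g x y k p q p′ q′ → p ≡ p′ → q ≡ q′ → (x ≡ true → g ≡ true) → (y ≡ true → g ≡ true) →
                  (g ≡ true → x ≡ true ⊎ y ≡ true ⊎ k ≡ true) →
                  𝟙 ((g ∧ not (p′ ∨ q′)) ∨ ((p′ ∨ q′) ∧ not g)) ≤
                  𝟙 (x ∧ not p) + 𝟙 (y ∧ not q) + 𝟙 k + 𝟙 (p ∧ not x) + 𝟙 (q ∧ not y)
      pointwise true x y k true  q _ _ refl refl _ _ _ = z≤n
      pointwise true x y k false true _ _ refl refl _ _ _ = z≤n
      pointwise true true  y k false false _ _ refl refl _ _ _ = s≤s z≤n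
      pointwise true false true  k false false _ _ refl refl _ _ _ = s≤s z≤n
      pointwise true false false true false false _ _ refl refl _ _ _ = s≤s z≤n
      pointwise true false false false false false _ _ refl refl _ _ h with h refl
      ... | inj₁ ()
      ... | inj₂ (inj₁ ())
      ... | inj₂ (inj₂ ())
      pointwise false true  y    k p q _ _ refl refl i j h with () ← i refl
      pointwise false false true k p q _ _ refl refl i j h with () ← j refl
      pointwise false false false k true  q _ _ refl refl i j h = m≤n⇒m≤n+o _ (m≤n+m 1 (𝟙 k))
      pointwise false false false k false true  _ _ refl refl i j h = m≤n+m 1 (𝟙 k + 0)
      pointwise false false false k false false _ _ refl refl i j h = z≤n

  Close : Family n → Set
  Close G = Σ (Subset n) λ S → ∣ S ∣ ≡ l × N * card (G Δ F₀ S) ≤ 200 * L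

  module _ (G X Y F : Family n) (F≡f : # F ≡ f)
           (X⊆G : ∀ A → X A ≡ true → G A ≡ true) (Y⊆G : ∀ A → Y A ≡ true → G A ≡ true)
           (G⊆X∪Y∪F : ∀ A → G A ≡ true → X A ≡ true ⊎ Y A ≡ true ⊎ F A ≡ true)
           (h₀ : # X + # Y + f ≤ 3 * N) (hᵤ : 2 * uncovered X Y ≤ 2 * L + f * N) where

    -- S collects the elements that are frequent in X; by counting the sets that contain
    -- a given element, the others are frequent in Y.
    frequent : Fin n → Bool
    frequent i = not (17 * with-member X i ≤ᵇ 8 * without-member X i)

    S : Subset n
    S = tabulate frequent

    frequent-in-X : ∀ i → lookup S i ≡ true → 8 * without-member X i ≤ 17 * with-member X i
    frequent-in-X i i∈S = <⇒≤ (≰⇒> λ le → contradiction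
      (not-true (trans (sym (lookup∘tabulate frequent i)) i∈S)) (true≢false (T⇒true (≤⇒≤ᵇ le))))
      where T⇒true : ∀ {b} → T b → b ≡ true
            T⇒true {true} _ = refl

    frequent-in-Y : ∀ i → lookup S i ≡ false → 8 * without-member Y i ≤ 17 * with-member Y i
    frequent-in-Y i i∉S = by-contradiction λ rare-in-Y → element-numerics rare-in-X rare-in-Y
      (≤-trans (≤-reflexive (sym (2^[2l] l))) (element-bound X Y i))
      where
      open Numerics N (with-member X i) (without-member X i) (with-member Y i) (without-member Y i)
                    f (uncovered X Y) L 0 0 N>0
                    (subst₂ (λ p q → p + q + f ≤ 3 * N) (#-split X (λ A → lookup A i)) (#-split Y (λ A → lookup A i)) h₀)
                    h₁ hᵤ hₗ
      rare-in-X : 17 * with-member X i ≤ 8 * without-member X i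
      rare-in-X = ≤ᵇ⇒≤ _ _ (subst T (sym (not-false (trans (sym (lookup∘tabulate frequent i)) i∉S))) _)

    module XY = OneSide X Y S frequent-in-X frequent-in-Y h₀ hᵤ

    h₀ˢ : # Y + # X + f ≤ 3 * N
    h₀ˢ = subst (λ p → p + f ≤ 3 * N) (+-comm (# X) (# Y)) h₀

    hᵤˢ : 2 * uncovered Y X ≤ 2 * L + f * N
    hᵤˢ = ≤-trans (*-monoʳ-≤ 2 (uncovered-sym X Y)) hᵤ

    frequent-in-Yˢ : ∀ i → lookup (∁ S) i ≡ true → 8 * without-member Y i ≤ 17 * with-member Y i
    frequent-in-Yˢ i h = frequent-in-Y i (not-true (trans (sym (lookup-map i not S)) h))

    frequent-in-Xˢ : ∀ i → lookup (∁ S) i ≡ false → 8 * without-member X i ≤ 17 * with-member X i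
    frequent-in-Xˢ i h = frequent-in-X i (not-false (trans (sym (lookup-map i not S)) h))

    module YX = OneSide Y X (∁ S) frequent-in-Yˢ frequent-in-Xˢ h₀ˢ hᵤˢ

    G⊆Y∪X∪F : ∀ A → G A ≡ true → Y A ≡ true ⊎ X A ≡ true ⊎ F A ≡ true
    G⊆Y∪X∪F A h with G⊆X∪Y∪F A h
    ... | inj₁ x        = inj₂ (inj₁ x)
    ... | inj₂ (inj₁ y) = inj₁ y
    ... | inj₂ (inj₂ k) = inj₂ (inj₂ k)

    sizes : ∀ p q → l ≤ p → l ≤ q → p + q ≡ suc (2 * l) → p ≡ l ⊎ q ≡ l
    sizes p q l≤p l≤q eq with p ≤? l
    ... | yes p≤l = inj₁ (≤-antisym p≤l l≤p)
    ... | no  p≰l = inj₂ (≤-antisym (+-cancelˡ-≤ (suc l) q l (≤-trans (+-monoˡ-≤ q (≰⇒> p≰l))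
                      (≤-reflexive (trans eq (cong (λ m → suc (l + m)) (+-identityʳ l)))))) l≤q)

    -- The sizes of `S` and of its complement are at least `l` and add up to `2 * l + 1`, so one of
    -- them is `l`; if it is the complement, the sides are exchanged.
    stability : Close G
    stability = [ (λ ∣S∣≡l → S , ∣S∣≡l , ≤-trans (*-monoʳ-≤ N
                    (difference G X Y F F≡f X⊆G Y⊆G G⊆X∪Y∪F h₀ hᵤ S frequent-in-X frequent-in-Y)) (XY.close ∣S∣≡l))
                , (λ ∣∁S∣≡l → ∁ S , ∣∁S∣≡l , ≤-trans (*-monoʳ-≤ N
                    (difference G Y X F F≡f Y⊆G X⊆G G⊆Y∪X∪F h₀ˢ hᵤˢ (∁ S) frequent-in-Yˢ frequent-in-Xˢ)) (YX.close ∣∁S∣≡l))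
                ]′ (sizes (∣ S ∣) (∣ ∁ S ∣) XY.l≤∣S∣ XY.l≤∣∁S∣ (∣S∣+∣∁S∣ S))

-- Disjoint generators

module FewCycles {n} (gs : List (Subset n)) (sparse : ∀ S → ∑ gs (λ v → 𝟙 (v ⊆ᵇ S)) ≤ 2 ^ ∣ S ∣)
                 (N : ℕ) (N>0 : 0 < N) (gs≤ : length gs ≤ 3 * N) (k s : ℕ) (short : n + n < 5 * suc s) where

  open Graph gs
  open Cycles gs sparse N N>0 gs≤ k s hiding (V)

  T₃≡ : T₃ ≡ ∑ g3 (λ x → 𝟙 (triangle x))
  T₃≡ = sym (trans (∑-× gs g2 _) (∑-cong gs (λ u → trans (∑-× gs g1 _) (∑-cong gs (λ A → trans (∑-× gs pt _) (∑-cong gs (λ B →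
    trans (+-identityʳ _) (trans (𝟙-⩓ (D u A) _) (trans (cong (e u A *_) (𝟙-⩓ (D A B) (D B u))) (sym (*-assoc (e u A) _ _)))))))))))

  T₅≡ : T₅ ≡ ∑ g5 (λ x → 𝟙 (pentagon x))
  T₅≡ = sym (trans (∑-× gs g4 _) (∑-cong gs (λ u → begin
    ∑ g4 (λ x → 𝟙 (pentagon (u , x)))
      ≡⟨ trans (∑-× gs g3 _) (∑-cong gs (λ y → trans (∑-× gs g2 _) (∑-cong gs (λ A → trans (∑-× gs g1 _) (∑-cong gs (λ B →
           trans (∑-× gs pt _) (trans (∑-cong gs (λ z → trans (+-identityʳ _) (product u y A B z)))
             (∑-*ˡ (e u y * e y A * e A B) gs (λ z → e B z * e z u))))))))) ⟩
    ∑ gs (λ y → ∑² (λ A B → e u y * e y A * e A B * cod B u))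
      ≡⟨ sym (∑²-∑ (λ A B y → e u y * e y A * e A B * cod B u)) ⟩
    ∑² (λ A B → ∑ gs (λ y → e u y * e y A * e A B * cod B u))
      ≡⟨ ∑²-cong (λ A B → trans (∑-*ʳ (cod B u) gs (λ y → e u y * e y A * e A B))
                                (cong (_* cod B u) (∑-*ʳ (e A B) gs (λ y → e u y * e y A)))) ⟩
    pent u ∎)))
    where
    open ≡-Reasoning
    assoc : ∀ a b c d f → a * (b * (c * (d * f))) ≡ a * b * c * (d * f)
    assoc = solve-∀
    product : ∀ u y A B z → 𝟙 (D u y ⩓ D y A ⩓ D A B ⩓ D B z ⩓ D z u) ≡ e u y * e y A * e A B * (e B z * e z u)
    product u y A B z = trans (𝟙-⩓ (D u y) _) (trans (cong (e u y *_) (trans (𝟙-⩓ (D y A) _) (cong (e y A *_)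
      (trans (𝟙-⩓ (D A B) _) (cong (e A B *_) (𝟙-⩓ (D B z) (D z u))))))) (assoc (e u y) (e y A) (e A B) (e B z) (e z u)))

  -- The factor 243 = 3⁵ turns a bound by `(3 * N) ^ 5` into one by N⁵; it also more than suffices
  -- for triangles.
  Large⁺ : ℕ → Set
  Large⁺ r = Large (grow k (grow k (grow k (grow k (243 * r)))))

  module _ (r : ℕ) (r>0 : 0 < r) (large : Large⁺ r) where

    q>0 : 0 < 243 * r
    q>0 = *-mono-≤ {1} {243} (s≤s z≤n) r>0

    q₂>0 : 0 < grow k (grow k (243 * r))
    q₂>0 = grow-> k (grow-> k q>0)

    few₃ : r * T₃ ≤ N * N * N
    few₃ = *-cancelˡ-≤ 243 (begin
      243 * (r * T₃)                               ≡⟨ sym (*-assoc 243 r T₃) ⟩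
      243 * r * T₃                                 ≡⟨ cong (243 * r *_) T₃≡ ⟩
      243 * r * ∑ g3 (λ x → 𝟙 (triangle x))        ≤⟨ <⇒≤ (few-triangles short (243 * r) q>0
                                                       (Large-anti (≤-trans (q≤grow k q₂>0) (q≤grow k (grow-> k q₂>0))) large)) ⟩
      (3 * N) ^ 3                                  ≡⟨ lemma N ⟩
      27 * (N * N * N)                             ≤⟨ *-monoˡ-≤ (N * N * N) (m≤m+n 27 216) ⟩
      243 * (N * N * N)                            ∎)
      where
      open ≤-Reasoning
      lemma : ∀ N → 3 * N * (3 * N * (3 * N * 1)) ≡ 27 * (N * N * N)
      lemma = solve-∀

    few₅ : r * T₅ ≤ N * N * N * (N * N)
    few₅ = *-cancelˡ-≤ 243 (begin
      243 * (r * T₅)                               ≡⟨ sym (*-assoc 243 r T₅) ⟩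
      243 * r * T₅                                 ≡⟨ cong (243 * r *_) T₅≡ ⟩
      243 * r * ∑ g5 (λ x → 𝟙 (pentagon x))        ≤⟨ <⇒≤ (few-pentagons short (243 * r) q>0 large) ⟩
      (3 * N) ^ 5                                  ≡⟨ lemma N ⟩
      243 * (N * N * N * (N * N))                  ∎)
      where
      open ≤-Reasoning
      lemma : ∀ N → 3 * N * (3 * N * (3 * N * (3 * N * (3 * N * 1)))) ≡ 243 * (N * N * N * (N * N))
      lemma = solve-∀

m≤2^m : ∀ m → m ≤ 2 ^ m
m≤2^m zero    = z≤n
m≤2^m (suc m) = +-mono-≤ (m^n>0 2 m) (≤-trans (m≤2^m m) (m≤m+n (2 ^ m) 0))

-- The gap between 2^(g+s) and 2^s yields a factor 2^(gt) = 2^(gτ) 2^(gτ). The first half, helped by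
-- 2^τ, pays for 2^(n+1); the second pays for that 2^τ together with Q^(2τ) = (Q²)^τ.
large-enough : ∀ t τ g s n Q → t ≡ τ + τ → suc n ≤ τ * g + τ → 2 * (Q * Q) ≤ 2 ^ g →
               2 * (Q ^ t * (2 ^ n * (2 ^ s) ^ t)) ≤ (2 ^ (g + s)) ^ t
large-enough _ τ g s n Q refl n≤ Q≤ = begin
  2 * (Q ^ (τ + τ) * (2 ^ n * M))                        ≡⟨ lemma (Q ^ (τ + τ)) (2 ^ n) M ⟩
  2 ^ suc n * Q ^ (τ + τ) * M                            ≤⟨ *-monoˡ-≤ M (*-mono-≤ (^-monoʳ-≤ 2 n≤) ≤-refl) ⟩
  2 ^ (τ * g + τ) * Q ^ (τ + τ) * M                      ≡⟨ cong (_* M) (cong₂ _*_ (trans (^-distribˡ-+-* 2 (τ * g) τ)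
                                                              (cong (_* 2 ^ τ) (trans (cong (2 ^_) (*-comm τ g)) (sym (^-*-assoc 2 g τ)))))
                                                              (^-distribˡ-+-* Q τ τ)) ⟩
  (2 ^ g) ^ τ * 2 ^ τ * (Q ^ τ * Q ^ τ) * M              ≡⟨ cong (_* M) (trans (*-assoc ((2 ^ g) ^ τ) _ _) (cong ((2 ^ g) ^ τ *_)
                                                              (trans (cong (2 ^ τ *_) (sym (^-distrib-* τ Q Q))) (sym (^-distrib-* τ 2 (Q * Q)))))) ⟩
  (2 ^ g) ^ τ * (2 * (Q * Q)) ^ τ * M                    ≤⟨ *-monoˡ-≤ M (*-monoʳ-≤ ((2 ^ g) ^ τ) (^-monoˡ-≤ τ Q≤)) ⟩
  (2 ^ g) ^ τ * (2 ^ g) ^ τ * M                          ≡⟨ cong (_* M) (sym (^-distribˡ-+-* (2 ^ g) τ τ)) ⟩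
  (2 ^ g) ^ (τ + τ) * M                                  ≡⟨ trans (sym (^-distrib-* (τ + τ) (2 ^ g) (2 ^ s)))
                                                              (cong (_^ (τ + τ)) (sym (^-distribˡ-+-* 2 g s))) ⟩
  (2 ^ (g + s)) ^ (τ + τ)                                ∎
  where
  open ≤-Reasoning
  M = (2 ^ s) ^ (τ + τ)
  lemma : ∀ a b c → 2 * (a * (b * c)) ≡ 2 * b * a * c
  lemma = solve-∀

-- Not imported earlier, because the prefix + would make the sections (x +_) ambiguous.
open import Data.Integer using (+_; +[1+_])
open import Data.Rational using (ℚ; mkℚ; Positive; toℚᵘ; _/_) renaming (_*_ to _*ℚ_; _≤_ to _≤ℚ_)

-- Choice of the parameters

module Core (K : ℕ) (K≥ : 100 * 100 ≤ K) where

  -- `r` is what `good-edge` asks of the cycle counts, and `Q` is the density parameter after four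
  -- blow-ups. In `ℓ₀`, the first term gives l/8 ≥ 2Q², hence 2^(l/8) ≥ 2Q²; the second gives N ≥
  -- 32K, which makes 1 + |G| ≤ 4N negligible against N²/K.
  h H p r Q ℓ₀ : ℕ
  h = 24 * K
  H = 1 + h + h * h
  p = 8 * K * H
  r = 1440 * p
  Q = grow 5 (grow 5 (grow 5 (grow 5 (243 * r))))
  ℓ₀ = 2 * (Q * Q) * 8 + 32 * K

  K>0 : 0 < K
  K>0 = ≤-trans (s≤s z≤n) K≥

  r>0 : 0 < r
  r>0 = *-mono-≤ {1} {1440} (s≤s z≤n) (*-mono-≤ {1} {8 * K} (*-mono-≤ {1} {8} (s≤s z≤n) K>0) (s≤s z≤n))

  module _ (l : ℕ) (l≥ : ℓ₀ ≤ l) (G : Family (suc (2 * l)))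
           (generates : 16 * K * nonGenerated2 G ≤ 2 ^ suc (2 * l)) (small : card G ≤ 3 * 2 ^ l) where

    N n g s W : ℕ
    N = 2 ^ l
    n = suc (2 * l)
    g = l ℕ./ 8
    s = l ∸ g
    W = nonGenerated2 G + 1 + card G

    open Members G
    open Graph gs

    N>0 : 0 < N
    N>0 = m^n>0 2 l

    2^n : 2 ^ n ≡ 2 * (N * N)
    2^n = cong (2 *_) (2^[2l] l)

    8g≤l : g * 8 ≤ l
    8g≤l = ≤-trans (m≤n+m (g * 8) (l ℕ.% 8)) (≤-reflexive (sym (m≡m%n+[m/n]*n l 8)))

    l≤8g+7 : l ≤ g * 8 + 7
    l≤8g+7 = ≤-trans (≤-reflexive (trans (m≡m%n+[m/n]*n l 8) (+-comm (l ℕ.% 8) (g * 8))))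
                     (+-monoʳ-≤ (g * 8) (s≤s⁻¹ (m%n<n l 8)))

    g+s : g + s ≡ l
    g+s = m+[n∸m]≡n (≤-trans (m≤m*n g 8) 8g≤l)

    -- With s about 7l/8, five large sets have total size above 35l/8, more than the 4l + 2 that a
    -- cyclically disjoint quintuple allows.
    short : n + n < 5 * suc s
    short = begin
      suc (n + n)                       ≡⟨ lemma₁ l ⟩
      4 * l + 3                         ≡⟨ cong (λ x → 4 * x + 3) (sym g+s) ⟩
      4 * (g + s) + 3                   ≡⟨ lemma₂ g s ⟩
      4 * s + (4 * g) + 3               ≤⟨ +-mono-≤ (+-monoʳ-≤ (4 * s) 4g≤s) (m≤m+n 3 2) ⟩
      4 * s + s + 5                     ≡⟨ lemma₃ s ⟩
      5 * suc s                         ∎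
      where
      open ≤-Reasoning
      lemma₁ : ∀ l → suc (suc (2 * l) + suc (2 * l)) ≡ 4 * l + 3
      lemma₁ = solve-∀
      lemma₂ : ∀ g s → 4 * (g + s) + 3 ≡ 4 * s + (4 * g) + 3
      lemma₂ = solve-∀
      lemma₃ : ∀ s → 4 * s + s + 5 ≡ 5 * suc s
      lemma₃ = solve-∀
      lemma₄ : ∀ g → g + 4 * g + 3 * g ≡ g * 8
      lemma₄ = solve-∀
      4g≤s : 4 * g ≤ s
      4g≤s = +-cancelˡ-≤ g (4 * g) s (≤-trans (m≤m+n (g + 4 * g) (3 * g))
        (≤-trans (≤-reflexive (lemma₄ g)) (≤-trans 8g≤l (≤-reflexive (sym g+s)))))

    Q≤ : 2 * (Q * Q) ≤ 2 ^ g
    Q≤ = ≤-trans (≤-reflexive (sym (m*n/n≡m (2 * (Q * Q)) 8)))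
          (≤-trans (/-monoˡ-≤ 8 (≤-trans (m≤m+n (2 * (Q * Q) * 8) (32 * K)) l≥)) (m≤2^m g))

    -- Tuples of length 32 = 2 * 16 match g = l/8: since l ≤ 8g + 7, the exponent n + 1 = 2l + 2 is
    -- at most 16g + 16.
    large : 2 * (Q ^ (2 ^ 5) * (2 ^ n * (2 ^ s) ^ (2 ^ 5))) ≤ N ^ (2 ^ 5)
    large = subst (λ x → 2 * (Q ^ (2 ^ 5) * (2 ^ n * (2 ^ s) ^ (2 ^ 5))) ≤ (2 ^ x) ^ (2 ^ 5)) g+s
      (large-enough (2 ^ 5) 16 g s n Q refl (≤-trans (*-monoʳ-≤ 2 (s≤s l≤8g+7) ∙ lemma₀ l) (≤-reflexive (lemma g))) Q≤)
      where
      lemma₀ : ∀ l → suc (suc (2 * l)) ≡ 2 * suc l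
      lemma₀ = solve-∀
      lemma : ∀ g → 2 * suc (g * 8 + 7) ≡ 16 * g + 16
      lemma = solve-∀
      _∙_ : ∀ {a b c} → b ≤ c → a ≡ b → a ≤ c
      le ∙ refl = le

    32K≤N : 32 * K ≤ N
    32K≤N = ≤-trans (m≤n+m (32 * K) (2 * (Q * Q) * 8)) (≤-trans l≥ (m≤2^m l))

    W-small : 4 * K * W ≤ N * N
    W-small = *-cancelˡ-≤ 4 (begin
      4 * (4 * K * W)                                        ≡⟨ lemma₁ K (nonGenerated2 G) (card G) ⟩
      16 * K * nonGenerated2 G + 16 * K * (1 + card G)       ≤⟨ +-mono-≤ (≤-trans generates (≤-reflexive 2^n))
                                                                 (*-monoʳ-≤ (16 * K) (≤-trans (+-mono-≤ N>0 small) (≤-reflexive (lemma₂ N)))) ⟩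
      2 * (N * N) + 16 * K * (4 * N)                         ≡⟨ cong (λ x → 2 * (N * N) + x) (lemma₃ K N) ⟩
      2 * (N * N) + 2 * (32 * K * N)                         ≤⟨ +-monoʳ-≤ (2 * (N * N)) (*-monoʳ-≤ 2 (*-monoˡ-≤ N 32K≤N)) ⟩
      2 * (N * N) + 2 * (N * N)                              ≡⟨ lemma₄ (N * N) ⟩
      4 * (N * N)                                            ∎)
      where
      open ≤-Reasoning
      lemma₁ : ∀ K x c → 4 * (4 * K * (x + 1 + c)) ≡ 16 * K * x + 16 * K * (1 + c)
      lemma₁ = solve-∀
      lemma₂ : ∀ N → N + 3 * N ≡ 4 * N
      lemma₂ = solve-∀
      lemma₃ : ∀ K N → 16 * K * (4 * N) ≡ 2 * (32 * K * N)
      lemma₃ = solve-∀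
      lemma₄ : ∀ x → 2 * x + 2 * x ≡ 4 * x
      lemma₄ = solve-∀

    dense : 79 * (N * N) ≤ 20 * E
    dense = +-cancelʳ-≤ (N * N) (79 * (N * N)) (20 * E) (begin
      79 * (N * N) + N * N            ≡⟨ lemma₁ (N * N) ⟩
      20 * (2 * (2 * (N * N)))        ≡⟨ cong (λ x → 20 * (2 * x)) (sym 2^n) ⟩
      20 * (2 * 2 ^ n)                ≤⟨ *-monoʳ-≤ 20 (Edges.many-edges G) ⟩
      20 * (E + 2 * W)                ≡⟨ lemma₂ E W ⟩
      20 * E + 4 * 10 * W             ≤⟨ +-monoʳ-≤ (20 * E) (≤-trans (*-monoˡ-≤ W (*-monoʳ-≤ 4 (≤-trans (m≤m+n 10 9990) K≥))) W-small) ⟩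
      20 * E + N * N                  ∎)
      where
      open ≤-Reasoning
      lemma₁ : ∀ x → 79 * x + x ≡ 20 * (2 * (2 * x))
      lemma₁ = solve-∀
      lemma₂ : ∀ e w → 20 * (e + 2 * w) ≡ 20 * e + 4 * 10 * w
      lemma₂ = solve-∀

    open FewCycles gs sparse N N>0 small 5 s short

    bipartite : Bipartition G N K
    bipartite = let u , v , degrees , penalty = good-edge N N>0 small p dense (few₃ r r>0 large) (few₅ r r>0 large)
                in Splitting.FromEdge.bipartition G N K N>0 K>0 small u v degrees penalty W-small

    open Bipartition bipartite

    close : Σ (Subset n) λ S → ∣ S ∣ ≡ l × K * card (G Δ F₀ S) ≤ 200 * N
    close = let S , ∣S∣≡l , near = Stability.stability l (# F) Λ F-small Λ≤ G X Y F refl X⊆G Y⊆G G⊆X∪Y∪F size covering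
            in S , ∣S∣≡l , *-cancelˡ-≤ N {{>-nonZero N>0}} (begin
                 N * (K * card (G Δ F₀ S))      ≡⟨ lemma₁ N K (card (G Δ F₀ S)) ⟩
                 K * (N * card (G Δ F₀ S))      ≤⟨ *-monoʳ-≤ K near ⟩
                 K * (200 * Λ)                  ≡⟨ lemma₂ K Λ ⟩
                 200 * (K * Λ)                  ≤⟨ *-monoʳ-≤ 200 Λ-small ⟩
                 200 * (N * N)                  ≡⟨ lemma₃ N ⟩
                 N * (200 * N)                  ∎)
      where
      open ≤-Reasoning
      lemma₁ : ∀ N K c → N * (K * c) ≡ K * (N * c)
      lemma₁ = solve-∀
      lemma₂ : ∀ K x → K * (200 * x) ≡ 200 * (K * x)
      lemma₂ = solve-∀
      lemma₃ : ∀ x → 200 * (x * x) ≡ x * (200 * x)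
      lemma₃ = solve-∀
      Λ≤ : 100 * (100 * Λ) ≤ N * N
      Λ≤ = ≤-trans (≤-reflexive (sym (*-assoc 100 100 Λ))) (≤-trans (*-monoˡ-≤ Λ K≥) Λ-small)

-- Between rational and natural inequalities

integer : ∀ m → toℚᵘ ((+ m) / 1) ≃ᵘ mkℚᵘ (+ m) 0
integer m = toℚᵘ-fromℚᵘ (mkℚᵘ (+ m) 0)

scaled : ∀ q m → toℚᵘ (q *ℚ ((+ m) / 1)) ≃ᵘ toℚᵘ q *ᵘ mkℚᵘ (+ m) 0
scaled q m = ℚᵘ.≃-trans (toℚᵘ-homo-* q ((+ m) / 1)) (ℚᵘ.*-congˡ {toℚᵘ q} (integer m))

unit-fraction : ℕ → ℚ
unit-fraction j = mkℚ (+ 1) j (1-coprimeTo (suc j))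

≤unit-fraction : ∀ j a b → ((+ a) / 1) ≤ℚ (unit-fraction j *ℚ ((+ b) / 1)) → a * suc j ≤ b
≤unit-fraction j a b h
  with *≤* le ← ℚᵘ.≤-respˡ-≃ (integer a) (ℚᵘ.≤-respʳ-≃ (scaled (unit-fraction j) b) (toℚᵘ-mono-≤ h)) =
  ℤ.drop‿+≤+ (subst₂ ℤ._≤_ (trans (cong (λ x → + a ℤ.* + x) (*-identityʳ (suc j))) (sym (ℤ.pos-* a (suc j))))
    (trans (ℤ.*-identityʳ _) (ℤ.*-identityˡ (+ b))) le)

≤fraction : ∀ k j .(c : Coprime (suc k) (suc j)) a b → suc j * a ≤ b → ((+ a) / 1) ≤ℚ (mkℚ +[1+ k ] j c *ℚ ((+ b) / 1))
≤fraction k j c a b h = toℚᵘ-cancel-≤ (ℚᵘ.≤-respˡ-≃ (ℚᵘ.≃-sym (integer a))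
  (ℚᵘ.≤-respʳ-≃ (ℚᵘ.≃-sym (scaled (mkℚ +[1+ k ] j c) b)) (*≤* (subst₂ ℤ._≤_ (ℤ.pos-* a (suc j * 1))
    (trans (ℤ.pos-* (suc k) b) (sym (ℤ.*-identityʳ _)))
    (ℤ.+≤+ (≤-trans (≤-reflexive (trans (cong (a *_) (*-identityʳ (suc j))) (*-comm a (suc j)))) (≤-trans h (m≤n*m b (suc k)))))))))

theorem3 : (ε′ : ℚ) → Positive ε′ →
    Σ ℚ λ δ → Positive δ × Σ ℕ λ ℓ₀ →
    (ℓ : ℕ) → ℓ₀ ≤ ℓ →
    (G : Family (suc (2 * ℓ))) →
    ((+ nonGenerated2 G) / 1) ≤ℚ (δ *ℚ ((+ (2 ^ suc (2 * ℓ))) / 1)) →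
    card G ≤ 3 * 2 ^ ℓ →
    Σ (Subset (suc (2 * ℓ))) λ S → ∣ S ∣ ≡ ℓ ×
    ((+ card (G Δ F₀ S)) / 1) ≤ℚ (ε′ *ℚ ((+ (2 ^ ℓ)) / 1))
theorem3 (mkℚ +[1+ k ] j c) _ = unit-fraction (16 * K) , _ , Core.ℓ₀ K K≥ , λ l l≥ G generates small →
    let S , ∣S∣≡l , near = Core.close K K≥ l l≥ G (generated-ℕ l G generates) small
    in S , ∣S∣≡l , ≤fraction k j c (card (G Δ F₀ S)) (2 ^ l) (*-cancelˡ-≤ 200 (begin
         200 * (suc j * card (G Δ F₀ S))            ≡⟨ sym (*-assoc 200 (suc j) (card (G Δ F₀ S))) ⟩
         200 * suc j * card (G Δ F₀ S)              ≤⟨ *-monoˡ-≤ (card (G Δ F₀ S)) (*-monoˡ-≤ (suc j) (m≤m+n 200 9800)) ⟩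
         K * card (G Δ F₀ S)                        ≤⟨ near ⟩
         200 * 2 ^ l                                ∎))
  where
  open ≤-Reasoning
  K : ℕ
  -- `ε′` is at least 1/(j+1), so the bound 200N/K of `Core.close` is small enough once K ≥
  -- 200(j+1); the larger factor 10⁴ is the precision assumed in `Numerics`.
  K = 100 * 100 * suc j
  K≥ : 100 * 100 ≤ K
  K≥ = m≤m*n (100 * 100) (suc j)
  generated-ℕ : ∀ l (G : Family (suc (2 * l))) →
                ((+ nonGenerated2 G) / 1) ≤ℚ (unit-fraction (16 * K) *ℚ ((+ (2 ^ suc (2 * l))) / 1)) →
                16 * K * nonGenerated2 G ≤ 2 ^ suc (2 * l)
  -- `unit-fraction (16 * K)` has denominator 16K + 1, so one unit is given away.
  generated-ℕ l G h = ≤-trans (*-monoˡ-≤ (nonGenerated2 G) (n≤1+n (16 * K)))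
    (≤-trans (≤-reflexive (*-comm (suc (16 * K)) (nonGenerated2 G))) (≤unit-fraction (16 * K) (nonGenerated2 G) (2 ^ suc (2 * l)) h))
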